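{- Let $r$ be a positive integer, let $t$ be a positive integer such that $t^4\le 2^r$, and let $a$ be any nonzero element of the finite field $\mathbb{F}_{2^r}$. Then the function $\mathbb{F}_{2^r}\to\mathbb{F}_{2^r}$, $c\mapsto ac^t$, is planar on $\mathbb{F}_{2^r}$ if and only if $t$ is a power of $2$.
   Context: Let $q$ be a power of $2$. A function $f\colon\mathbb{F}_q\to\mathbb{F}_q$ is called planar (in Zhou's sense for characteristic $2$) if, for every $b\in\mathbb{F}_q^*$, the function $c\mapsto f(c+b)+f(c)+bc$ is a bijection on $\mathbb{F}_q$. Powers of $2$ include $1=2^0$. -}

module Defs where

open import Level using (0ℓ)
open import Data.Nat using (ℕ; zero; suc; _^_)
open import Data.Fin using (Fin)
open import Data.Product using (∃; _×_)
open import Relation.Nullary using (¬_)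
open import Relation.Binary.PropositionalEquality using (_≡_)
open import Algebra.Bundles using (CommutativeRing)
open import Function.Definitions using (Bijective)

record FiniteField (q : ℕ) : Set₁ where
  field
    commRing : CommutativeRing 0ℓ 0ℓ
  open CommutativeRing commRing public
  field
    0≉1       : ¬ (0# ≈ 1#)
    inverse   : ∀ x → ¬ (x ≈ 0#) → ∃ λ y → x * y ≈ 1#
    enum      : Fin q → Carrier
    enum-inj  : ∀ i j → enum i ≈ enum j → i ≡ j
    enum-surj : ∀ x → ∃ λ i → enum i ≈ x

  pow : Carrier → ℕ → Carrier
  pow x zero    = 1#
  pow x (suc n) = x * pow x n

-- Planarity (Zhou's sense, characteristic 2): for every nonzero b,
-- c ↦ f(c+b) + f(c) + b c is a bijection of the field.
Planar : ∀ {q} (F : FiniteField q) → (FiniteField.Carrier F → FiniteField.Carrier F) → Set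
Planar F f = ∀ b → ¬ (b ≈ 0#) → Bijective _≈_ _≈_ (λ c → (f (c + b) + f c) + b * c)
  where open FiniteField F

IsPowerOf2 : ℕ → Set
IsPowerOf2 t = ∃ λ k → t ≡ 2 ^ k

{-# OPTIONS --safe #-}
module Submission where

-- If t = 2^k, the function c ↦ a(c+b)^t + ac^t + bc is affine in c with linear part bc. Conversely let t ≥ 3.
--
-- Let t = 2^v + 2^(v+i) have binary weight two, and write φₛ x = x^(2^s). The symmetric bilinear form
-- B(b,c) = a(φ_{v+i} b φ_v c + φ_v b φ_{v+i} c) + bc has no nontrivial zero, hence neither has its trace adjoint
-- Λ(w,X), and ∑ w^(t-2) Λ(w,X)^(q-1) = 0. In the expansion of the power, indexed by pairs of r-digit
-- binary numbers, the nonzero terms are symmetric in the pair (a carry argument), so only the diagonal remains.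
-- There t⁴ ≤ 2^r allows a single term, and its value is a².
--
-- Let t have weight at least three. With i^Q(x) for the Z/4-valued quadratic form Q polarising to 2 Tr(xy),
-- planarity makes the sums ∑ₓ i^Q(x) (-1)^Tr(ux^t + μx), u = az^(t-2), of norm q, so they are π^r times odd
-- Gaussian integers, π = 1 + i. Substituting z ↦ z/x in a sum over z and x turns ux^t into a term quadratic in x;
-- comparing iterated differences modulo powers of π gives an identity in the field, whose coefficient
-- at exponents dictated by the binary digits of t is a. Hence a = 0.

open import Defs
open import Level using (0ℓ)
open import Data.Nat.Base as ℕ using (ℕ; zero; suc; pred; s≤s; z≤n; NonZero)
import Data.Nat.Properties as ℕₚ
import Data.Nat.DivMod as ℕ/
open import Data.Nat.Divisibility as ∣ using (_∣_; divides)
open import Data.Fin.Base as Fin using (Fin; zero; suc)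
import Data.Fin.Properties as Finₚ
open import Data.Fin.Permutation using (permutation)
open import Data.Product using (∃; _×_; _,_; proj₁; proj₂)
open import Data.Sum using (_⊎_; inj₁; inj₂; [_,_]′)
open import Data.Empty using (⊥; ⊥-elim)
open import Function using (_∘_; id)
open import Relation.Nullary using (¬_; Dec; yes; no)
open import Relation.Nullary.Negation using (contradiction)
open import Relation.Binary.PropositionalEquality
open import Algebra.Structures using (IsCommutativeRing; IsCommutativeMonoid)
open import Algebra.Core using (Op₁; Op₂)
import Algebra.Properties.CommutativeMonoid.Sum as CMSum
import Algebra.Properties.Semiring.Sum as SSum
import Algebra.Properties.Semiring.Exp as SExp
import Algebra.Properties.Semiring.Mult as SMult
import Algebra.Properties.CommutativeSemiring.Exp as CSExp
import Algebra.Properties.Ring as RingP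
open import Relation.Nullary.Decidable using (¬?)
open import Relation.Binary.Definitions using (tri<; tri≈; tri>)
open import Data.Integer.Base as ℤ using (ℤ; -[1+_]; 0ℤ; 1ℤ)
import Data.Integer.Properties as ℤₚ
open import Data.Integer.Tactic.RingSolver using () renaming (solve-∀ to solveℤ)
open import Data.Nat.Tactic.RingSolver using () renaming (solve-∀ to solveℕ)
open import Data.Bool.Base using (Bool; true; false)
open import Data.Vec.Base as Vec using (Vec; []; _∷_; replicate; _∷ʳ_)
open import Data.Nat.Induction using (<-rec)
open import Data.Vec.Relation.Unary.All as All using (All; []; _∷_)
open import Data.Vec.Relation.Unary.AllPairs as AllPairs using (AllPairs; []; _∷_)
import Data.Vec.Relation.Unary.All.Properties as Allₚ
import Data.Vec.Relation.Unary.AllPairs.Properties as AllPairsₚ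
open import Function.Bundles using (_⇔_; mk⇔)
open import Algebra.Bundles using (CommutativeMonoid; CommutativeRing; RawRing)
open import Algebra.Morphism.Structures using (IsRingMonomorphism)
import Algebra.Morphism.RingMonomorphism as RingMono

-- Why weight three: n differences in `β` multiply the side that carries only characters by 2ⁿ,
-- which is π^(2n) up to a unit, and parity gives one more π. On the side that carries `P̄` each of
-- n + 1 differences gains a single π, and the character in `ν` gives two. The comparison 2n + 1 > n
-- + 3 starts at n = 3, so two digits give no information and weight two needs an argument of its
-- own. The leading coefficient at level n + 3 is a field element, a sum over matchings in traces,
-- and power sums over the field extract its coefficients. The exponents must be distinct, which
-- removes the matchings among the differences, and must avoid 2 = 2^1, which would contribute a
-- second `a` and cancel the first. The bound on t is tight for t = 1 + 2^s: the digit argument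
-- there needs 4s + 1 ≤ r, and this is what 2^(4s) < t⁴ ≤ 2^r provides.

-- Fields carried by `Fin q`, with decidable propositional equality, and finite sums.

record Field (q : ℕ) : Set where
  field
    _+_ _*_ : Op₂ (Fin q)
    -_ : Op₁ (Fin q)
    0# 1# : Fin q
    isCommutativeRing : IsCommutativeRing _≡_ _+_ _*_ -_ 0# 1#
    0≢1 : 0# ≢ 1#
    inverse : ∀ x → x ≢ 0# → ∃ λ y → x * y ≡ 1#
  commutativeRing : CommutativeRing 0ℓ 0ℓ
  commutativeRing = record { isCommutativeRing = isCommutativeRing }

module Sums {A : Set} {_∙_ : Op₂ A} {ε : A} (isCM : IsCommutativeMonoid _≡_ _∙_ ε) where
  M : CommutativeMonoid 0ℓ 0ℓ
  M = record { isCommutativeMonoid = isCM }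
  open CommutativeMonoid M using (identityˡ; identityʳ; assoc; comm)
  open CMSum M public

  sum-reindex : ∀ {n} (f g : Fin n → Fin n) → (∀ i → f (g i) ≡ i) → (∀ i → g (f i) ≡ i) →
    ∀ (h : Fin n → A) → sum h ≡ sum (h ∘ f)
  sum-reindex f g fg gf h = sum-permute h (permutation f g fg gf)

  sum-ε : ∀ {n} {h : Fin n → A} → (∀ i → h i ≡ ε) → sum h ≡ ε
  sum-ε {n} eq = trans (sum-cong-≗ eq) (sum-replicate-zero n)

  sum-single : ∀ {n} (k : Fin n) (h : Fin n → A) → (∀ i → i ≢ k → h i ≡ ε) → sum h ≡ h k
  sum-single zero h eq = trans (cong (h zero ∙_) (sum-ε {h = h ∘ suc} λ i → eq (suc i) λ ())) (identityʳ _)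
  sum-single (suc k) h eq = trans (cong (λ e → e ∙ sum (h ∘ suc)) (eq zero λ ())) (trans (identityˡ _)
    (sum-single k (h ∘ suc) λ i ne → eq (suc i) (ne ∘ Finₚ.suc-injective)))

-- Arithmetic of a field with 2^r elements: characteristic, polynomials, power sums.

module FieldTheory {r : ℕ} (F : Field (2 ℕ.^ r)) (1≤r : 1 ℕ.≤ r) where
  open CommutativeRing (Field.commutativeRing F) public
    using (_+_; _*_; -_; 0#; 1#; +-assoc; +-comm; +-identityˡ; +-identityʳ; *-assoc; *-comm; *-identityˡ; *-identityʳ;
           distribˡ; distribʳ; zeroˡ; zeroʳ; -‿inverseˡ; -‿inverseʳ; ring; semiring; commutativeSemiring;
           +-isCommutativeMonoid; *-isCommutativeMonoid)
  open Field F using (0≢1; inverse) public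
  open ≡-Reasoning

  q q-1 : ℕ
  q = 2 ℕ.^ r
  q-1 = pred q

  K : Set
  K = Fin q

  open SExp semiring public using (_^_; ^-homo-*; ^-assocʳ)
  open CSExp commutativeSemiring public using (^-distrib-*)
  open SMult semiring public using (×1-homo-*; ×-homo-1; ×-assoc-*) renaming (_×_ to _⨯_)
  module Sum = Sums +-isCommutativeMonoid
  module Prod = Sums *-isCommutativeMonoid
  open Sum public using (sum-cong-≗; ∑-comm; ∑-distrib-+; sum-ε; sum-single; sum-reindex)
  open SSum semiring public using (*-distribˡ-sum; *-distribʳ-sum)
  module R = RingP ring

  ∑ : (K → K) → K
  ∑ = Sum.sum {q}

  infix 4 _≟_
  _≟_ : (x y : K) → Dec (x ≡ y)
  _≟_ = Finₚ._≟_

  q≡ : q ≡ suc q-1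
  q≡ = sym (ℕₚ.suc-pred q {{ℕₚ.m^n≢0 2 r}})

  instance
    q-1≢0 : NonZero q-1
    q-1≢0 = ℕ.>-nonZero (ℕₚ.pred-mono-≤ {2} {q} (subst (ℕ._≤ q) (ℕₚ.*-identityʳ 2) (ℕₚ.^-monoʳ-≤ 2 1≤r)))

  *-integral : ∀ x y → x * y ≡ 0# → x ≡ 0# ⊎ y ≡ 0#
  *-integral x y xy≡0 with x ≟ 0#
  ... | yes x≡0 = inj₁ x≡0
  ... | no x≢0 = let (x⁻¹ , xx⁻¹≡1) = inverse x x≢0 in inj₂ (begin
    y ≡⟨ *-identityˡ y ⟨
    1# * y ≡⟨ cong (_* y) (trans (*-comm _ _) xx⁻¹≡1) ⟨
    (x⁻¹ * x) * y ≡⟨ *-assoc _ _ _ ⟩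
    x⁻¹ * (x * y) ≡⟨ cong (x⁻¹ *_) xy≡0 ⟩
    x⁻¹ * 0# ≡⟨ zeroʳ _ ⟩
    0# ∎)

  *-nonzero : ∀ {x y} → x ≢ 0# → y ≢ 0# → x * y ≢ 0#
  *-nonzero x≢0 y≢0 eq = [ x≢0 , y≢0 ]′ (*-integral _ _ eq)

  +-cancel0 : ∀ {x y} → x + y ≡ x → y ≡ 0#
  +-cancel0 {x} {y} eq = R.+-cancelˡ x y 0# (trans eq (sym (+-identityʳ x)))

  2^×1 : ∀ n → (2 ℕ.^ n) ⨯ 1# ≡ (2 ⨯ 1#) ^ n
  2^×1 zero = ×-homo-1 1#
  2^×1 (suc n) = trans (×1-homo-* 2 (2 ℕ.^ n)) (cong (2 ⨯ 1# *_) (2^×1 n))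

  -- Translation by 1 permutes the field, so adding q times 1 leaves the sum of all elements
  -- unchanged.
  q×1≡0 : q ⨯ 1# ≡ 0#
  q×1≡0 = +-cancel0 {∑ id} (begin
    ∑ id + q ⨯ 1# ≡⟨ cong (∑ id +_) (Sum.sum-replicate q) ⟨
    ∑ id + ∑ (λ _ → 1#) ≡⟨ ∑-distrib-+ id (λ _ → 1#) ⟨
    ∑ (_+ 1#) ≡⟨ sum-reindex (_+ 1#) (_+ (- 1#))
      (λ x → trans (+-assoc x _ _) (trans (cong (x +_) (-‿inverseˡ 1#)) (+-identityʳ x)))
      (λ x → trans (+-assoc x _ _) (trans (cong (x +_) (-‿inverseʳ 1#)) (+-identityʳ x))) id ⟨
    ∑ id ∎)

  ^-integral : ∀ {x} n → x ^ n ≡ 0# → x ≡ 0#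
  ^-integral zero eq = contradiction (sym eq) 0≢1
  ^-integral {x} (suc n) eq = [ id , ^-integral n ]′ (*-integral x (x ^ n) eq)

  -- The 2^r-fold multiple of 1 is the r-th power of 1 + 1, and a field has no nilpotent elements.
  1+1≡0 : 1# + 1# ≡ 0#
  1+1≡0 = trans (cong (1# +_) (sym (+-identityʳ 1#))) (^-integral r (trans (sym (2^×1 r)) q×1≡0))

  x+x≡0 : ∀ x → x + x ≡ 0#
  x+x≡0 x = begin
    x + x ≡⟨ cong₂ _+_ (*-identityˡ x) (*-identityˡ x) ⟨
    1# * x + 1# * x ≡⟨ distribʳ x 1# 1# ⟨
    (1# + 1#) * x ≡⟨ cong (_* x) 1+1≡0 ⟩
    0# * x ≡⟨ zeroˡ x ⟩
    0# ∎

  x+[x+y]≡y : ∀ x y → x + (x + y) ≡ y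
  x+[x+y]≡y x y = trans (sym (+-assoc x x y)) (trans (cong (_+ y) (x+x≡0 x)) (+-identityˡ y))

  [x+y]+y≡x : ∀ x y → (x + y) + y ≡ x
  [x+y]+y≡x x y = trans (+-assoc x y y) (trans (cong (x +_) (x+x≡0 y)) (+-identityʳ x))

  x+y≡0⇒x≡y : ∀ {x y} → x + y ≡ 0# → x ≡ y
  x+y≡0⇒x≡y {x} {y} eq = trans (sym ([x+y]+y≡x x y)) (trans (cong (_+ y) eq) (+-identityˡ y))

  *-cancelˡ : ∀ {x y z} → x ≢ 0# → x * y ≡ x * z → y ≡ z
  *-cancelˡ {x} {y} {z} x≢0 eq with *-integral x (y + z) (trans (distribˡ x y z) (trans (cong (_+ x * z) eq) (x+x≡0 _)))
  ... | inj₁ x≡0 = contradiction x≡0 x≢0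
  ... | inj₂ y+z≡0 = x+y≡0⇒x≡y y+z≡0

  open import Algebra.Solver.Ring.NaturalCoefficients.Default commutativeSemiring public
    using () renaming (solve to solveF; _:+_ to _⊕_; _:*_ to _⊗_; _:=_ to _⊜_)

  0^ : ∀ {n} → 0 ℕ.< n → 0# ^ n ≡ 0#
  0^ {suc n} _ = zeroˡ _

  ^-nonzero : ∀ {x} n → x ≢ 0# → x ^ n ≢ 0#
  ^-nonzero n x≢0 eq = x≢0 (^-integral n eq)

  1^ : ∀ n → 1# ^ n ≡ 1#
  1^ zero = refl
  1^ (suc n) = trans (*-identityˡ _) (1^ n)

  -- Lagrange's theorem for the multiplicative group: multiplication by a permutes the field.
  ^q : ∀ x → x ^ q ≡ x
  ^q a with a ≟ 0#
  ... | yes refl = 0^ (ℕₚ.m^n>0 2 r)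
  ... | no a≢0 = begin
      a ^ q ≡⟨ Prod.sum-replicate q ⟨
      Prod.sum {q} (λ _ → a) ≡⟨ Prod.sum-cong-≗ split ⟩
      Prod.sum (λ x → c x * d x) ≡⟨ Prod.∑-distrib-+ c d ⟩
      Prod.sum c * Prod.sum d ≡⟨ cong (Prod.sum c *_) ∏d≡1 ⟩
      Prod.sum c * 1# ≡⟨ *-identityʳ _ ⟩
      Prod.sum c ≡⟨ Prod.sum-single 0# c c-off ⟩
      c 0# ≡⟨ c0 ⟩
      a ∎
    where
    a⁻¹ = proj₁ (inverse a a≢0)
    aa⁻¹ = proj₂ (inverse a a≢0)
    -- The constant `a` is split as `c x * d x`, with `c` equal to 1 off zero and `d` equal to 1 at
    -- zero; `N` replaces 0 by 1, so that its product can be cancelled.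
    c d N : K → K
    c x with x ≟ 0#
    ... | yes _ = a
    ... | no _ = 1#
    d x with x ≟ 0#
    ... | yes _ = 1#
    ... | no _ = a
    N x with x ≟ 0#
    ... | yes _ = 1#
    ... | no _ = x
    c0 : c 0# ≡ a
    c0 with 0# ≟ 0#
    ... | yes _ = refl
    ... | no ne = contradiction refl ne
    c-off : ∀ x → x ≢ 0# → c x ≡ 1#
    c-off x x≢0 with x ≟ 0#
    ... | yes eq = contradiction eq x≢0
    ... | no _ = refl
    split : ∀ x → a ≡ c x * d x
    split x with x ≟ 0#
    ... | yes _ = sym (*-identityʳ a)
    ... | no _ = sym (*-identityˡ a)
    N-mul : ∀ x → N (a * x) ≡ d x * N x
    N-mul x with x ≟ 0# | a * x ≟ 0#
    ... | yes _ | yes _ = sym (*-identityˡ 1#)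
    ... | yes refl | no ne = contradiction (zeroʳ a) ne
    ... | no x≢0 | yes eq = contradiction eq (*-nonzero a≢0 x≢0)
    ... | no _ | no _ = refl
    N≢0 : ∀ x → N x ≢ 0#
    N≢0 x eq with x ≟ 0#
    ... | yes _ = 0≢1 (sym eq)
    ... | no ne = ne eq
    ∏≢0 : ∀ {n} (h : Fin n → K) → (∀ i → h i ≢ 0#) → Prod.sum h ≢ 0#
    ∏≢0 {zero} h ne eq = 0≢1 (sym eq)
    ∏≢0 {suc n} h ne = *-nonzero (ne zero) (∏≢0 (h ∘ suc) (ne ∘ suc))
    mulinv : ∀ u v → u * v ≡ 1# → ∀ x → u * (v * x) ≡ x
    mulinv u v uv x = trans (sym (*-assoc u v x)) (trans (cong (_* x) uv) (*-identityˡ x))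
    ∏d≡1 : Prod.sum d ≡ 1#
    ∏d≡1 = *-cancelˡ (∏≢0 N N≢0) (begin
      Prod.sum N * Prod.sum d ≡⟨ *-comm _ _ ⟩
      Prod.sum d * Prod.sum N ≡⟨ Prod.∑-distrib-+ d N ⟨
      Prod.sum (λ x → d x * N x) ≡⟨ Prod.sum-cong-≗ N-mul ⟨
      Prod.sum (λ x → N (a * x)) ≡⟨ Prod.sum-reindex (a *_) (a⁻¹ *_) (mulinv a a⁻¹ aa⁻¹) (mulinv a⁻¹ a (trans (*-comm _ _) aa⁻¹)) N ⟨
      Prod.sum N ≡⟨ *-identityʳ _ ⟨
      Prod.sum N * 1# ∎)

  ^q-1 : ∀ {x} → x ≢ 0# → x ^ q-1 ≡ 1#
  ^q-1 {x} x≢0 = *-cancelˡ x≢0 (trans (cong (x ^_) (sym q≡)) (trans (^q x) (sym (*-identityʳ x))))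

  -- Positivity of `n` matters at zero, where the exponent 0 gives 1 and all others give 0.
  ^-wrap : ∀ x {n} → 0 ℕ.< n → x ^ (n ℕ.+ q-1) ≡ x ^ n
  ^-wrap x {suc n} _ = begin
    x ^ (suc n ℕ.+ q-1) ≡⟨ cong (x ^_) (trans (cong suc (ℕₚ.+-comm n q-1)) (cong (ℕ._+ n) (sym q≡))) ⟩
    x ^ (q ℕ.+ n) ≡⟨ ^-homo-* x q n ⟩
    x ^ q * x ^ n ≡⟨ cong (_* x ^ n) (^q x) ⟩
    x ^ suc n ∎

  ^-wraps : ∀ x {n} k → 0 ℕ.< n → x ^ (n ℕ.+ k ℕ.* q-1) ≡ x ^ n
  ^-wraps x {n} zero 0<n = cong (x ^_) (ℕₚ.+-identityʳ n)
  ^-wraps x {n} (suc k) 0<n = begin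
    x ^ (n ℕ.+ (q-1 ℕ.+ k ℕ.* q-1)) ≡⟨ cong (x ^_) (trans (cong (n ℕ.+_) (ℕₚ.+-comm q-1 _)) (sym (ℕₚ.+-assoc n _ q-1))) ⟩
    x ^ (n ℕ.+ k ℕ.* q-1 ℕ.+ q-1) ≡⟨ ^-wrap x (ℕₚ.≤-trans 0<n (ℕₚ.m≤m+n n _)) ⟩
    x ^ (n ℕ.+ k ℕ.* q-1) ≡⟨ ^-wraps x k 0<n ⟩
    x ^ n ∎

  -- Monic polynomials of degree m, lower coefficients in increasing order.
  evalM : ∀ {m} → Vec K m → K → K
  evalM [] x = 1#
  evalM (c ∷ cs) x = c + x * evalM cs x

  addM : ∀ {m} → K → Vec K (suc m) → Vec K m → Vec K (suc m)
  addM a (c ∷ []) [] = (c + a) ∷ []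
  addM a (c ∷ c′ ∷ cs) (d ∷ ds) = (c + a * d) ∷ addM a (c′ ∷ cs) ds

  evalM-addM : ∀ {m} a (cs : Vec K (suc m)) ds x → evalM (addM a cs ds) x ≡ evalM cs x + a * evalM ds x
  evalM-addM a (c ∷ []) [] x = solveF 4 (λ a c x o → (c ⊕ a) ⊕ x ⊗ o ⊜ (c ⊕ x ⊗ o) ⊕ a) refl a c x 1#
    ∙ cong (_ +_) (sym (*-identityʳ a))
    where _∙_ = trans
  evalM-addM a (c ∷ c′ ∷ cs) (d ∷ ds) x = trans (cong (λ e → c + a * d + x * e) (evalM-addM a (c′ ∷ cs) ds x))
    (solveF 6 (λ a c d x e f → (c ⊕ a ⊗ d) ⊕ x ⊗ (e ⊕ a ⊗ f) ⊜ (c ⊕ x ⊗ e) ⊕ a ⊗ (d ⊕ x ⊗ f)) refl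
      a c d x (evalM (c′ ∷ cs) x) (evalM ds x))

  -- Synthetic division: the quotient of f(x) + f(a) by x + a, signs being irrelevant in
  -- characteristic 2.
  quotM : ∀ {m} → K → Vec K (suc m) → Vec K m
  quotM a (c ∷ []) = []
  quotM a (c ∷ c′ ∷ cs) = addM a (c′ ∷ cs) (quotM a (c′ ∷ cs))

  evalM-quotM : ∀ {m} a (cs : Vec K (suc m)) x → evalM cs x + evalM cs a ≡ (x + a) * evalM (quotM a cs) x
  evalM-quotM a (c ∷ []) x = begin
    (c + x * 1#) + (c + a * 1#) ≡⟨ solveF 4 (λ c x a o → (c ⊕ x ⊗ o) ⊕ (c ⊕ a ⊗ o) ⊜ (c ⊕ c) ⊕ (x ⊕ a) ⊗ o) refl c x a 1# ⟩
    (c + c) + (x + a) * 1# ≡⟨ cong (λ e → e + (x + a) * 1#) (x+x≡0 c) ⟩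
    0# + (x + a) * 1# ≡⟨ +-identityˡ _ ⟩
    (x + a) * 1# ∎
  evalM-quotM a (c ∷ cs@(c′ ∷ cs′)) x = begin
    (c + x * E) + (c + a * A) ≡⟨ solveF 5 (λ c x a E A → (c ⊕ x ⊗ E) ⊕ (c ⊕ a ⊗ A) ⊜ (c ⊕ c) ⊕ (x ⊗ E ⊕ a ⊗ A)) refl c x a E A ⟩
    (c + c) + (x * E + a * A) ≡⟨ cong (λ e → e + (x * E + a * A)) (trans (x+x≡0 c) (sym (x+x≡0 (a * E)))) ⟩
    (a * E + a * E) + (x * E + a * A) ≡⟨ solveF 4 (λ x a E A → (a ⊗ E ⊕ a ⊗ E) ⊕ (x ⊗ E ⊕ a ⊗ A) ⊜ (x ⊕ a) ⊗ E ⊕ a ⊗ (E ⊕ A)) refl x a E A ⟩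
    (x + a) * E + a * (E + A) ≡⟨ cong (λ e → (x + a) * E + a * e) (evalM-quotM a cs x) ⟩
    (x + a) * E + a * ((x + a) * G) ≡⟨ solveF 4 (λ y a E G → y ⊗ E ⊕ a ⊗ (y ⊗ G) ⊜ y ⊗ (E ⊕ a ⊗ G)) refl (x + a) a E G ⟩
    (x + a) * (E + a * G) ≡⟨ cong ((x + a) *_) (evalM-addM a cs (quotM a cs) x) ⟨
    (x + a) * evalM (addM a cs (quotM a cs)) x ∎
    where E = evalM cs x
          A = evalM cs a
          G = evalM (quotM a cs) x

  -- Dividing by the factor of the first point leaves a monic polynomial of smaller degree that
  -- vanishes at the remaining points.
  monic-roots : ∀ {m} (cs : Vec K m) (p : Fin (suc m) → K) → (∀ {i j} → p i ≡ p j → i ≡ j) →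
    ¬ (∀ i → evalM cs (p i) ≡ 0#)
  monic-roots [] p inj root = 0≢1 (sym (root zero))
  monic-roots cs@(_ ∷ _) p inj root = monic-roots (quotM a cs) (p ∘ suc) (Finₚ.suc-injective ∘ inj) λ i →
    [ (λ eq → contradiction (inj (x+y≡0⇒x≡y eq)) λ ()) , id ]′ (*-integral (p (suc i) + a) _
      (trans (sym (evalM-quotM a cs (p (suc i)))) (trans (cong₂ _+_ (root (suc i)) (root zero)) (+-identityʳ 0#))))
    where a = p zero

  evalM-replicate : ∀ m x → evalM (replicate m 0#) x ≡ x ^ m
  evalM-replicate zero x = refl
  evalM-replicate (suc m) x = trans (+-identityˡ _) (cong (x *_) (evalM-replicate m x))

  -- If x^(m+1) = x identically with m+1 < q, the monic polynomial x^(m+1) - x has too many roots.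
  ∃-nonroot : ∀ m → 0 ℕ.< m → m ℕ.< q-1 → ∃ λ x → x ≢ 0# × x ^ m ≢ 1#
  ∃-nonroot (suc m) _ m<q-1 with Finₚ.any? {q} (λ x → ¬? (x ^ suc (suc m) ≟ x))
  ... | yes (x , ne) = x , (λ { refl → ne (0^ {suc (suc m)} (s≤s z≤n)) }) ,
        λ eq → ne (trans (cong (x *_) eq) (*-identityʳ x))
  ... | no ¬ex = ⊥-elim (monic-roots (0# ∷ 1# ∷ replicate m 0#) p (Finₚ.inject≤-injective _ _ _ _) root)
    where
    p : Fin (3 ℕ.+ m) → K
    p i = Fin.inject≤ i (subst (3 ℕ.+ m ℕ.≤_) (sym q≡) (s≤s m<q-1))
    root : ∀ i → evalM (0# ∷ 1# ∷ replicate m 0#) (p i) ≡ 0#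
    root i with p i
    ... | x with x ^ suc (suc m) ≟ x
    ... | no ne = contradiction (x , ne) ¬ex
    ... | yes eq = begin
      0# + x * (1# + x * evalM (replicate m 0#) x) ≡⟨ +-identityˡ _ ⟩
      x * (1# + x * evalM (replicate m 0#) x) ≡⟨ cong (λ e → x * (1# + x * e)) (evalM-replicate m x) ⟩
      x * (1# + x * x ^ m) ≡⟨ distribˡ x 1# _ ⟩
      x * 1# + x ^ suc (suc m) ≡⟨ cong₂ _+_ (*-identityʳ x) eq ⟩
      x + x ≡⟨ x+x≡0 x ⟩
      0# ∎

  sum-const : ∀ x → ∑ (λ _ → x) ≡ 0#
  sum-const x = trans (Sum.sum-replicate q) (trans (cong (q ⨯_) (sym (*-identityˡ x)))
    (trans (sym (×-assoc-* q 1# x)) (trans (cong (_* x) q×1≡0) (zeroˡ x))))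

  sum-scale : ∀ {c} → c ≢ 0# → ∀ (h : K → K) → ∑ h ≡ ∑ (λ x → h (c * x))
  sum-scale {c} c≢0 h = sum-reindex (c *_) (c⁻¹ *_) (inv cc⁻¹) (inv (trans (*-comm _ _) cc⁻¹)) h
    where
    c⁻¹ = proj₁ (inverse c c≢0)
    cc⁻¹ = proj₂ (inverse c c≢0)
    inv : ∀ {u v} → u * v ≡ 1# → ∀ x → u * (v * x) ≡ x
    inv {u} {v} uv x = trans (sym (*-assoc u v x)) (trans (cong (_* x) uv) (*-identityˡ x))

  -- For m > 0, scaling the variable by `c` multiplies the sum by c^m, and m < q - 1 provides a
  -- nonzero `c` with c^m ≠ 1.
  sum-pow-small : ∀ m → m ℕ.< q-1 → ∑ (_^ m) ≡ 0#
  sum-pow-small zero _ = sum-const 1#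
  sum-pow-small (suc m) m<q-1 with ∃-nonroot (suc m) (s≤s z≤n) m<q-1
  ... | c , c≢0 , cᵐ≢1 with *-integral (c ^ suc m + 1#) (∑ (_^ suc m)) (begin
      (c ^ suc m + 1#) * S ≡⟨ distribʳ S _ _ ⟩
      c ^ suc m * S + 1# * S ≡⟨ cong₂ _+_ scaled (*-identityˡ S) ⟩
      S + S ≡⟨ x+x≡0 S ⟩
      0# ∎)
    where
    S = ∑ (_^ suc m)
    scaled : c ^ suc m * S ≡ S
    scaled = begin
      c ^ suc m * S ≡⟨ *-distribˡ-sum (c ^ suc m) (_^ suc m) ⟩
      ∑ (λ x → c ^ suc m * x ^ suc m) ≡⟨ sum-cong-≗ (λ x → ^-distrib-* c x (suc m)) ⟨
      ∑ (λ x → (c * x) ^ suc m) ≡⟨ sum-scale c≢0 (_^ suc m) ⟨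
      S ∎
  ... | inj₁ eq = contradiction (x+y≡0⇒x≡y eq) cᵐ≢1
  ... | inj₂ eq = eq

  -- The multiple must be positive: then zero contributes 0 and the other q - 1 elements, an odd
  -- number, contribute 1 each. At exponent 0 the sum would be q = 0.
  sum-pow-∣ : ∀ k → ∑ (_^ (suc k ℕ.* q-1)) ≡ 1#
  sum-pow-∣ k = begin
    ∑ (_^ (suc k ℕ.* q-1)) ≡⟨ sum-cong-≗ (λ x → ^-wraps x k (ℕ.>-nonZero⁻¹ q-1)) ⟩
    ∑ (_^ q-1) ≡⟨ x+y≡0⇒x≡y (begin
      ∑ (_^ q-1) + 1# ≡⟨ cong (∑ (_^ q-1) +_) (sym (trans (sum-single 0# δ δ-off) δ0)) ⟩
      ∑ (_^ q-1) + ∑ δ ≡⟨ ∑-distrib-+ (_^ q-1) δ ⟨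
      ∑ (λ x → x ^ q-1 + δ x) ≡⟨ sum-cong-≗ one ⟩
      ∑ (λ _ → 1#) ≡⟨ sum-const 1# ⟩
      0# ∎) ⟩
    1# ∎
    where
    δ : K → K
    δ x with x ≟ 0#
    ... | yes _ = 1#
    ... | no _ = 0#
    δ-off : ∀ x → x ≢ 0# → δ x ≡ 0#
    δ-off x ne with x ≟ 0#
    ... | yes eq = contradiction eq ne
    ... | no _ = refl
    one : ∀ x → x ^ q-1 + δ x ≡ 1#
    one x with x ≟ 0#
    ... | yes refl = trans (cong (_+ 1#) (0^ (ℕ.>-nonZero⁻¹ q-1))) (+-identityˡ 1#)
    ... | no ne = trans (cong (_+ 0#) (^q-1 ne)) (+-identityʳ 1#)
    δ0 : δ 0# ≡ 1#
    δ0 with 0# ≟ 0#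
    ... | yes _ = refl
    ... | no ne = contradiction refl ne

  sum-pow-∤ : ∀ n → ¬ (q-1 ∣ n) → ∑ (_^ n) ≡ 0#
  sum-pow-∤ n ∤n = begin
    ∑ (_^ n) ≡⟨ sum-cong-≗ (λ x → trans (cong (x ^_) (ℕ/.m≡m%n+[m/n]*n n q-1)) (^-wraps x (n ℕ/./ q-1) 0<m)) ⟩
    ∑ (_^ (n ℕ/.% q-1)) ≡⟨ sum-pow-small _ (ℕ/.m%n<n n q-1) ⟩
    0# ∎
    where
    0<m : 0 ℕ.< n ℕ/.% q-1
    0<m = ℕₚ.n≢0⇒n>0 λ eq → ∤n (∣.m%n≡0⇒n∣m n q-1 eq)

-- Frobenius powers, the absolute trace, and selection of coefficients.

module Trace {r : ℕ} (F : Field (2 ℕ.^ r)) (1≤r : 1 ℕ.≤ r) where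
  open FieldTheory F 1≤r
  open ≡-Reasoning

  x^2≡x*x : ∀ x → x ^ 2 ≡ x * x
  x^2≡x*x x = cong (x *_) (*-identityʳ x)

  square-+ : ∀ x y → (x + y) ^ 2 ≡ x ^ 2 + y ^ 2
  square-+ x y = begin
    (x + y) ^ 2 ≡⟨ x^2≡x*x _ ⟩
    (x + y) * (x + y) ≡⟨ solveF 2 (λ x y → (x ⊕ y) ⊗ (x ⊕ y) ⊜ (x ⊗ x ⊕ y ⊗ y) ⊕ (x ⊗ y ⊕ x ⊗ y)) refl x y ⟩
    (x * x + y * y) + (x * y + x * y) ≡⟨ cong ((x * x + y * y) +_) (x+x≡0 _) ⟩
    (x * x + y * y) + 0# ≡⟨ +-identityʳ _ ⟩
    x * x + y * y ≡⟨ cong₂ _+_ (x^2≡x*x x) (x^2≡x*x y) ⟨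
    x ^ 2 + y ^ 2 ∎

  φ : ℕ → K → K
  φ s x = x ^ (2 ℕ.^ s)

  φ-suc : ∀ s x → φ (suc s) x ≡ φ s x ^ 2
  φ-suc s x = trans (cong (x ^_) (ℕₚ.*-comm 2 (2 ℕ.^ s))) (sym (^-assocʳ x (2 ℕ.^ s) 2))

  φ-suc′ : ∀ s x → φ (suc s) x ≡ φ s (x ^ 2)
  φ-suc′ s x = sym (^-assocʳ x 2 (2 ℕ.^ s))

  φ-0 : ∀ x → φ 0 x ≡ x
  φ-0 = *-identityʳ

  φ-+ : ∀ s x y → φ s (x + y) ≡ φ s x + φ s y
  φ-+ zero x y = distribʳ 1# x y
  φ-+ (suc s) x y = begin
    φ (suc s) (x + y) ≡⟨ φ-suc s _ ⟩
    φ s (x + y) ^ 2 ≡⟨ cong (_^ 2) (φ-+ s x y) ⟩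
    (φ s x + φ s y) ^ 2 ≡⟨ square-+ _ _ ⟩
    φ s x ^ 2 + φ s y ^ 2 ≡⟨ cong₂ _+_ (φ-suc s x) (φ-suc s y) ⟨
    φ (suc s) x + φ (suc s) y ∎

  φ-* : ∀ s x y → φ s (x * y) ≡ φ s x * φ s y
  φ-* s x y = ^-distrib-* x y (2 ℕ.^ s)

  φ-φ : ∀ s u x → φ s (φ u x) ≡ φ (u ℕ.+ s) x
  φ-φ s u x = trans (^-assocʳ x (2 ℕ.^ u) (2 ℕ.^ s)) (cong (x ^_) (sym (ℕₚ.^-distribˡ-+-* 2 u s)))

  φ-r : ∀ x → φ r x ≡ x
  φ-r = ^q

  φ-0# : ∀ s → φ s 0# ≡ 0#
  φ-0# s = 0^ (ℕₚ.m^n>0 2 s)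

  -- The r-th Frobenius power is the identity, so the (r - 1)-st one inverts squaring.
  sqrt : K → K
  sqrt = φ (pred r)

  suc-pred-r : suc (pred r) ≡ r
  suc-pred-r = ℕₚ.suc-pred r {{ℕ.>-nonZero 1≤r}}

  φ-suc-sqrt : ∀ s x → φ (suc s) (sqrt x) ≡ φ s x
  φ-suc-sqrt s x = begin
    φ (suc s) (φ (pred r) x) ≡⟨ φ-φ (suc s) (pred r) x ⟩
    φ (pred r ℕ.+ suc s) x ≡⟨ cong (λ n → φ n x) (trans (ℕₚ.+-suc (pred r) s) (cong (ℕ._+ s) suc-pred-r)) ⟩
    φ (r ℕ.+ s) x ≡⟨ φ-φ s r x ⟨
    φ s (φ r x) ≡⟨ cong (φ s) (φ-r x) ⟩
    φ s x ∎

  sqrt-square : ∀ x → sqrt x ^ 2 ≡ x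
  sqrt-square x = trans (φ-suc-sqrt 0 x) (φ-0 x)

  ∑< : ℕ → (ℕ → K) → K
  ∑< zero f = 0#
  ∑< (suc n) f = ∑< n f + f n

  ∑<-cong : ∀ n {f g : ℕ → K} → (∀ s → f s ≡ g s) → ∑< n f ≡ ∑< n g
  ∑<-cong zero eq = refl
  ∑<-cong (suc n) eq = cong₂ _+_ (∑<-cong n eq) (eq n)

  ∑<-+ : ∀ n (f g : ℕ → K) → ∑< n (λ s → f s + g s) ≡ ∑< n f + ∑< n g
  ∑<-+ zero f g = sym (+-identityʳ 0#)
  ∑<-+ (suc n) f g = trans (cong (_+ (f n + g n)) (∑<-+ n f g))
    (solveF 4 (λ a b c d → (a ⊕ b) ⊕ (c ⊕ d) ⊜ (a ⊕ c) ⊕ (b ⊕ d)) refl _ _ _ _)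

  ∑<-* : ∀ n c (f : ℕ → K) → c * ∑< n f ≡ ∑< n (λ s → c * f s)
  ∑<-* zero c f = zeroʳ c
  ∑<-* (suc n) c f = trans (distribˡ c _ _) (cong (_+ c * f n) (∑<-* n c f))

  ∑<-zero : ∀ n {f : ℕ → K} → (∀ {s} → s ℕ.< n → f s ≡ 0#) → ∑< n f ≡ 0#
  ∑<-zero zero eq = refl
  ∑<-zero (suc n) eq = trans (cong₂ _+_ (∑<-zero n (λ s<n → eq (ℕₚ.m<n⇒m<1+n s<n))) (eq ℕₚ.≤-refl)) (+-identityʳ 0#)

  ∑<-single : ∀ n {b} (f : ℕ → K) → b ℕ.< n → (∀ {s} → s ℕ.< n → s ≢ b → f s ≡ 0#) → ∑< n f ≡ f b
  ∑<-single (suc n) {b} f b<n eq with n ℕₚ.≟ b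
  ... | yes refl = trans (cong (_+ f n) (∑<-zero n λ s<n → eq (ℕₚ.m<n⇒m<1+n s<n) (ℕₚ.<⇒≢ s<n))) (+-identityˡ _)
  ... | no n≢b = trans (cong₂ _+_ (∑<-single n f (ℕₚ.≤∧≢⇒< (ℕₚ.≤-pred b<n) (n≢b ∘ sym)) (λ s<n → eq (ℕₚ.m<n⇒m<1+n s<n))) (eq ℕₚ.≤-refl n≢b)) (+-identityʳ _)

  ∑-∑<-comm : ∀ n (f : K → ℕ → K) → ∑ (λ x → ∑< n (f x)) ≡ ∑< n (λ s → ∑ (λ x → f x s))
  ∑-∑<-comm zero f = sum-const 0#
  ∑-∑<-comm (suc n) f = trans (∑-distrib-+ (λ x → ∑< n (f x)) (λ x → f x n)) (cong (_+ ∑ (λ x → f x n)) (∑-∑<-comm n f))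

  ∑<-head : ∀ n (f : ℕ → K) → ∑< (suc n) f ≡ f 0 + ∑< n (f ∘ suc)
  ∑<-head zero f = +-comm _ _
  ∑<-head (suc n) f = trans (cong (_+ f (suc n)) (∑<-head n f)) (+-assoc _ _ _)

  Tr : K → K
  Tr x = ∑< r (λ s → φ s x)

  Tr-+ : ∀ x y → Tr (x + y) ≡ Tr x + Tr y
  Tr-+ x y = trans (∑<-cong r (λ s → φ-+ s x y)) (∑<-+ r _ _)

  φ-∑< : ∀ u n (f : ℕ → K) → φ u (∑< n f) ≡ ∑< n (λ s → φ u (f s))
  φ-∑< u zero f = φ-0# u
  φ-∑< u (suc n) f = trans (φ-+ u _ _) (cong (_+ φ u (f n)) (φ-∑< u n f))

  Tr-square : ∀ x → Tr (x ^ 2) ≡ Tr x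
  Tr-square x = begin
    Tr (x ^ 2) ≡⟨ ∑<-cong r (λ s → φ-suc′ s x) ⟨
    ∑< r (λ s → φ (suc s) x) ≡⟨ x+[x+y]≡y (φ 0 x) _ ⟨
    φ 0 x + (φ 0 x + ∑< r (λ s → φ (suc s) x)) ≡⟨ cong (φ 0 x +_) (∑<-head r (λ s → φ s x)) ⟨
    φ 0 x + (Tr x + φ r x) ≡⟨ cong₂ (λ u v → u + (Tr x + v)) (φ-0 x) (φ-r x) ⟩
    x + (Tr x + x) ≡⟨ +-comm _ _ ⟩
    (Tr x + x) + x ≡⟨ [x+y]+y≡x _ _ ⟩
    Tr x ∎

  Tr-φ : ∀ u x → Tr (φ u x) ≡ Tr x
  Tr-φ zero x = cong Tr (φ-0 x)
  Tr-φ (suc u) x = trans (cong Tr (φ-suc u x)) (trans (Tr-square _) (Tr-φ u x))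

  idem : ∀ {e} → e ^ 2 ≡ e → e ≡ 0# ⊎ e ≡ 1#
  idem {e} eq with *-integral e (e + 1#) (begin
    e * (e + 1#) ≡⟨ distribˡ e e 1# ⟩
    e * e + e * 1# ≡⟨ cong₂ _+_ (trans (sym (x^2≡x*x e)) eq) (*-identityʳ e) ⟩
    e + e ≡⟨ x+x≡0 e ⟩
    0# ∎)
  ... | inj₁ e≡0 = inj₁ e≡0
  ... | inj₂ e+1≡0 = inj₂ (x+y≡0⇒x≡y e+1≡0)

  Tr-^2 : ∀ x → Tr x ^ 2 ≡ Tr x
  Tr-^2 x = trans (φ-∑< 1 r (λ s → φ s x)) (trans (∑<-cong r (λ s → sym (φ-suc s x)))
    (trans (∑<-cong r (λ s → φ-suc′ s x)) (Tr-square x)))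

  Tr-01 : ∀ x → Tr x ≡ 0# ⊎ Tr x ≡ 1#
  Tr-01 x = idem (Tr-^2 x)

  Tr-0# : Tr 0# ≡ 0#
  Tr-0# = ∑<-zero r (λ {s} _ → φ-0# s)

  2^<q : ∀ {b} → b ℕ.< r → 2 ℕ.^ b ℕ.≤ q-1
  2^<q b<r = ℕₚ.<⇒≤pred (ℕₚ.^-monoʳ-< 2 ℕₚ.≤-refl b<r)

  2^-injective : ∀ {b s} → 2 ℕ.^ b ≡ 2 ℕ.^ s → b ≡ s
  2^-injective {b} {s} eq with ℕₚ.<-cmp b s
  ... | tri< b<s _ _ = contradiction eq (ℕₚ.<⇒≢ (ℕₚ.^-monoʳ-< 2 ℕₚ.≤-refl b<s))
  ... | tri≈ _ b≡s _ = b≡s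
  ... | tri> _ _ s<b = contradiction (sym eq) (ℕₚ.<⇒≢ (ℕₚ.^-monoʳ-< 2 ℕₚ.≤-refl s<b))

  -- The exponent of β^(-2^b).
  neg2^ : ℕ → ℕ
  neg2^ b = q-1 ℕ.∸ 2 ℕ.^ b

  ∣⇒≡ : ∀ {m n} → 0 ℕ.< n → n ℕ.< m ℕ.+ m → m ∣ n → n ≡ m
  ∣⇒≡ 0<n _ (divides zero refl) = contradiction 0<n λ ()
  ∣⇒≡ _ _ (divides 1 refl) = ℕₚ.+-identityʳ _
  ∣⇒≡ {m} _ n<2m (divides (suc (suc k)) refl) = contradiction n<2m (ℕₚ.≤⇒≯ (ℕₚ.+-monoʳ-≤ m (ℕₚ.m≤m+n m _)))

  -- The exponent q - 1 - 2^b + 2^s lies strictly between 0 and 2(q - 1), so it is a multiple of q -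
  -- 1 only for s = b.
  select : ∀ {b s} → b ℕ.< r → s ℕ.< r → s ≢ b → ∑ (λ β → β ^ neg2^ b * φ s β) ≡ 0#
  select {b} {s} b<r s<r s≢b = trans (sum-cong-≗ (λ β → sym (^-homo-* β (neg2^ b) (2 ℕ.^ s)))) (sum-pow-∤ _ λ d →
    s≢b (2^-injective (ℕₚ.+-cancelˡ-≡ (neg2^ b) _ _ (trans (∣⇒≡ pos small d) (sym (ℕₚ.m∸n+n≡m (2^<q b<r)))))))
    where
    pos : 0 ℕ.< neg2^ b ℕ.+ 2 ℕ.^ s
    pos = ℕₚ.≤-trans (ℕₚ.m^n>0 2 s) (ℕₚ.m≤n+m _ (neg2^ b))
    small : neg2^ b ℕ.+ 2 ℕ.^ s ℕ.< q-1 ℕ.+ q-1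
    small = ℕₚ.+-mono-<-≤ (ℕₚ.∸-monoʳ-< (ℕₚ.m^n>0 2 b) (2^<q b<r)) (2^<q s<r)

  select-b : ∀ {b} → b ℕ.< r → ∑ (λ β → β ^ neg2^ b * φ b β) ≡ 1#
  select-b {b} b<r = trans (sum-cong-≗ (λ β → trans (sym (^-homo-* β (neg2^ b) (2 ℕ.^ b)))
    (cong (β ^_) (trans (ℕₚ.m∸n+n≡m (2^<q b<r)) (sym (ℕₚ.*-identityˡ q-1)))))) (sum-pow-∣ 0)

  ∑-*ˡ : ∀ c (f : K → K) → ∑ (λ x → c * f x) ≡ c * ∑ f
  ∑-*ˡ c f = sym (*-distribˡ-sum c f)

  -- As a polynomial in β, Tr(cβ) has the coefficient `φ b c` at the exponent 2^b; the weighted sum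
  -- isolates it.
  select-Tr : ∀ {b} → b ℕ.< r → ∀ c → ∑ (λ β → β ^ neg2^ b * Tr (c * β)) ≡ φ b c
  select-Tr {b} b<r c = begin
    ∑ (λ β → β ^ neg2^ b * Tr (c * β)) ≡⟨ sum-cong-≗ (λ β → trans (∑<-* r _ _) (∑<-cong r λ s →
       trans (cong (β ^ neg2^ b *_) (φ-* s c β)) (solveF 3 (λ x y z → x ⊗ (y ⊗ z) ⊜ y ⊗ (x ⊗ z)) refl _ _ _))) ⟩
    ∑ (λ β → ∑< r (λ s → φ s c * (β ^ neg2^ b * φ s β))) ≡⟨ ∑-∑<-comm r _ ⟩
    ∑< r (λ s → ∑ (λ β → φ s c * (β ^ neg2^ b * φ s β))) ≡⟨ ∑<-cong r (λ s → ∑-*ˡ (φ s c) _) ⟩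
    ∑< r (λ s → φ s c * ∑ (λ β → β ^ neg2^ b * φ s β)) ≡⟨ ∑<-single r _ b<r (λ {s} s<r s≢b →
       trans (cong (φ s c *_) (select b<r s<r s≢b)) (zeroʳ _)) ⟩
    φ b c * ∑ (λ β → β ^ neg2^ b * φ b β) ≡⟨ cong (φ b c *_) (select-b b<r) ⟩
    φ b c * 1# ≡⟨ *-identityʳ _ ⟩
    φ b c ∎

  -- If the trace vanished identically, so would its selected coefficient at the exponent 1, which
  -- is 1.
  ∃-Tr≡1 : ∃ λ y → Tr y ≡ 1#
  ∃-Tr≡1 with Finₚ.any? (λ y → Tr y ≟ 1#)
  ... | yes found = found
  ... | no none = contradiction (begin
    0# ≡⟨ sum-ε (λ y → trans (cong (λ e → y ^ neg2^ 0 * e) (trans (cong Tr (*-identityˡ y)) (Tr≡0 y))) (zeroʳ _)) ⟨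
    ∑ (λ y → y ^ neg2^ 0 * Tr (1# * y)) ≡⟨ select-Tr 1≤r 1# ⟩
    φ 0 1# ≡⟨ φ-0 1# ⟩
    1# ∎) 0≢1
    where
    Tr≡0 : ∀ y → Tr y ≡ 0#
    Tr≡0 y with Tr-01 y
    ... | inj₁ eq = eq
    ... | inj₂ eq = contradiction (y , eq) none

-- Gaussian integers and the prime 1 + i above 2.

module Gaussian where
  infix 5 _+i_
  record 𝔾 : Set where
    no-eta-equality
    pattern
    constructor _+i_
    field
      re im : ℤ
  open 𝔾 public

  infixl 6 _+_
  infixl 7 _*_
  infix 8 -_

  _+_ _*_ : 𝔾 → 𝔾 → 𝔾
  (a +i b) + (c +i d) = (a ℤ.+ c) +i (b ℤ.+ d)
  (a +i b) * (c +i d) = (a ℤ.* c ℤ.- b ℤ.* d) +i (a ℤ.* d ℤ.+ b ℤ.* c)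

  -_ conj : 𝔾 → 𝔾
  - (a +i b) = (ℤ.- a) +i (ℤ.- b)
  conj (a +i b) = a +i (ℤ.- b)

  0# 1# 𝕚 π : 𝔾
  0# = 0ℤ +i 0ℤ
  1# = 1ℤ +i 0ℤ
  𝕚 = 0ℤ +i 1ℤ
  π = 1ℤ +i 1ℤ

  isCommutativeRing : IsCommutativeRing _≡_ _+_ _*_ -_ 0# 1#
  isCommutativeRing = record
    { isRing = record
      { +-isAbelianGroup = record
        { isGroup = record
          { isMonoid = record
            { isSemigroup = record
              { isMagma = record { isEquivalence = isEquivalence ; ∙-cong = cong₂ _+_ }
              ; assoc = λ { (a +i b) (c +i d) (e +i f) → cong₂ _+i_ (ℤₚ.+-assoc a c e) (ℤₚ.+-assoc b d f) } }
            ; identity = (λ { (a +i b) → cong₂ _+i_ (ℤₚ.+-identityˡ a) (ℤₚ.+-identityˡ b) })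
                       , (λ { (a +i b) → cong₂ _+i_ (ℤₚ.+-identityʳ a) (ℤₚ.+-identityʳ b) }) }
          ; inverse = (λ { (a +i b) → cong₂ _+i_ (ℤₚ.+-inverseˡ a) (ℤₚ.+-inverseˡ b) })
                    , (λ { (a +i b) → cong₂ _+i_ (ℤₚ.+-inverseʳ a) (ℤₚ.+-inverseʳ b) })
          ; ⁻¹-cong = cong -_ }
        ; comm = λ { (a +i b) (c +i d) → cong₂ _+i_ (ℤₚ.+-comm a c) (ℤₚ.+-comm b d) } }
      ; *-cong = cong₂ _*_
      ; *-assoc = λ { (a +i b) (c +i d) (e +i f) → cong₂ _+i_ (assoc-re a b c d e f) (assoc-im a b c d e f) }
      ; *-identity = (λ { (a +i b) → cong₂ _+i_ (idˡ-re a b) (idˡ-im a b) })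
                   , (λ { (a +i b) → cong₂ _+i_ (idʳ-re a b) (idʳ-im a b) })
      ; distrib = (λ { (a +i b) (c +i d) (e +i f) → cong₂ _+i_ (dˡ-re a b c d e f) (dˡ-im a b c d e f) })
                , (λ { (a +i b) (c +i d) (e +i f) → cong₂ _+i_ (dʳ-re a b c d e f) (dʳ-im a b c d e f) }) }
    ; *-comm = λ { (a +i b) (c +i d) → cong₂ _+i_ (comm-re a b c d) (comm-im a b c d) } }
    where
    open import Data.Integer.Base using () renaming (_+_ to _⊕_; _*_ to _⊗_; _-_ to _⊖_)
    assoc-re : ∀ a b c d e f → (a ⊗ c ⊖ b ⊗ d) ⊗ e ⊖ (a ⊗ d ⊕ b ⊗ c) ⊗ f ≡ a ⊗ (c ⊗ e ⊖ d ⊗ f) ⊖ b ⊗ (c ⊗ f ⊕ d ⊗ e)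
    assoc-re = solveℤ
    assoc-im : ∀ a b c d e f → (a ⊗ c ⊖ b ⊗ d) ⊗ f ⊕ (a ⊗ d ⊕ b ⊗ c) ⊗ e ≡ a ⊗ (c ⊗ f ⊕ d ⊗ e) ⊕ b ⊗ (c ⊗ e ⊖ d ⊗ f)
    assoc-im = solveℤ
    idˡ-re : ∀ a b → 1ℤ ⊗ a ⊖ 0ℤ ⊗ b ≡ a
    idˡ-re = solveℤ
    idˡ-im : ∀ a b → 1ℤ ⊗ b ⊕ 0ℤ ⊗ a ≡ b
    idˡ-im = solveℤ
    idʳ-re : ∀ a b → a ⊗ 1ℤ ⊖ b ⊗ 0ℤ ≡ a
    idʳ-re = solveℤ
    idʳ-im : ∀ a b → a ⊗ 0ℤ ⊕ b ⊗ 1ℤ ≡ b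
    idʳ-im = solveℤ
    dˡ-re : ∀ a b c d e f → a ⊗ (c ⊕ e) ⊖ b ⊗ (d ⊕ f) ≡ (a ⊗ c ⊖ b ⊗ d) ⊕ (a ⊗ e ⊖ b ⊗ f)
    dˡ-re = solveℤ
    dˡ-im : ∀ a b c d e f → a ⊗ (d ⊕ f) ⊕ b ⊗ (c ⊕ e) ≡ (a ⊗ d ⊕ b ⊗ c) ⊕ (a ⊗ f ⊕ b ⊗ e)
    dˡ-im = solveℤ
    dʳ-re : ∀ a b c d e f → (c ⊕ e) ⊗ a ⊖ (d ⊕ f) ⊗ b ≡ (c ⊗ a ⊖ d ⊗ b) ⊕ (e ⊗ a ⊖ f ⊗ b)
    dʳ-re = solveℤ
    dʳ-im : ∀ a b c d e f → (c ⊕ e) ⊗ b ⊕ (d ⊕ f) ⊗ a ≡ (c ⊗ b ⊕ d ⊗ a) ⊕ (e ⊗ b ⊕ f ⊗ a)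
    dʳ-im = solveℤ
    comm-re : ∀ a b c d → a ⊗ c ⊖ b ⊗ d ≡ c ⊗ a ⊖ d ⊗ b
    comm-re = solveℤ
    comm-im : ∀ a b c d → a ⊗ d ⊕ b ⊗ c ≡ c ⊗ b ⊕ d ⊗ a
    comm-im = solveℤ

  commutativeRing : CommutativeRing 0ℓ 0ℓ
  commutativeRing = record { isCommutativeRing = isCommutativeRing }

  open CommutativeRing commutativeRing public
    using (+-assoc; +-comm; +-identityˡ; +-identityʳ; *-assoc; *-comm; *-identityˡ; *-identityʳ;
           distribˡ; distribʳ; zeroˡ; zeroʳ; -‿inverseˡ; -‿inverseʳ; ring; semiring;
           +-isCommutativeMonoid; *-isCommutativeMonoid; _-_)
  open SExp semiring public using (_^_; ^-homo-*)
  open RingP ring public using (-‿distribˡ-*; -‿distribʳ-*; +-cancelˡ)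

  open import Algebra.Solver.Ring.NaturalCoefficients.Default (CommutativeRing.commutativeSemiring commutativeRing) public
    using () renaming (solve to solveG; _:+_ to _⊕_; _:*_ to _⊗_; _:=_ to _⊜_; con to con)

  conj-+ : ∀ x y → conj (x + y) ≡ conj x + conj y
  conj-+ (a +i b) (c +i d) = cong ((a ℤ.+ c) +i_) (ℤₚ.neg-distrib-+ b d)

  conj-* : ∀ x y → conj (x * y) ≡ conj x * conj y
  conj-* (a +i b) (c +i d) = cong₂ _+i_ (eq₁ a b c d) (eq₂ a b c d)
    where
    eq₁ : ∀ a b c d → a ℤ.* c ℤ.- b ℤ.* d ≡ a ℤ.* c ℤ.- (ℤ.- b) ℤ.* (ℤ.- d)
    eq₁ = solveℤ
    eq₂ : ∀ a b c d → ℤ.- (a ℤ.* d ℤ.+ b ℤ.* c) ≡ a ℤ.* (ℤ.- d) ℤ.+ (ℤ.- b) ℤ.* c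
    eq₂ = solveℤ

  double-cancel : ∀ {a b : ℤ} → a ℤ.+ a ≡ b ℤ.+ b → a ≡ b
  double-cancel {a} {b} eq = ℤₚ.*-cancelˡ-≡ (ℤ.+ 2) a b (trans (two a) (trans eq (sym (two b))))
    where
    two : ∀ a → ℤ.+ 2 ℤ.* a ≡ a ℤ.+ a
    two = solveℤ

  half≢1 : ∀ {a : ℤ} → a ℤ.+ a ≢ 1ℤ
  half≢1 {ℤ.+ zero} ()
  half≢1 {ℤ.+ suc n} eq with trans (sym (ℕₚ.+-suc n n)) (ℕₚ.suc-injective (ℤₚ.+-injective eq))
  ... | ()
  half≢1 { -[1+ n ]} ()

  -- Multiplying by `conj π` turns the factor π into the factor 2.
  π-cancel : ∀ {x y} → π * x ≡ π * y → x ≡ y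
  π-cancel {x} {y} eq = dbl x y (trans (sym (πx x)) (trans (cong (conj π *_) eq) (πx y)))
    where
    πx : ∀ x → conj π * (π * x) ≡ x + x
    πx x = trans (sym (*-assoc (conj π) π x)) (trans (distribʳ x 1# 1#) (cong₂ _+_ (*-identityˡ x) (*-identityˡ x)))
    dbl : ∀ x y → x + x ≡ y + y → x ≡ y
    dbl (a +i b) (c +i d) eq = cong₂ _+i_ (double-cancel (cong re eq)) (double-cancel (cong im eq))

  π^-cancel : ∀ n {x y} → π ^ n * x ≡ π ^ n * y → x ≡ y
  π^-cancel zero {x} {y} eq = trans (sym (*-identityˡ x)) (trans eq (*-identityˡ y))
  π^-cancel (suc n) {x} {y} eq = π^-cancel n (π-cancel (trans (sym (*-assoc π (π ^ n) x)) (trans eq (*-assoc π (π ^ n) y))))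

  -- The two residue classes modulo π.
  Even Odd : 𝔾 → Set
  Even x = ∃ λ y → x ≡ π * y
  Odd x = ∃ λ y → x ≡ 1# + π * y

  -- The real and imaginary parts of π(a + bi) add up to 2a.
  ¬Even-1 : ¬ Even 1#
  ¬Even-1 ((a +i b) , eq) = half≢1 {a} (trans (dbl a b) (trans (sym (cong₂ ℤ._+_ (cong re eq) (cong im eq))) refl))
    where
    dbl : ∀ a b → a ℤ.+ a ≡ (1ℤ ℤ.* a ℤ.- 1ℤ ℤ.* b) ℤ.+ (1ℤ ℤ.* b ℤ.+ 1ℤ ℤ.* a)
    dbl = solveℤ

  Even-Odd-⊥ : ∀ {x} → Even x → Odd x → ⊥
  Even-Odd-⊥ (y , eq) (z , eq′) = ¬Even-1 (y - z , trans
    (sym (trans (+-assoc 1# (π * z) _) (trans (cong (1# +_) (-‿inverseʳ (π * z))) (+-identityʳ 1#))))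
    (trans (cong (_- π * z) (trans (sym eq′) eq)) (trans (cong (π * y +_) (-‿distribʳ-* π z)) (sym (distribˡ π y (- z))))))

  parity : ∀ n → ∃ λ k → n ≡ k ℤ.+ k ⊎ n ≡ 1ℤ ℤ.+ (k ℤ.+ k)
  parity (ℤ.+ zero) = 0ℤ , inj₁ refl
  parity (ℤ.+ suc n) with parity (ℤ.+ n)
  ... | k , inj₁ eq = k , inj₂ (cong (λ m → 1ℤ ℤ.+ m) eq)
  ... | k , inj₂ eq = 1ℤ ℤ.+ k , inj₁ (trans (cong (λ m → 1ℤ ℤ.+ m) eq) (shift k))
    where
    shift : ∀ k → 1ℤ ℤ.+ (1ℤ ℤ.+ (k ℤ.+ k)) ≡ (1ℤ ℤ.+ k) ℤ.+ (1ℤ ℤ.+ k)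
    shift = solveℤ
  parity -[1+ zero ] = -[1+ 0 ] , inj₂ refl
  parity -[1+ suc n ] with parity -[1+ n ]
  ... | k , inj₁ eq = -[1+ 0 ] ℤ.+ k , inj₂ (trans (cong (λ m → -[1+ 0 ] ℤ.+ m) eq) (shift k))
    where
    shift : ∀ k → -[1+ 0 ] ℤ.+ (k ℤ.+ k) ≡ 1ℤ ℤ.+ ((-[1+ 0 ] ℤ.+ k) ℤ.+ (-[1+ 0 ] ℤ.+ k))
    shift = solveℤ
  ... | k , inj₂ eq = k , inj₁ (trans (cong (λ m → -[1+ 0 ] ℤ.+ m) eq) (shift k))
    where
    shift : ∀ k → -[1+ 0 ] ℤ.+ (1ℤ ℤ.+ (k ℤ.+ k)) ≡ k ℤ.+ k
    shift = solveℤ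

  even-or-odd : ∀ x → Even x ⊎ Odd x
  even-or-odd (a +i b) with parity (a ℤ.+ b)
  ... | k , inj₁ eq = inj₁ ((k +i (k ℤ.- a)) , cong₂ _+i_ (eq₁ k a) (trans (eq₂ a b) (trans (cong (ℤ._- a) eq) (eq₃ k a))))
    where
    eq₁ : ∀ k a → a ≡ 1ℤ ℤ.* k ℤ.- 1ℤ ℤ.* (k ℤ.- a)
    eq₁ = solveℤ
    eq₂ : ∀ a b → b ≡ (a ℤ.+ b) ℤ.- a
    eq₂ = solveℤ
    eq₃ : ∀ k a → (k ℤ.+ k) ℤ.- a ≡ 1ℤ ℤ.* (k ℤ.- a) ℤ.+ 1ℤ ℤ.* k
    eq₃ = solveℤ
  ... | k , inj₂ eq = inj₂ ((k +i (1ℤ ℤ.+ k ℤ.- a)) , cong₂ _+i_ (eq₁ k a) (trans (eq₂ a b) (trans (cong (ℤ._- a) eq) (eq₃ k a))))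
    where
    eq₁ : ∀ k a → a ≡ 1ℤ ℤ.+ (1ℤ ℤ.* k ℤ.- 1ℤ ℤ.* (1ℤ ℤ.+ k ℤ.- a))
    eq₁ = solveℤ
    eq₂ : ∀ a b → b ≡ (a ℤ.+ b) ℤ.- a
    eq₂ = solveℤ
    eq₃ : ∀ k a → (1ℤ ℤ.+ (k ℤ.+ k)) ℤ.- a ≡ 0ℤ ℤ.+ (1ℤ ℤ.* (1ℤ ℤ.+ k ℤ.- a) ℤ.+ 1ℤ ℤ.* k)
    eq₃ = solveℤ

  2# : 𝔾
  2# = 1# + 1#

  private
    lemma₁ : ∀ m p y z → m * (p * (p * (y * z))) ≡ (p * y) * ((m * p) * z)
    lemma₁ = solveG 4 (λ m p y z → m ⊗ (p ⊗ (p ⊗ (y ⊗ z))) ⊜ (p ⊗ y) ⊗ ((m ⊗ p) ⊗ z)) refl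
    lemma₂ : ∀ m p z → (m * (p * p)) * z ≡ p * (m * (p * z))
    lemma₂ = solveG 3 (λ m p z → (m ⊗ (p ⊗ p)) ⊗ z ⊜ p ⊗ (m ⊗ (p ⊗ z))) refl
    lemma₃ : ∀ m p y z → (1# + p * y) * (1# + (m * p) * z) ≡ 1# + p * (y + (m * z + (m * p) * (y * z)))
    lemma₃ = solveG 4 (λ m p y z → (con 1 ⊕ p ⊗ y) ⊗ (con 1 ⊕ (m ⊗ p) ⊗ z) ⊜
        con 1 ⊕ p ⊗ (y ⊕ (m ⊗ z ⊕ (m ⊗ p) ⊗ (y ⊗ z)))) refl
    lemma₄ : ∀ m p z → (m * (p * p)) * z ≡ m * (p * (p * z))
    lemma₄ = solveG 3 (λ m p z → (m ⊗ (p ⊗ p)) ⊗ z ⊜ m ⊗ (p ⊗ (p ⊗ z))) refl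

  -𝕚 : 𝔾
  -𝕚 = - 𝕚

  conj-π : conj π ≡ -𝕚 * π
  conj-π = refl

  2≡-iππ : 2# ≡ -𝕚 * (π * π)
  2≡-iππ = refl

  -𝕚-cancel : ∀ {x y} → -𝕚 * x ≡ -𝕚 * y → x ≡ y
  -𝕚-cancel {x} {y} eq = trans (sym (i x)) (trans (cong (𝕚 *_) eq) (i y))
    where
    i*-i : 𝕚 * -𝕚 ≡ 1#
    i*-i = refl
    i : ∀ x → 𝕚 * (-𝕚 * x) ≡ x
    i x = trans (sym (*-assoc 𝕚 -𝕚 x)) (trans (cong (_* x) i*-i) (*-identityˡ x))

  norm-π* : ∀ y → (π * y) * conj (π * y) ≡ 2# * (y * conj y)
  norm-π* y = begin
    (π * y) * conj (π * y) ≡⟨ cong ((π * y) *_) (conj-* π y) ⟩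
    (π * y) * (conj π * conj y) ≡⟨ cong (λ e → (π * y) * (e * conj y)) conj-π ⟩
    (π * y) * ((-𝕚 * π) * conj y) ≡⟨ lemma₁ -𝕚 π y (conj y) ⟨
    -𝕚 * (π * (π * (y * conj y))) ≡⟨ lemma₄ -𝕚 π (y * conj y) ⟨
    (-𝕚 * (π * π)) * (y * conj y) ≡⟨ cong (_* (y * conj y)) 2≡-iππ ⟨
    2# * (y * conj y) ∎
    where open ≡-Reasoning

  2#-cancel : ∀ {x y} → 2# * x ≡ 2# * y → x ≡ y
  2#-cancel {x} {y} eq = π-cancel (π-cancel (-𝕚-cancel (trans (sym (lemma₄ -𝕚 π x))
    (trans (cong (_* x) (sym 2≡-iππ)) (trans eq (trans (cong (_* y) 2≡-iππ) (lemma₄ -𝕚 π y)))))))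

  Even-2# : ∀ x → Even (2# * x)
  Even-2# x = -𝕚 * (π * x) , trans (cong (_* x) 2≡-iππ) (lemma₂ -𝕚 π x)

  Odd-norm : ∀ {x} → Odd x → Odd (x * conj x)
  Odd-norm (y , refl) = _ , trans (cong ((1# + π * y) *_) (trans (conj-+ 1# (π * y)) (cong (1# +_)
    (trans (conj-* π y) (cong (_* conj y) conj-π))))) (lemma₃ -𝕚 π y (conj y))

  -- Up to a unit, 1 + i is the only prime above 2.
  norm-2^ : ∀ r x → x * conj x ≡ 2# ^ r → ∃ λ ε → (x ≡ π ^ r * ε) × Odd ε
  norm-2^ r x eq = split r x eq (even-or-odd x)
    where
    split : ∀ r x → x * conj x ≡ 2# ^ r → Even x ⊎ Odd x → ∃ λ ε → (x ≡ π ^ r * ε) × Odd ε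
    split zero x eq (inj₁ (y , x≡)) = ⊥-elim (¬Even-1 (y * conj x ,
      trans (sym eq) (trans (cong (_* conj x) x≡) (*-assoc π y (conj x)))))
    split zero x eq (inj₂ odd) = x , sym (*-identityˡ x) , odd
    split (suc r) x eq (inj₁ (y , x≡)) = let (ε , y≡ , odd) = norm-2^ r y y-norm in
      ε , trans x≡ (trans (cong (π *_) y≡) (sym (*-assoc π (π ^ r) ε))) , odd
      where
      y-norm : y * conj y ≡ 2# ^ r
      y-norm = 2#-cancel (trans (sym (norm-π* y)) (trans (cong (λ x → x * conj x) (sym x≡)) eq))
    split (suc r) x eq (inj₂ odd) = ⊥-elim (Even-Odd-⊥ (subst Even (sym eq) (Even-2# (2# ^ r))) (Odd-norm odd))

  open RingP ring public using (-‿anti-homo-+)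

  private
    m : 𝔾
    m = - 1#

    -- Subtraction is encoded as multiplication by m = -1, treated as a semiring variable; terms
    -- with the factor 1 + m or m + m² are supplied or removed by `absorb`.
    neg : ∀ x → - x ≡ m * x
    neg x = sym (RingP.-1*x≈-x ring x)

    absorb : ∀ z x y → z ≡ 0# → x + z * y ≡ x
    absorb z x y eq = trans (cong (λ z → x + z * y) eq) (trans (cong (x +_) (zeroˡ y)) (+-identityʳ x))

    sub₁ : ∀ m c d a b → (c * a + m * b) + m * (d * a + m * b) ≡ (c + m * d) * a + (m + m * m) * b
    sub₁ = solveG 5 (λ m c d a b → (c ⊗ a ⊕ m ⊗ b) ⊕ m ⊗ (d ⊗ a ⊕ m ⊗ b) ⊜ (c ⊕ m ⊗ d) ⊗ a ⊕ (m ⊕ m ⊗ m) ⊗ b) refl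
    sub₂ : ∀ m c d a′ a b′ b → ((c * a′ + m * b′) + m * (d * a + m * b)) + (1# + m) * (d * a′) ≡
      (c + m * d) * a′ + (d * (a′ + m * a) + m * (b′ + m * b))
    sub₂ = solveG 7 (λ m c d a′ a b′ b → ((c ⊗ a′ ⊕ m ⊗ b′) ⊕ m ⊗ (d ⊗ a ⊕ m ⊗ b)) ⊕ (con 1 ⊕ m) ⊗ (d ⊗ a′) ⊜
      (c ⊕ m ⊗ d) ⊗ a′ ⊕ (d ⊗ (a′ ⊕ m ⊗ a) ⊕ m ⊗ (b′ ⊕ m ⊗ b))) refl
    sub₃ : ∀ m c u a b → c * (u * a) + m * (u * b) ≡ u * (c * a + m * b)
    sub₃ = solveG 5 (λ m c u a b → c ⊗ (u ⊗ a) ⊕ m ⊗ (u ⊗ b) ⊜ u ⊗ (c ⊗ a ⊕ m ⊗ b)) refl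
    sub₄ : ∀ m c d → c * d + m * c ≡ c * (d + m)
    sub₄ = solveG 3 (λ m c d → c ⊗ d ⊕ m ⊗ c ⊜ c ⊗ (d ⊕ m)) refl
    sub₅ : ∀ m c a b → (c * a + m * b) + (1# + m) * a ≡ (c + m) * a + (a + m * b)
    sub₅ = solveG 4 (λ m c a b → (c ⊗ a ⊕ m ⊗ b) ⊕ (con 1 ⊕ m) ⊗ a ⊜ (c ⊕ m) ⊗ a ⊕ (a ⊕ m ⊗ b)) refl

  sub-lemma₁ : ∀ c d a b → (c * a - b) - (d * a - b) ≡ (c - d) * a
  sub-lemma₁ c d a b rewrite neg d | neg b | neg (d * a + m * b) = trans (sub₁ m c d a b) (absorb _ _ b refl)

  sub-lemma₂ : ∀ c d a′ a b′ b → (c * a′ - b′) - (d * a - b) ≡ (c - d) * a′ + (d * (a′ - a) - (b′ - b))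
  sub-lemma₂ c d a′ a b′ b rewrite neg d | neg a | neg b | neg b′ | neg (d * a + m * b) | neg (b′ + m * b) =
    trans (sym (absorb _ _ (d * a′) refl)) (sub₂ m c d a′ a b′ b)

  sub-lemma₃ : ∀ c u a b → c * (u * a) - u * b ≡ u * (c * a - b)
  sub-lemma₃ c u a b rewrite neg b | neg (u * b) = sub₃ m c u a b

  sub-lemma₄ : ∀ c d → c * d - c ≡ c * (d - 1#)
  sub-lemma₄ c d rewrite neg c = sub₄ m c d

  sub-lemma₅ : ∀ c a b → c * a - b ≡ (c - 1#) * a + (a - b)
  sub-lemma₅ c a b rewrite neg b = trans (sym (absorb _ _ a refl)) (sub₅ m c a b)

-- The additive character and a Z/4-valued quadratic form.

module CharacterSums {r : ℕ} (F : Field (2 ℕ.^ r)) (1≤r : 1 ℕ.≤ r) where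
  open FieldTheory F 1≤r
  open Trace F 1≤r
  open Gaussian public using (𝔾; 𝕚; π; conj; Even; Odd) renaming
    (_+_ to _⊞_; _*_ to _⊠_; -_ to ⊟_; _-_ to _⊟_; _^_ to _^ᴳ_; 0# to 0ᴳ; 1# to 1ᴳ; 2# to 2ᴳ)
  module G = Gaussian
  open ≡-Reasoning

  Bit : K → Set
  Bit e = e ≡ 0# ⊎ e ≡ 1#

  -- `e` is the residue of `c` modulo π, seen in the prime field of `K`.
  data Res (c : 𝔾) (e : K) : Set where
    even : Even c → e ≡ 0# → Res c e
    odd : Odd c → e ≡ 1# → Res c e

  private
    lemma₁ : ∀ p y z → p ⊠ y ⊞ p ⊠ z ≡ p ⊠ (y ⊞ z)
    lemma₁ = G.solveG 3 (λ p y z → p G.⊗ y G.⊕ p G.⊗ z G.⊜ p G.⊗ (y G.⊕ z)) refl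
    lemma₂ : ∀ p y z → p ⊠ y ⊞ (1ᴳ ⊞ p ⊠ z) ≡ 1ᴳ ⊞ p ⊠ (y ⊞ z)
    lemma₂ = G.solveG 3 (λ p y z → p G.⊗ y G.⊕ (G.con 1 G.⊕ p G.⊗ z) G.⊜ G.con 1 G.⊕ p G.⊗ (y G.⊕ z)) refl
    lemma₃ : ∀ p y z → (1ᴳ ⊞ p ⊠ y) ⊞ (1ᴳ ⊞ p ⊠ z) ≡ 2ᴳ ⊞ p ⊠ (y ⊞ z)
    lemma₃ = G.solveG 3 (λ p y z → (G.con 1 G.⊕ p G.⊗ y) G.⊕ (G.con 1 G.⊕ p G.⊗ z) G.⊜ (G.con 1 G.⊕ G.con 1) G.⊕ p G.⊗ (y G.⊕ z)) refl
    lemma₄ : ∀ p y z → (1ᴳ ⊞ p ⊠ y) ⊠ (1ᴳ ⊞ p ⊠ z) ≡ 1ᴳ ⊞ p ⊠ ((y ⊞ z) ⊞ p ⊠ (y ⊠ z))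
    lemma₄ = G.solveG 3 (λ p y z → (G.con 1 G.⊕ p G.⊗ y) G.⊗ (G.con 1 G.⊕ p G.⊗ z) G.⊜ G.con 1 G.⊕ p G.⊗ ((y G.⊕ z) G.⊕ p G.⊗ (y G.⊗ z))) refl
    lemma₅ : ∀ p y z → (p ⊠ y) ⊠ z ≡ p ⊠ (y ⊠ z)
    lemma₅ = G.*-assoc
    2≡π* : ∃ λ c → 2ᴳ ≡ π ⊠ c
    2≡π* = conj π , refl

  Even-+ : ∀ {c d} → Even c → Even d → Even (c ⊞ d)
  Even-+ (y , refl) (z , refl) = _ , lemma₁ π y z

  Res-+ : ∀ {c d e f} → Res c e → Res d f → Res (c ⊞ d) (e + f)
  Res-+ (even p refl) (even p′ refl) = even (Even-+ p p′) (+-identityʳ 0#)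
  Res-+ (even (y , refl) refl) (odd (z , refl) refl) = odd (_ , lemma₂ π y z) (+-identityˡ 1#)
  Res-+ (odd (y , refl) refl) (even (z , refl) refl) =
    odd (_ , trans (G.+-comm (1ᴳ ⊞ π ⊠ y) (π ⊠ z)) (lemma₂ π z y)) (+-identityʳ 1#)
  Res-+ (odd (y , refl) refl) (odd (z , refl) refl) =
    even (subst Even (sym (lemma₃ π y z)) (Even-+ 2≡π* (y ⊞ z , refl))) 1+1≡0

  Even-*ˡ : ∀ c {d} → Even c → Even (c ⊠ d)
  Even-*ˡ _ {d} (y , refl) = y ⊠ d , lemma₅ π y d

  Even-*ʳ : ∀ c {d} → Even d → Even (c ⊠ d)
  Even-*ʳ c {d} ev = subst Even (G.*-comm d c) (Even-*ˡ d ev)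

  Res-* : ∀ {c d e f} → Res c e → Res d f → Res (c ⊠ d) (e * f)
  Res-* {f = f} (even p refl) _ = even (Even-*ˡ _ p) (zeroˡ f)
  Res-* {e = e} (odd _ refl) (even p refl) = even (Even-*ʳ _ p) (zeroʳ e)
  Res-* (odd (y , refl) refl) (odd (z , refl) refl) = odd (_ , lemma₄ π y z) (*-identityˡ 1#)

  Res-0 : Res 0ᴳ 0#
  Res-0 = even (0ᴳ , refl) refl

  Res-even : ∀ {c e} → Even c → Res c e → e ≡ 0#
  Res-even ev (even _ eq) = eq
  Res-even ev (odd od _) = ⊥-elim (G.Even-Odd-⊥ ev od)

  Res-π : ∀ c → Res (π ⊠ c) 0#
  Res-π c = even (c , refl) refl

  -- `e` is the π-adic digit after the leading 1, a logarithm modulo π²: by `Unit-*`, products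
  -- become sums.
  Unit : 𝔾 → K → Set
  Unit u e = ∃ λ c → (u ≡ 1ᴳ ⊞ π ⊠ c) × Res c e

  Unit-* : ∀ {u v e f} → Unit u e → Unit v f → Unit (u ⊠ v) (e + f)
  Unit-* {e = e} {f} (c , refl , rc) (d , refl , rd) = _ , lemma₄ π c d ,
    subst (Res _) (+-identityʳ (e + f)) (Res-+ (Res-+ rc rd) (Res-π (c ⊠ d)))

  Unit⇒Res : ∀ {u e} → Unit u e → Res u 1#
  Unit⇒Res (c , eq , _) = odd (c , eq) refl

  sign : K → 𝔾
  sign e with e ≟ 0#
  ... | yes _ = 1ᴳ
  ... | no _ = ⊟ 1ᴳ

  quarter : K → 𝔾
  quarter e with e ≟ 0#
  ... | yes _ = 1ᴳ
  ... | no _ = 𝕚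

  sign-0 : sign 0# ≡ 1ᴳ
  sign-0 with 0# ≟ 0#
  ... | yes _ = refl
  ... | no ne = contradiction refl ne

  sign-1 : sign 1# ≡ ⊟ 1ᴳ
  sign-1 with 1# ≟ 0#
  ... | yes eq = contradiction (sym eq) 0≢1
  ... | no _ = refl

  quarter-0 : quarter 0# ≡ 1ᴳ
  quarter-0 with 0# ≟ 0#
  ... | yes _ = refl
  ... | no ne = contradiction refl ne

  quarter-1 : quarter 1# ≡ 𝕚
  quarter-1 with 1# ≟ 0#
  ... | yes eq = contradiction (sym eq) 0≢1
  ... | no _ = refl

  sign-+ : ∀ {a b} → Bit a → Bit b → sign (a + b) ≡ sign a ⊠ sign b
  sign-+ {b = b} (inj₁ refl) _ = trans (cong sign (+-identityˡ b)) (trans (sym (G.*-identityˡ _)) (cong (_⊠ sign b) (sym sign-0)))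
  sign-+ {a} _ (inj₁ refl) = trans (cong sign (+-identityʳ a)) (trans (sym (G.*-identityʳ _)) (cong (sign a ⊠_) (sym sign-0)))
  sign-+ (inj₂ refl) (inj₂ refl) = trans (cong sign 1+1≡0) (trans sign-0 (sym (cong₂ _⊠_ sign-1 sign-1)))

  -- Since -1 = 1 - 2 agrees with 1 modulo π², signs are invisible at this precision.
  sign-Unit : ∀ e → Unit (sign e) 0#
  sign-Unit e with e ≟ 0#
  ... | yes _ = 0ᴳ , refl , Res-0
  ... | no _ = π ⊠ 𝕚 , refl , Res-π 𝕚

  sign-conj : ∀ e → conj (sign e) ≡ sign e
  sign-conj e with e ≟ 0#
  ... | yes _ = refl
  ... | no _ = refl

  sign-square : ∀ e → sign e ⊠ sign e ≡ 1ᴳ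
  sign-square e with e ≟ 0#
  ... | yes _ = refl
  ... | no _ = refl

  lift : K → 𝔾
  lift e with e ≟ 0#
  ... | yes _ = 0ᴳ
  ... | no _ = 1ᴳ

  sign≡1-2lift : ∀ e → sign e ⊟ 1ᴳ ≡ 2ᴳ ⊠ (⊟ lift e)
  sign≡1-2lift e with e ≟ 0#
  ... | yes _ = refl
  ... | no _ = refl

  Res-lift : ∀ {e} → Bit e → Res (⊟ lift e) e
  Res-lift {e} be with e ≟ 0# | be
  ... | yes refl | _ = Res-0
  ... | no ne | inj₁ eq = contradiction eq ne
  ... | no _ | inj₂ refl = odd (⊟ (conj π) , refl) refl

  χ : K → 𝔾
  χ y = sign (Tr y)

  χ-+ : ∀ x y → χ (x + y) ≡ χ x ⊠ χ y
  χ-+ x y = trans (cong sign (Tr-+ x y)) (sign-+ (Tr-01 x) (Tr-01 y))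

  χ-0 : χ 0# ≡ 1ᴳ
  χ-0 = trans (cong sign Tr-0#) sign-0

  e₂< : ℕ → K → K
  e₂< n x = ∑< n (λ j → ∑< j (λ i → φ i x) * φ j x)

  -- The second elementary symmetric function of the conjugates of `x`.
  e₂ : K → K
  e₂ = e₂< r

  e₂-shift : ∀ n x → e₂< (suc n) x ≡ e₂< n (x ^ 2) + x * ∑< n (λ s → φ s (x ^ 2))
  e₂-shift zero x = trans (+-identityˡ _) (trans (zeroˡ _) (sym (trans (+-identityˡ _) (zeroʳ x))))
  e₂-shift (suc n) x = begin
    e₂< (suc n) x + ∑< (suc n) (λ i → φ i x) * φ (suc n) x ≡⟨ cong₂ _+_ (e₂-shift n x)
      (cong₂ _*_ (trans (∑<-head n (λ i → φ i x)) (cong₂ _+_ (φ-0 x) (∑<-cong n (λ s → φ-suc′ s x)))) (φ-suc′ n x)) ⟩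
    (e₂< n (x ^ 2) + x * T) + (x + T) * φ n (x ^ 2)
      ≡⟨ solveF 4 (λ e x T p → (e ⊕ x ⊗ T) ⊕ (x ⊕ T) ⊗ p ⊜ (e ⊕ T ⊗ p) ⊕ x ⊗ (T ⊕ p)) refl _ x T _ ⟩
    (e₂< n (x ^ 2) + T * φ n (x ^ 2)) + x * (T + φ n (x ^ 2)) ∎
    where T = ∑< n (λ s → φ s (x ^ 2))

  -- Squaring permutes the conjugates cyclically, so it fixes their symmetric function; `e₂-shift`
  -- accounts for the conjugate that moves from the first place to the last.
  e₂-01 : ∀ x → Bit (e₂ x)
  e₂-01 x = idem (begin
    e₂ x ^ 2 ≡⟨ φ-∑< 1 r _ ⟩
    ∑< r (λ j → (∑< j (λ i → φ i x) * φ j x) ^ 2) ≡⟨ ∑<-cong r (λ j → trans (φ-* 1 _ _) (cong₂ _*_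
        (trans (φ-∑< 1 j _) (∑<-cong j λ i → trans (sym (φ-suc i x)) (φ-suc′ i x))) (trans (sym (φ-suc j x)) (φ-suc′ j x)))) ⟩
    e₂ (x ^ 2) ≡⟨ [x+y]+y≡x _ (x * Tr x) ⟨
    (e₂ (x ^ 2) + x * Tr x) + x * Tr x ≡⟨ cong (_+ x * Tr x) (cong (λ T → e₂ (x ^ 2) + x * T) (Tr-square x)) ⟨
    (e₂ (x ^ 2) + x * Tr (x ^ 2)) + x * Tr x ≡⟨ cong (_+ x * Tr x) (e₂-shift r x) ⟨
    (e₂ x + Tr x * φ r x) + x * Tr x ≡⟨ cong₂ (λ u v → (e₂ x + u) + v) (cong (Tr x *_) (φ-r x)) (*-comm x (Tr x)) ⟩
    (e₂ x + Tr x * x) + Tr x * x ≡⟨ [x+y]+y≡x _ _ ⟩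
    e₂ x ∎)

  -- The mixed terms run over i ≠ j: a product of two sums without its diagonal. Partial sums allow
  -- the induction.
  e₂-+ : ∀ n x y → e₂< n (x + y) ≡
    (e₂< n x + e₂< n y) + (∑< n (λ s → φ s x) * ∑< n (λ s → φ s y) + ∑< n (λ s → φ s (x * y)))
  e₂-+ zero x y = sym (trans (cong₂ _+_ (+-identityʳ 0#) (trans (+-identityʳ _) (zeroˡ 0#))) (+-identityʳ 0#))
  e₂-+ (suc n) x y = begin
    e₂< n (x + y) + ∑< n (λ i → φ i (x + y)) * φ n (x + y)
      ≡⟨ cong₂ _+_ (e₂-+ n x y) (cong₂ _*_ (trans (∑<-cong n λ s → φ-+ s x y) (∑<-+ n _ _)) (φ-+ n x y)) ⟩
    ((a + b) + (X * Y + Z)) + (X + Y) * (u + v) ≡⟨ +-identityʳ _ ⟨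
    (((a + b) + (X * Y + Z)) + (X + Y) * (u + v)) + 0# ≡⟨ cong ((((a + b) + (X * Y + Z)) + (X + Y) * (u + v)) +_) (x+x≡0 (u * v)) ⟨
    (((a + b) + (X * Y + Z)) + (X + Y) * (u + v)) + (u * v + u * v)
      ≡⟨ solveF 7 (λ a b X Y Z u v → (((a ⊕ b) ⊕ (X ⊗ Y ⊕ Z)) ⊕ (X ⊕ Y) ⊗ (u ⊕ v)) ⊕ (u ⊗ v ⊕ u ⊗ v) ⊜
           ((a ⊕ X ⊗ u) ⊕ (b ⊕ Y ⊗ v)) ⊕ ((X ⊕ u) ⊗ (Y ⊕ v) ⊕ (Z ⊕ u ⊗ v))) refl a b X Y Z u v ⟩
    ((a + X * u) + (b + Y * v)) + ((X + u) * (Y + v) + (Z + u * v))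
      ≡⟨ cong (λ w → ((a + X * u) + (b + Y * v)) + ((X + u) * (Y + v) + (Z + w))) (φ-* n x y) ⟨
    ((a + X * u) + (b + Y * v)) + ((X + u) * (Y + v) + (Z + φ n (x * y))) ∎
    where
    a = e₂< n x
    b = e₂< n y
    X = ∑< n (λ s → φ s x)
    Y = ∑< n (λ s → φ s y)
    Z = ∑< n (λ s → φ s (x * y))
    u = φ n x
    v = φ n y

  -- The Z/4-valued quadratic form Tr01(x) + 2 e₂(x), polarising to 2 Tr(xy), as a power of i.
  P : K → 𝔾
  P x = quarter (Tr x) ⊠ sign (e₂ x)

  Bit-+ : ∀ {a b} → Bit a → Bit b → Bit (a + b)
  Bit-+ {b = b} (inj₁ refl) bb = subst Bit (sym (+-identityˡ b)) bb
  Bit-+ {a} ba (inj₁ refl) = subst Bit (sym (+-identityʳ a)) ba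
  Bit-+ (inj₂ refl) (inj₂ refl) = inj₁ 1+1≡0

  Bit-* : ∀ {a b} → Bit a → Bit b → Bit (a * b)
  Bit-* {b = b} (inj₁ refl) _ = inj₁ (zeroˡ b)
  Bit-* {b = b} (inj₂ refl) bb = subst Bit (sym (*-identityˡ b)) bb

  -- The carry in adding two bits: the product i · i = -1 occurs exactly when both are 1.
  quarter-+ : ∀ {a b} → Bit a → Bit b → quarter (a + b) ⊠ sign (a * b) ≡ quarter a ⊠ quarter b
  quarter-+ {b = b} (inj₁ refl) _ = trans (cong₂ _⊠_ (cong quarter (+-identityˡ b)) (trans (cong sign (zeroˡ b)) sign-0))
    (trans (G.*-comm _ _) (cong (_⊠ quarter b) (sym quarter-0)))
  quarter-+ {a} _ (inj₁ refl) = trans (cong₂ _⊠_ (cong quarter (+-identityʳ a)) (trans (cong sign (zeroʳ a)) sign-0))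
    (cong (quarter a ⊠_) (sym quarter-0))
  quarter-+ (inj₂ refl) (inj₂ refl) = trans (cong₂ _⊠_ (trans (cong quarter 1+1≡0) quarter-0)
    (trans (cong sign (*-identityˡ 1#)) sign-1)) (sym (cong₂ _⊠_ quarter-1 quarter-1))

  -- The carry of the traces gives the sign of Tr x Tr y, and so does the mixed part of `e₂`; they
  -- cancel and Tr(xy) remains.
  P-+ : ∀ x y → P (x + y) ≡ (P x ⊠ P y) ⊠ χ (x * y)
  P-+ x y = begin
    quarter (Tr (x + y)) ⊠ sign (e₂ (x + y)) ≡⟨ cong₂ (λ a b → quarter a ⊠ sign b) (Tr-+ x y) (e₂-+ r x y) ⟩
    quarter (a + b) ⊠ sign ((e₂ x + e₂ y) + (a * b + Tr (x * y)))
      ≡⟨ cong (quarter (a + b) ⊠_) (trans (sign-+ (Bit-+ (e₂-01 x) (e₂-01 y)) (Bit-+ (Bit-* (Tr-01 x) (Tr-01 y)) (Tr-01 (x * y))))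
           (cong₂ _⊠_ (sign-+ (e₂-01 x) (e₂-01 y)) (sign-+ (Bit-* (Tr-01 x) (Tr-01 y)) (Tr-01 (x * y))))) ⟩
    quarter (a + b) ⊠ ((sign (e₂ x) ⊠ sign (e₂ y)) ⊠ (sign (a * b) ⊠ χ (x * y)))
      ≡⟨ lemma (quarter (a + b)) (sign (e₂ x)) (sign (e₂ y)) (sign (a * b)) (χ (x * y)) ⟩
    (quarter (a + b) ⊠ sign (a * b)) ⊠ ((sign (e₂ x) ⊠ sign (e₂ y)) ⊠ χ (x * y))
      ≡⟨ cong (_⊠ ((sign (e₂ x) ⊠ sign (e₂ y)) ⊠ χ (x * y))) (quarter-+ (Tr-01 x) (Tr-01 y)) ⟩
    (quarter a ⊠ quarter b) ⊠ ((sign (e₂ x) ⊠ sign (e₂ y)) ⊠ χ (x * y))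
      ≡⟨ lemma′ (quarter a) (quarter b) (sign (e₂ x)) (sign (e₂ y)) (χ (x * y)) ⟩
    (P x ⊠ P y) ⊠ χ (x * y) ∎
    where
    a = Tr x
    b = Tr y
    lemma : ∀ q u v s c → q ⊠ ((u ⊠ v) ⊠ (s ⊠ c)) ≡ (q ⊠ s) ⊠ ((u ⊠ v) ⊠ c)
    lemma = G.solveG 5 (λ q u v s c → q G.⊗ ((u G.⊗ v) G.⊗ (s G.⊗ c)) G.⊜ (q G.⊗ s) G.⊗ ((u G.⊗ v) G.⊗ c)) refl
    lemma′ : ∀ p q u v c → (p ⊠ q) ⊠ ((u ⊠ v) ⊠ c) ≡ ((p ⊠ u) ⊠ (q ⊠ v)) ⊠ c
    lemma′ = G.solveG 5 (λ p q u v c → (p G.⊗ q) G.⊗ ((u G.⊗ v) G.⊗ c) G.⊜ ((p G.⊗ u) G.⊗ (q G.⊗ v)) G.⊗ c) refl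

  quarter-conj-Unit : ∀ {e} → Bit e → Unit (conj (quarter e)) e
  quarter-conj-Unit {e} be with e ≟ 0# | be
  ... | yes refl | _ = 0ᴳ , refl , Res-0
  ... | no ne | inj₁ eq = contradiction eq ne
  ... | no _ | inj₂ refl = ⊟ 1ᴳ , refl , odd (π ⊠ 𝕚 , refl) refl

  quarter-norm : ∀ e → quarter e ⊠ conj (quarter e) ≡ 1ᴳ
  quarter-norm e with e ≟ 0#
  ... | yes _ = refl
  ... | no _ = refl

  P̄ : K → 𝔾
  P̄ x = conj (P x)

  P̄-Unit : ∀ x → Unit (P̄ x) (Tr x)
  P̄-Unit x = subst₂ Unit (sym (trans (G.conj-* _ _) (cong (conj (quarter (Tr x)) ⊠_) (sign-conj (e₂ x))))) (+-identityʳ (Tr x))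
    (Unit-* (quarter-conj-Unit (Tr-01 x)) (sign-Unit (e₂ x)))

  P̄-+ : ∀ x y → P̄ (x + y) ≡ (P̄ x ⊠ P̄ y) ⊠ χ (x * y)
  P̄-+ x y = trans (cong conj (P-+ x y)) (trans (G.conj-* _ _) (cong₂ _⊠_ (G.conj-* (P x) (P y)) (sign-conj (Tr (x * y)))))

  P-norm : ∀ x → P x ⊠ P̄ x ≡ 1ᴳ
  P-norm x = trans (cong (P x ⊠_) (trans (G.conj-* _ _) (cong (conj (quarter (Tr x)) ⊠_) (sign-conj (e₂ x)))))
    (trans (lemma _ _ _) (trans (cong₂ _⊠_ (quarter-norm (Tr x)) (sign-square (e₂ x))) (G.*-identityˡ 1ᴳ)))
    where
    lemma : ∀ a b s → (a ⊠ s) ⊠ (b ⊠ s) ≡ (a ⊠ b) ⊠ (s ⊠ s)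
    lemma = G.solveG 3 (λ a b s → (a G.⊗ s) G.⊗ (b G.⊗ s) G.⊜ (a G.⊗ b) G.⊗ (s G.⊗ s)) refl

-- Iterated differences of the quadratic exponential modulo powers of π.

module Differences {r : ℕ} (F : Field (2 ℕ.^ r)) (1≤r : 1 ℕ.≤ r) where
  open FieldTheory F 1≤r
  open Trace F 1≤r
  open CharacterSums F 1≤r
  open ≡-Reasoning

  -- Divisibility by π^n together with the residue of the quotient, the π-adic coefficient at level
  -- `n`, which may be zero.
  Lev : ℕ → 𝔾 → K → Set
  Lev n x e = ∃ λ c → (x ≡ π ^ᴳ n ⊠ c) × Res c e

  private
    shuffle₁ : ∀ p x y → p ⊠ x ⊞ p ⊠ y ≡ p ⊠ (x ⊞ y)
    shuffle₁ = G.solveG 3 (λ p x y → p G.⊗ x G.⊕ p G.⊗ y G.⊜ p G.⊗ (x G.⊕ y)) refl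
    shuffle₂ : ∀ p p′ x y → (p ⊠ x) ⊠ (p′ ⊠ y) ≡ (p ⊠ p′) ⊠ (x ⊠ y)
    shuffle₂ = G.solveG 4 (λ p p′ x y → (p G.⊗ x) G.⊗ (p′ G.⊗ y) G.⊜ (p G.⊗ p′) G.⊗ (x G.⊗ y)) refl

  Lev-+ : ∀ n {x y e f} → Lev n x e → Lev n y f → Lev n (x ⊞ y) (e + f)
  Lev-+ n (c , refl , rc) (d , refl , rd) = c ⊞ d , shuffle₁ (π ^ᴳ n) c d , Res-+ rc rd

  Lev-* : ∀ m n {x y e f} → Lev m x e → Lev n y f → Lev (m ℕ.+ n) (x ⊠ y) (e * f)
  Lev-* m n (c , refl , rc) (d , refl , rd) = c ⊠ d ,
    trans (shuffle₂ (π ^ᴳ m) (π ^ᴳ n) c d) (cong (_⊠ (c ⊠ d)) (sym (G.^-homo-* π m n))) , Res-* rc rd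

  Lev-0 : ∀ n → Lev n 0ᴳ 0#
  Lev-0 n = 0ᴳ , sym (G.zeroʳ _) , Res-0

  Lev-unit : ∀ n {u x e f} → Unit u f → Lev n x e → Lev n (u ⊠ x) e
  Lev-unit n {u} {e = e} unit lev = subst (Lev n _) (*-identityˡ e)
    (Lev-* 0 n (u , sym (G.*-identityˡ u) , Unit⇒Res unit) lev)

  Lev-unit-1 : ∀ {u e} → Unit u e → Lev 1 (u ⊟ 1ᴳ) e
  Lev-unit-1 (c , refl , rc) = c , eq , rc
    where
    eq : (1ᴳ ⊞ π ⊠ c) ⊟ 1ᴳ ≡ (π ⊠ 1ᴳ) ⊠ c
    eq = trans (cong (_⊟ 1ᴳ) (G.+-comm 1ᴳ (π ⊠ c))) (trans (G.+-assoc (π ⊠ c) 1ᴳ (⊟ 1ᴳ))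
      (trans (cong (π ⊠ c ⊞_) (G.-‿inverseʳ 1ᴳ)) (trans (G.+-identityʳ _) (cong (_⊠ c) (sym (G.*-identityʳ π))))))

  Lev-2 : Lev 2 2ᴳ 1#
  Lev-2 = ⊟ 𝕚 , refl , odd (⊟ 1ᴳ , refl) refl

  Lev-χ : ∀ y → Lev 2 (χ y ⊟ 1ᴳ) (Tr y)
  Lev-χ y = subst₂ (Lev 2) (sym (sign≡1-2lift (Tr y))) (*-identityˡ (Tr y))
    (Lev-* 2 0 Lev-2 (⊟ lift (Tr y) , sym (G.*-identityˡ _) , Res-lift (Tr-01 y)))

  -- Signed differences: the pair (β , y) stands for the operator χ(y) g(x + β) - g(x).
  Signed : ℕ → Set
  Signed n = Vec (K × K) n

  steps : ∀ {n} → Signed n → Vec K n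
  steps = Vec.map proj₁

  Ψ : ∀ {n} → Signed n → K → 𝔾
  Ψ [] x = P̄ x
  Ψ ((β , y) ∷ l) x = χ y ⊠ Ψ l (x + β) ⊟ Ψ l x

  -- By polarisation, a translation by γ multiplies the sign at the step β by χ(γβ). Signs are part
  -- of the data because translation does not preserve unsigned differences.
  twist : ∀ {n} → K → Signed n → Signed n
  twist γ = Vec.map (λ { (β , y) → β , y + γ * β })

  steps-twist : ∀ {n} γ (l : Signed n) → steps (twist γ l) ≡ steps l
  steps-twist γ [] = refl
  steps-twist γ (_ ∷ l) = cong (_ ∷_) (steps-twist γ l)

  Ψ-shift : ∀ {n} γ (l : Signed n) x → Ψ l (x + γ) ≡ (P̄ γ ⊠ χ (γ * x)) ⊠ Ψ (twist γ l) x
  Ψ-shift γ [] x = begin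
    P̄ (x + γ) ≡⟨ P̄-+ x γ ⟩
    (P̄ x ⊠ P̄ γ) ⊠ χ (x * γ) ≡⟨ cong (λ e → (P̄ x ⊠ P̄ γ) ⊠ χ e) (*-comm x γ) ⟩
    (P̄ x ⊠ P̄ γ) ⊠ χ (γ * x) ≡⟨ lemma (P̄ x) (P̄ γ) (χ (γ * x)) ⟩
    (P̄ γ ⊠ χ (γ * x)) ⊠ P̄ x ∎
    where
    lemma : ∀ a b c → (a ⊠ b) ⊠ c ≡ (b ⊠ c) ⊠ a
    lemma = G.solveG 3 (λ a b c → (a G.⊗ b) G.⊗ c G.⊜ (b G.⊗ c) G.⊗ a) refl
  Ψ-shift γ ((β , y) ∷ l) x = begin
    χ y ⊠ Ψ l ((x + γ) + β) ⊟ Ψ l (x + γ)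
      ≡⟨ cong₂ (λ a b → χ y ⊠ a ⊟ b) (trans (cong (Ψ l) (solveF 3 (λ x γ β → (x ⊕ γ) ⊕ β ⊜ (x ⊕ β) ⊕ γ) refl x γ β))
           (Ψ-shift γ l (x + β))) (Ψ-shift γ l x) ⟩
    χ y ⊠ ((P̄ γ ⊠ χ (γ * (x + β))) ⊠ A) ⊟ u ⊠ B
      ≡⟨ cong (λ c → χ y ⊠ ((P̄ γ ⊠ c) ⊠ A) ⊟ u ⊠ B) (trans (cong χ (distribˡ γ x β)) (χ-+ _ _)) ⟩
    χ y ⊠ ((P̄ γ ⊠ (χ (γ * x) ⊠ χ (γ * β))) ⊠ A) ⊟ u ⊠ B
      ≡⟨ cong₂ _⊞_ (lemma (χ y) (P̄ γ) (χ (γ * x)) (χ (γ * β)) A) (G.-‿distribʳ-* u B) ⟩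
    u ⊠ ((χ y ⊠ χ (γ * β)) ⊠ A) ⊞ u ⊠ (⊟ B) ≡⟨ G.distribˡ u _ _ ⟨
    u ⊠ ((χ y ⊠ χ (γ * β)) ⊠ A ⊟ B) ≡⟨ cong (λ c → u ⊠ (c ⊠ A ⊟ B)) (χ-+ y (γ * β)) ⟨
    u ⊠ (χ (y + γ * β) ⊠ A ⊟ B) ∎
    where
    A = Ψ (twist γ l) (x + β)
    B = Ψ (twist γ l) x
    u = P̄ γ ⊠ χ (γ * x)
    lemma : ∀ a b c d e → a ⊠ ((b ⊠ (c ⊠ d)) ⊠ e) ≡ (b ⊠ c) ⊠ ((a ⊠ d) ⊠ e)
    lemma = G.solveG 5 (λ a b c d e → a G.⊗ ((b G.⊗ (c G.⊗ d)) G.⊗ e) G.⊜ (b G.⊗ c) G.⊗ ((a G.⊗ d) G.⊗ e)) refl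

  sumPicks : ∀ {A : Set} {n} → Vec A (suc n) → (A → Vec A n → K) → K
  sumPicks (y ∷ []) f = f y []
  sumPicks (y ∷ w@(_ ∷ _)) f = f y w + sumPicks w (λ y′ w′ → f y′ (y ∷ w′))

  -- The sum over all partial matchings of v of the product of Tr(βᵢβⱼ) over the matched
  -- pairs and of Tr(βₖ) over the unmatched entries.
  R : ∀ n → Vec K n → K
  R zero [] = 1#
  R (suc zero) (β ∷ []) = Tr β * 1# + 0#
  R (suc (suc n)) (β ∷ v) = Tr β * R (suc n) v + sumPicks v (λ y w → Tr (β * y) * R n w)

  -- Stages of twisting one entry at a time: the entries before the chosen one are not yet twisted,
  -- those after it already are.
  sumTw : ∀ {n} → K → Signed (suc n) → (K × K → Signed n → 𝔾) → 𝔾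
  sumTw γ (p ∷ []) f = f p []
  sumTw γ (p ∷ l@(_ ∷ _)) f = f p (twist γ l) ⊞ sumTw γ l (λ p′ w → f p′ (p ∷ w))

  flip-term : ∀ {n} → K → K → K × K → Signed n → 𝔾
  flip-term γ x (β , y) w = (χ (y + γ * β) ⊟ χ y) ⊠ Ψ w (x + β)

  sumTw-cong : ∀ {n} γ (l : Signed (suc n)) {f g} → (∀ p w → f p w ≡ g p w) → sumTw γ l f ≡ sumTw γ l g
  sumTw-cong γ (p ∷ []) eq = eq p []
  sumTw-cong γ (p ∷ l@(_ ∷ _)) eq = cong₂ _⊞_ (eq p _) (sumTw-cong γ l (λ p′ w → eq p′ (p ∷ w)))

  sumTw-linear : ∀ {n} γ (l : Signed (suc n)) c f g →
    sumTw γ l (λ p w → c ⊠ f p w ⊟ g p w) ≡ c ⊠ sumTw γ l f ⊟ sumTw γ l g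
  sumTw-linear γ (p ∷ []) c f g = refl
  sumTw-linear γ (p ∷ l@(_ ∷ _)) c f g = begin
    (c ⊠ a ⊟ b) ⊞ sumTw γ l _ ≡⟨ cong ((c ⊠ a ⊟ b) ⊞_) (sumTw-linear γ l c _ _) ⟩
    (c ⊠ a ⊟ b) ⊞ (c ⊠ a′ ⊟ b′) ≡⟨ lemma c a (⊟ b) a′ (⊟ b′) ⟩
    c ⊠ (a ⊞ a′) ⊞ (⊟ b ⊞ ⊟ b′) ≡⟨ cong (c ⊠ (a ⊞ a′) ⊞_) (neg-+ b b′) ⟨
    c ⊠ (a ⊞ a′) ⊟ (b ⊞ b′) ∎
    where
    a = f p (twist γ l)
    b = g p (twist γ l)
    a′ = sumTw γ l (λ p′ w → f p′ (p ∷ w))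
    b′ = sumTw γ l (λ p′ w → g p′ (p ∷ w))
    lemma : ∀ c a b a′ b′ → (c ⊠ a ⊞ b) ⊞ (c ⊠ a′ ⊞ b′) ≡ c ⊠ (a ⊞ a′) ⊞ (b ⊞ b′)
    lemma = G.solveG 5 (λ c a b a′ b′ → (c G.⊗ a G.⊕ b) G.⊕ (c G.⊗ a′ G.⊕ b′) G.⊜ c G.⊗ (a G.⊕ a′) G.⊕ (b G.⊕ b′)) refl
    neg-+ : ∀ x y → ⊟ (x ⊞ y) ≡ ⊟ x ⊞ ⊟ y
    neg-+ x y = trans (G.-‿anti-homo-+ x y) (G.+-comm _ _)

  -- Telescoping from `l` to `twist γ l`: each stage changes the sign in front of a single
  -- translated term.
  twist-difference : ∀ {n} γ (l : Signed (suc n)) x → Ψ (twist γ l) x ⊟ Ψ l x ≡ sumTw γ l (flip-term γ x)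
  twist-difference γ ((β , y) ∷ []) x = lemma (χ (y + γ * β)) (χ y) (P̄ (x + β)) (P̄ x)
    where
    lemma : ∀ c d a b → (c ⊠ a ⊟ b) ⊟ (d ⊠ a ⊟ b) ≡ (c ⊟ d) ⊠ a
    lemma c d a b = G.sub-lemma₁ c d a b
  twist-difference γ (p@(β , y) ∷ l@(_ ∷ _)) x = begin
    (χ (y + γ * β) ⊠ A′ ⊟ B′) ⊟ (χ y ⊠ A ⊟ B) ≡⟨ G.sub-lemma₂ (χ (y + γ * β)) (χ y) A′ A B′ B ⟩
    (χ (y + γ * β) ⊟ χ y) ⊠ A′ ⊞ (χ y ⊠ (A′ ⊟ A) ⊟ (B′ ⊟ B))
      ≡⟨ cong₂ (λ a b → (χ (y + γ * β) ⊟ χ y) ⊠ A′ ⊞ (χ y ⊠ a ⊟ b)) (twist-difference γ l (x + β)) (twist-difference γ l x) ⟩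
    (χ (y + γ * β) ⊟ χ y) ⊠ A′ ⊞ (χ y ⊠ sumTw γ l (flip-term γ (x + β)) ⊟ sumTw γ l (flip-term γ x))
      ≡⟨ cong ((χ (y + γ * β) ⊟ χ y) ⊠ A′ ⊞_) (trans (sym (sumTw-linear γ l (χ y) _ _)) (sumTw-cong γ l step)) ⟩
    (χ (y + γ * β) ⊟ χ y) ⊠ A′ ⊞ sumTw γ l (λ p′ w → flip-term γ x p′ (p ∷ w)) ∎
    where
    A′ = Ψ (twist γ l) (x + β)
    A = Ψ l (x + β)
    B′ = Ψ (twist γ l) x
    B = Ψ l x
    step : ∀ p′ w → χ y ⊠ flip-term γ (x + β) p′ w ⊟ flip-term γ x p′ w ≡ flip-term γ x p′ (p ∷ w)
    step (β′ , y′) w = trans (cong (λ e → χ y ⊠ ((χ (y′ + γ * β′) ⊟ χ y′) ⊠ Ψ w e) ⊟ flip-term γ x (β′ , y′) w)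
        (solveF 3 (λ x b c → (x ⊕ b) ⊕ c ⊜ (x ⊕ c) ⊕ b) refl x β β′))
      (G.sub-lemma₃ (χ y) (χ (y′ + γ * β′) ⊟ χ y′) (Ψ w ((x + β′) + β)) (Ψ w (x + β′)))

  Lev-sumTw : ∀ {n} m γ (l : Signed (suc n)) {f g} → (∀ β y w → Lev m (f (β , y) w) (g β (steps w))) →
    Lev m (sumTw γ l f) (sumPicks (steps l) g)
  Lev-sumTw m γ (p ∷ []) lev = lev _ _ []
  Lev-sumTw m γ (p ∷ l@(_ ∷ _)) {f} {g} lev = Lev-+ m
    (subst (λ w → Lev m (f p (twist γ l)) (g (proj₁ p) w)) (steps-twist γ l) (lev _ _ (twist γ l)))
    (Lev-sumTw m γ l λ β y w → lev β y (p ∷ w))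

  Lev-flip : ∀ {n} γ x β y (w : Signed n) {e} → Lev n (Ψ w (x + β)) e → Lev (2 ℕ.+ n) (flip-term γ x (β , y) w) (Tr (γ * β) * e)
  Lev-flip {n} γ x β y w lev = Lev-* 2 n (subst (λ c → Lev 2 c _) (sym eq) (Lev-unit 2 (sign-Unit (Tr y)) (Lev-χ (γ * β)))) lev
    where
    eq : χ (y + γ * β) ⊟ χ y ≡ χ y ⊠ (χ (γ * β) ⊟ 1ᴳ)
    eq = trans (cong (_⊟ χ y) (χ-+ y (γ * β))) (G.sub-lemma₄ (χ y) (χ (γ * β)))

  -- Splitting off the first step β leaves two parts: a unit minus 1, of level 1 with digit Tr β,
  -- where β stays unmatched; and a twist difference, where β is matched with another step β′ and
  -- the two steps together gain the factor χ(ββ′) - 1 of level 2. The recursion runs on `n`, as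
  -- twisted vectors are not subterms.
  Lev-Ψ : ∀ n (l : Signed n) x → Lev n (Ψ l x) (R n (steps l))

  Lev-step : ∀ n β y (l : Signed n) x {e f} → Lev n (Ψ (twist β l) x) e → Lev (suc n) (Ψ (twist β l) x ⊟ Ψ l x) f →
    Lev (suc n) (Ψ ((β , y) ∷ l) x) (Tr β * e + f)
  Lev-step n β y l x {e} {f} lev dif = subst (λ c → Lev (suc n) c (Tr β * e + f)) (sym eq)
    (Lev-+ (suc n) (Lev-* 1 n (Lev-unit-1 unit) lev) dif)
    where
    ς = χ y ⊠ (P̄ β ⊠ χ (β * x))
    unit : Unit ς (Tr β)
    unit = subst (Unit ς) (trans (+-identityˡ _) (+-identityʳ _)) (Unit-* (sign-Unit (Tr y)) (Unit-* (P̄-Unit β) (sign-Unit (Tr (β * x)))))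
    eq : Ψ ((β , y) ∷ l) x ≡ (ς ⊟ 1ᴳ) ⊠ Ψ (twist β l) x ⊞ (Ψ (twist β l) x ⊟ Ψ l x)
    eq = trans (cong (λ c → χ y ⊠ c ⊟ Ψ l x) (Ψ-shift β l x))
      (trans (cong (_⊟ Ψ l x) (sym (G.*-assoc (χ y) (P̄ β ⊠ χ (β * x)) (Ψ (twist β l) x))))
        (G.sub-lemma₅ ς (Ψ (twist β l) x) (Ψ l x)))

  Lev-Ψ zero [] x = P̄ x , sym (G.*-identityˡ _) , Unit⇒Res (P̄-Unit x)
  Lev-Ψ (suc zero) ((β , y) ∷ []) x = Lev-step 0 β y [] x (Lev-Ψ 0 [] x)
    (subst (λ c → Lev 1 c 0#) (sym (G.-‿inverseʳ (P̄ x))) (Lev-0 1))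
  Lev-Ψ (suc (suc n)) ((β , y) ∷ l) x = Lev-step (suc n) β y l x
    (subst (λ v → Lev (suc n) (Ψ (twist β l) x) (R (suc n) v)) (steps-twist β l) (Lev-Ψ (suc n) (twist β l) x))
    (subst (λ c → Lev (suc (suc n)) c _) (sym (twist-difference β l x))
      (Lev-sumTw (suc (suc n)) β l λ β′ y′ w → Lev-flip β x β′ y′ w (Lev-Ψ n w (x + β′))))

-- Transforms of monomials and the substitution identity.

module Spectrum {r : ℕ} (F : Field (2 ℕ.^ r)) (1≤r : 1 ℕ.≤ r) (t′ : ℕ) where
  open FieldTheory F 1≤r
  open Trace F 1≤r
  open CharacterSums F 1≤r
  open Differences F 1≤r
  open ≡-Reasoning

  module GS = Sums G.+-isCommutativeMonoid
  module GSS = SSum G.semiring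
  module GM = SMult G.semiring

  t : ℕ
  t = 2 ℕ.+ t′

  ∑ᴳ : (K → 𝔾) → 𝔾
  ∑ᴳ = GS.sum {q}

  ∑ᴳ-*ˡ : ∀ c (f : K → 𝔾) → ∑ᴳ (λ x → c ⊠ f x) ≡ c ⊠ ∑ᴳ f
  ∑ᴳ-*ˡ c f = sym (GSS.*-distribˡ-sum c f)

  ∑ᴳ-*ʳ : ∀ c (f : K → 𝔾) → ∑ᴳ (λ x → f x ⊠ c) ≡ ∑ᴳ f ⊠ c
  ∑ᴳ-*ʳ c f = sym (GSS.*-distribʳ-sum c f)

  ⊟≡-1⊠ : ∀ x → ⊟ x ≡ (⊟ 1ᴳ) ⊠ x
  ⊟≡-1⊠ x = trans (cong ⊟_ (sym (G.*-identityˡ x))) (G.-‿distribˡ-* 1ᴳ x)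

  ∑ᴳ-⊟ : ∀ (f g : K → 𝔾) → ∑ᴳ (λ x → f x ⊟ g x) ≡ ∑ᴳ f ⊟ ∑ᴳ g
  ∑ᴳ-⊟ f g = trans (GS.∑-distrib-+ f (λ x → ⊟ g x)) (cong (∑ᴳ f ⊞_)
    (trans (GS.sum-cong-≗ (λ x → ⊟≡-1⊠ (g x))) (trans (∑ᴳ-*ˡ (⊟ 1ᴳ) g) (sym (⊟≡-1⊠ (∑ᴳ g))))))

  ∑ᴳ-translate : ∀ c (h : K → 𝔾) → ∑ᴳ h ≡ ∑ᴳ (λ x → h (x + c))
  ∑ᴳ-translate c h = GS.sum-reindex (_+ c) (_+ c) (λ x → [x+y]+y≡x x c) (λ x → [x+y]+y≡x x c) h

  ∑ᴳ-scale : ∀ {c d} → c * d ≡ 1# → (h : K → 𝔾) → ∑ᴳ h ≡ ∑ᴳ (λ x → h (c * x))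
  ∑ᴳ-scale {c} {d} cd h = GS.sum-reindex (c *_) (d *_) (inv cd) (inv (trans (*-comm d c) cd)) h
    where
    inv : ∀ {u v} → u * v ≡ 1# → ∀ x → u * (v * x) ≡ x
    inv {u} {v} uv x = trans (sym (*-assoc u v x)) (trans (cong (_* x) uv) (*-identityˡ x))

  ∑ᴳ-off-0 : ∀ (f g : K → 𝔾) → (∀ x → x ≢ 0# → f x ≡ g x) → ∑ᴳ f ≡ ∑ᴳ g ⊞ (f 0# ⊟ g 0#)
  ∑ᴳ-off-0 f g eq = begin
    ∑ᴳ f ≡⟨ lemma (∑ᴳ f) (∑ᴳ g) ⟩
    ∑ᴳ g ⊞ (∑ᴳ f ⊟ ∑ᴳ g) ≡⟨ cong (∑ᴳ g ⊞_) (∑ᴳ-⊟ f g) ⟨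
    ∑ᴳ g ⊞ ∑ᴳ (λ x → f x ⊟ g x) ≡⟨ cong (∑ᴳ g ⊞_) (GS.sum-single 0# (λ x → f x ⊟ g x) λ x ne →
        trans (cong (_⊟ g x) (eq x ne)) (G.-‿inverseʳ (g x))) ⟩
    ∑ᴳ g ⊞ (f 0# ⊟ g 0#) ∎
    where
    lemma : ∀ a b → a ≡ b ⊞ (a ⊟ b)
    lemma a b = sym (trans (G.+-comm b (a ⊟ b)) (trans (G.+-assoc a (⊟ b) b) (trans (cong (a ⊞_) (G.-‿inverseˡ b)) (G.+-identityʳ a))))

  -- Translating by an element that raises Tr(cy) by 1 changes the sign of the sum.
  χ-sum : ∀ {c} → c ≢ 0# → ∑ᴳ (λ y → χ (c * y)) ≡ 0ᴳ
  χ-sum {c} c≢0 = G.2#-cancel (begin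
    2ᴳ ⊠ S ≡⟨ G.distribʳ S 1ᴳ 1ᴳ ⟩
    1ᴳ ⊠ S ⊞ 1ᴳ ⊠ S ≡⟨ cong₂ _⊞_ (G.*-identityˡ S) (G.*-identityˡ S) ⟩
    S ⊞ S ≡⟨ cong (S ⊞_) S≡-S ⟩
    S ⊞ (⊟ S) ≡⟨ G.-‿inverseʳ S ⟩
    0ᴳ ≡⟨⟩
    2ᴳ ⊠ 0ᴳ ∎)
    where
    S = ∑ᴳ (λ y → χ (c * y))
    y₀ = proj₁ ∃-Tr≡1
    c⁻¹ = proj₁ (inverse c c≢0)
    S≡-S : S ≡ ⊟ S
    S≡-S = begin
      S ≡⟨ ∑ᴳ-translate (c⁻¹ * y₀) (λ y → χ (c * y)) ⟩
      ∑ᴳ (λ y → χ (c * (y + c⁻¹ * y₀))) ≡⟨ GS.sum-cong-≗ (λ y → trans (cong χ (trans (distribˡ c y (c⁻¹ * y₀))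
          (cong (c * y +_) (trans (sym (*-assoc c c⁻¹ y₀)) (trans (cong (_* y₀) (proj₂ (inverse c c≢0))) (*-identityˡ y₀))))))
          (trans (χ-+ (c * y) y₀) (trans (cong (χ (c * y) ⊠_) (trans (cong sign (proj₂ ∃-Tr≡1)) sign-1)) (G.*-comm _ _)))) ⟩
      ∑ᴳ (λ y → (⊟ 1ᴳ) ⊠ χ (c * y)) ≡⟨ ∑ᴳ-*ˡ (⊟ 1ᴳ) (λ y → χ (c * y)) ⟩
      (⊟ 1ᴳ) ⊠ S ≡⟨ ⊟≡-1⊠ S ⟨
      ⊟ S ∎

  conj-sum : ∀ {n} (f : Fin n → 𝔾) → conj (GS.sum f) ≡ GS.sum (λ i → conj (f i))
  conj-sum {zero} f = refl
  conj-sum {suc n} f = trans (G.conj-+ (f zero) _) (cong (conj (f zero) ⊞_) (conj-sum (λ i → f (suc i))))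

  ∑ᴳ-1 : ∑ᴳ (λ _ → 1ᴳ) ≡ 2ᴳ ^ᴳ r
  ∑ᴳ-1 = trans (GS.sum-replicate q) (2^×1ᴳ r)
    where
    2^×1ᴳ : ∀ n → (2 ℕ.^ n) GM.× 1ᴳ ≡ 2ᴳ ^ᴳ n
    2^×1ᴳ zero = refl
    2^×1ᴳ (suc n) = trans (GM.×1-homo-* 2 (2 ℕ.^ n)) (cong (2ᴳ ⊠_) (2^×1ᴳ n))

  P-0 : P 0# ≡ 1ᴳ
  P-0 = cong₂ _⊠_ (trans (cong quarter Tr-0#) quarter-0)
    (trans (cong sign (∑<-zero r λ {j} _ → trans (cong (∑< j (λ i → φ i 0#) *_) (φ-0# j)) (zeroʳ _))) sign-0)

  Γ : 𝔾
  Γ = ∑ᴳ P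

  -- Completing the square: a linear character is absorbed by a translation.
  P-χ-sum : ∀ μ → ∑ᴳ (λ x → P x ⊠ χ (μ * x)) ≡ P̄ μ ⊠ Γ
  P-χ-sum μ = begin
    ∑ᴳ (λ x → P x ⊠ χ (μ * x)) ≡⟨ GS.sum-cong-≗ pointwise ⟩
    ∑ᴳ (λ x → P̄ μ ⊠ P (x + μ)) ≡⟨ ∑ᴳ-*ˡ (P̄ μ) _ ⟩
    P̄ μ ⊠ ∑ᴳ (λ x → P (x + μ)) ≡⟨ cong (P̄ μ ⊠_) (∑ᴳ-translate μ P) ⟨
    P̄ μ ⊠ Γ ∎
    where
    lemma : ∀ a b b̄ c → b̄ ⊠ ((a ⊠ b) ⊠ c) ≡ (b ⊠ b̄) ⊠ (a ⊠ c)
    lemma = G.solveG 4 (λ a b b̄ c → b̄ G.⊗ ((a G.⊗ b) G.⊗ c) G.⊜ (b G.⊗ b̄) G.⊗ (a G.⊗ c)) refl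
    pointwise : ∀ x → P x ⊠ χ (μ * x) ≡ P̄ μ ⊠ P (x + μ)
    pointwise x = sym (begin
      P̄ μ ⊠ P (x + μ) ≡⟨ cong (P̄ μ ⊠_) (P-+ x μ) ⟩
      P̄ μ ⊠ ((P x ⊠ P μ) ⊠ χ (x * μ)) ≡⟨ lemma (P x) (P μ) (P̄ μ) _ ⟩
      (P μ ⊠ P̄ μ) ⊠ (P x ⊠ χ (x * μ)) ≡⟨ cong₂ (λ a b → a ⊠ (P x ⊠ χ b)) (P-norm μ) (*-comm x μ) ⟩
      1ᴳ ⊠ (P x ⊠ χ (μ * x)) ≡⟨ G.*-identityˡ _ ⟩
      P x ⊠ χ (μ * x) ∎)

  -- The transform of i^Q (-1)^{Tr(u x^t)} at μ.
  P̂ : K → K → 𝔾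
  P̂ u μ = ∑ᴳ (λ x → P x ⊠ χ (u * x ^ t + μ * x))

  -- What planarity of y ↦ u y^t yields when its difference maps are tested against the single
  -- character χ.
  Flat : K → Set
  Flat u = ∀ b → b ≢ 0# → ∑ᴳ (λ y → χ (u * ((y + b) ^ t + y ^ t) + y * b)) ≡ 0ᴳ

  -- With x = y + b in the double sum, polarisation of `P` supplies the summand yb of `Flat`, and
  -- every b ≠ 0 drops out.
  P̂-norm : ∀ {u} → Flat u → ∀ μ → P̂ u μ ⊠ conj (P̂ u μ) ≡ 2ᴳ ^ᴳ r
  P̂-norm {u} flat μ = begin
    P̂ u μ ⊠ conj (P̂ u μ) ≡⟨ cong (P̂ u μ ⊠_) (trans (conj-sum A) (GS.sum-cong-≗ (λ y → trans (G.conj-* (P y) (χ (E y))) (cong (P̄ y ⊠_) (sign-conj (Tr (E y))))))) ⟩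
    ∑ᴳ A ⊠ ∑ᴳ Ā ≡⟨ ∑ᴳ-*ˡ (∑ᴳ A) Ā ⟨
    ∑ᴳ (λ y → ∑ᴳ A ⊠ Ā y) ≡⟨ GS.sum-cong-≗ (λ y → trans (cong (_⊠ Ā y) (trans (∑ᴳ-translate y A) (GS.sum-cong-≗ (λ b → cong A (+-comm b y)))))
        (sym (∑ᴳ-*ʳ (Ā y) (λ b → A (y + b))))) ⟩
    ∑ᴳ (λ y → ∑ᴳ (λ b → A (y + b) ⊠ Ā y)) ≡⟨ GS.∑-comm (λ y b → A (y + b) ⊠ Ā y) ⟩
    ∑ᴳ (λ b → ∑ᴳ (λ y → A (y + b) ⊠ Ā y)) ≡⟨ GS.sum-cong-≗ (λ b → trans (GS.sum-cong-≗ (pointwise b)) (∑ᴳ-*ˡ (P b ⊠ χ (μ * b)) _)) ⟩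
    ∑ᴳ (λ b → (P b ⊠ χ (μ * b)) ⊠ I b) ≡⟨ GS.sum-single 0# _ (λ b b≢0 → trans (cong ((P b ⊠ χ (μ * b)) ⊠_) (flat b b≢0)) (G.zeroʳ _)) ⟩
    (P 0# ⊠ χ (μ * 0#)) ⊠ I 0# ≡⟨ cong₂ (λ a b → (a ⊠ b) ⊠ I 0#) P-0 (trans (cong χ (zeroʳ μ)) χ-0) ⟩
    (1ᴳ ⊠ 1ᴳ) ⊠ I 0# ≡⟨ G.*-identityˡ (I 0#) ⟩
    I 0# ≡⟨ GS.sum-cong-≗ (λ y → trans (cong χ (trans (cong₂ _+_ (trans (cong (λ e → u * (e ^ t + y ^ t)) (+-identityʳ y)) (trans (cong (u *_) (x+x≡0 (y ^ t))) (zeroʳ u))) (zeroʳ y)) (+-identityʳ 0#))) χ-0) ⟩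
    ∑ᴳ (λ _ → 1ᴳ) ≡⟨ ∑ᴳ-1 ⟩
    2ᴳ ^ᴳ r ∎
    where
    E : K → K
    E x = u * x ^ t + μ * x
    A Ā I : K → 𝔾
    A x = P x ⊠ χ (E x)
    Ā y = P̄ y ⊠ χ (E y)
    I b = ∑ᴳ (λ y → χ (u * ((y + b) ^ t + y ^ t) + y * b))
    lemma : ∀ p b c e p̄ e′ → (((p ⊠ b) ⊠ c) ⊠ e) ⊠ (p̄ ⊠ e′) ≡ (p ⊠ p̄) ⊠ (b ⊠ ((e ⊠ e′) ⊠ c))
    lemma = G.solveG 6 (λ p b c e p̄ e′ → (((p G.⊗ b) G.⊗ c) G.⊗ e) G.⊗ (p̄ G.⊗ e′) G.⊜ (p G.⊗ p̄) G.⊗ (b G.⊗ ((e G.⊗ e′) G.⊗ c))) refl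
    E-+ : ∀ y b → E (y + b) + E y ≡ μ * b + u * ((y + b) ^ t + y ^ t)
    E-+ y b = begin
      (u * (y + b) ^ t + μ * (y + b)) + (u * y ^ t + μ * y)
        ≡⟨ solveF 6 (λ u μ y b X Y → (u ⊗ X ⊕ μ ⊗ (y ⊕ b)) ⊕ (u ⊗ Y ⊕ μ ⊗ y) ⊜ (μ ⊗ b ⊕ u ⊗ (X ⊕ Y)) ⊕ (μ ⊗ y ⊕ μ ⊗ y)) refl u μ y b ((y + b) ^ t) (y ^ t) ⟩
      (μ * b + u * ((y + b) ^ t + y ^ t)) + (μ * y + μ * y) ≡⟨ cong (λ e → (μ * b + u * ((y + b) ^ t + y ^ t)) + e) (x+x≡0 (μ * y)) ⟩
      (μ * b + u * ((y + b) ^ t + y ^ t)) + 0# ≡⟨ +-identityʳ _ ⟩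
      μ * b + u * ((y + b) ^ t + y ^ t) ∎
    pointwise : ∀ b y → A (y + b) ⊠ Ā y ≡ (P b ⊠ χ (μ * b)) ⊠ χ (u * ((y + b) ^ t + y ^ t) + y * b)
    pointwise b y = begin
      (P (y + b) ⊠ χ (E (y + b))) ⊠ (P̄ y ⊠ χ (E y)) ≡⟨ cong (λ e → (e ⊠ χ (E (y + b))) ⊠ (P̄ y ⊠ χ (E y))) (P-+ y b) ⟩
      (((P y ⊠ P b) ⊠ χ (y * b)) ⊠ χ (E (y + b))) ⊠ (P̄ y ⊠ χ (E y)) ≡⟨ lemma (P y) (P b) (χ (y * b)) (χ (E (y + b))) (P̄ y) (χ (E y)) ⟩
      (P y ⊠ P̄ y) ⊠ (P b ⊠ ((χ (E (y + b)) ⊠ χ (E y)) ⊠ χ (y * b)))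
        ≡⟨ cong₂ (λ a c → a ⊠ (P b ⊠ (c ⊠ χ (y * b)))) (P-norm y) (trans (sym (χ-+ _ _)) (trans (cong χ (E-+ y b)) (χ-+ _ _))) ⟩
      1ᴳ ⊠ (P b ⊠ ((χ (μ * b) ⊠ χ (u * ((y + b) ^ t + y ^ t))) ⊠ χ (y * b)))
        ≡⟨ lemma′ (P b) (χ (μ * b)) (χ (u * ((y + b) ^ t + y ^ t))) (χ (y * b)) ⟩
      (P b ⊠ χ (μ * b)) ⊠ (χ (u * ((y + b) ^ t + y ^ t)) ⊠ χ (y * b)) ≡⟨ cong ((P b ⊠ χ (μ * b)) ⊠_) (χ-+ _ _) ⟨
      (P b ⊠ χ (μ * b)) ⊠ χ (u * ((y + b) ^ t + y ^ t) + y * b) ∎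
      where
      lemma′ : ∀ b m u c → 1ᴳ ⊠ (b ⊠ ((m ⊠ u) ⊠ c)) ≡ (b ⊠ m) ⊠ (u ⊠ c)
      lemma′ = G.solveG 4 (λ b m u c → G.con 1 G.⊗ (b G.⊗ ((m G.⊗ u) G.⊗ c)) G.⊜ (b G.⊗ m) G.⊗ (u G.⊗ c)) refl

  Flat-0 : Flat 0#
  Flat-0 b b≢0 = trans (GS.sum-cong-≗ (λ y → cong χ (trans (cong₂ _+_ (zeroˡ _) (*-comm y b)) (+-identityˡ (b * y))))) (χ-sum b≢0)

  infix 9 _⁻¹
  -- The power q - 2: the inverse off zero and, being a power, multiplicative on all of `K`, so
  -- rescaling `z` needs no case distinction.
  _⁻¹ : K → K
  z ⁻¹ = z ^ neg2^ 0

  ⁻¹-* : ∀ x z → (x * z) ⁻¹ ≡ x ⁻¹ * z ⁻¹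
  ⁻¹-* x z = ^-distrib-* x z (neg2^ 0)

  x*x⁻¹ : ∀ {x} → x ≢ 0# → x * x ⁻¹ ≡ 1#
  x*x⁻¹ {x} x≢0 = trans (cong (x ^_) (trans (ℕₚ.+-comm 1 (neg2^ 0)) (ℕₚ.m∸n+n≡m (2^<q 1≤r)))) (^q-1 x≢0)

  κ : K → K → K
  κ a z = sqrt (a * z ^ t′)

  -- For x ≠ 0, replacing z by z/x turns a z^t′ x^t into (κx)², whose trace is Tr(κx); the phase
  -- becomes linear in x and the sum over x completes a square. The discrepancy at x = 0 is a
  -- correction free of `a`.
  main-identity : ∀ a ν β →
    ∑ᴳ (λ z → χ (β * z ⁻¹) ⊠ P̂ (a * z ^ t′) (ν * z)) ≡
    ∑ᴳ (λ z → χ (ν * z) ⊠ P̄ (β * z ⁻¹ + κ a z)) ⊠ Γ ⊞ (∑ᴳ (λ z → χ (β * z ⁻¹)) ⊟ ∑ᴳ (λ z → χ (ν * z)))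
  main-identity a ν β = begin
    ∑ᴳ (λ z → χ (β * z ⁻¹) ⊠ P̂ (a * z ^ t′) (ν * z)) ≡⟨ GS.sum-cong-≗ (λ z → trans (sym (∑ᴳ-*ˡ (χ (β * z ⁻¹)) _))
        (GS.sum-cong-≗ λ x → trans (swap (χ (β * z ⁻¹)) (P x) _) (cong (P x ⊠_) (sym (χ-+ _ _))))) ⟩
    ∑ᴳ (λ z → ∑ᴳ (λ x → P x ⊠ χ (v z x))) ≡⟨ GS.∑-comm (λ z x → P x ⊠ χ (v z x)) ⟩
    ∑ᴳ (λ x → ∑ᴳ (λ z → P x ⊠ χ (v z x))) ≡⟨ GS.sum-cong-≗ (λ x → ∑ᴳ-*ˡ (P x) (λ z → χ (v z x))) ⟩
    ∑ᴳ (λ x → P x ⊠ V x) ≡⟨ ∑ᴳ-off-0 (λ x → P x ⊠ V x) (λ x → P x ⊠ W x) (λ x x≢0 → cong (P x ⊠_) (V≡W x x≢0)) ⟩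
    ∑ᴳ (λ x → P x ⊠ W x) ⊞ (P 0# ⊠ V 0# ⊟ P 0# ⊠ W 0#) ≡⟨ cong₂ _⊞_ ∑PW (cong₂ _⊟_ (PX V V0) (PX W W0)) ⟩
    ∑ᴳ (λ z → χ (ν * z) ⊠ P̄ (β * z ⁻¹ + κ a z)) ⊠ Γ ⊞ (∑ᴳ (λ z → χ (β * z ⁻¹)) ⊟ ∑ᴳ (λ z → χ (ν * z))) ∎
    where
    v w : K → K → K
    v z x = β * z ⁻¹ + (a * z ^ t′ * x ^ t + ν * z * x)
    w z x = ν * z + (β * z ⁻¹ + κ a z) * x
    V W : K → 𝔾
    V x = ∑ᴳ (λ z → χ (v z x))
    W x = ∑ᴳ (λ z → χ (w z x))
    swap : ∀ a b c → a ⊠ (b ⊠ c) ≡ b ⊠ (a ⊠ c)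
    swap = G.solveG 3 (λ a b c → a G.⊗ (b G.⊗ c) G.⊜ b G.⊗ (a G.⊗ c)) refl
    PX : ∀ (X : K → 𝔾) {Y} → X 0# ≡ Y → P 0# ⊠ X 0# ≡ Y
    PX X eq = trans (cong₂ _⊠_ P-0 eq) (G.*-identityˡ _)
    V0 : V 0# ≡ ∑ᴳ (λ z → χ (β * z ⁻¹))
    V0 = GS.sum-cong-≗ λ z → cong χ (trans (cong (β * z ⁻¹ +_) (trans (cong₂ _+_ (trans (cong (a * z ^ t′ *_) (0^ {t} (s≤s z≤n))) (zeroʳ _)) (zeroʳ _)) (+-identityʳ 0#))) (+-identityʳ _))
    W0 : W 0# ≡ ∑ᴳ (λ z → χ (ν * z))
    W0 = GS.sum-cong-≗ λ z → cong χ (trans (cong (ν * z +_) (zeroʳ _)) (+-identityʳ _))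
    ∑PW : ∑ᴳ (λ x → P x ⊠ W x) ≡ ∑ᴳ (λ z → χ (ν * z) ⊠ P̄ (β * z ⁻¹ + κ a z)) ⊠ Γ
    ∑PW = begin
      ∑ᴳ (λ x → P x ⊠ W x) ≡⟨ GS.sum-cong-≗ (λ x → ∑ᴳ-*ˡ (P x) (λ z → χ (w z x))) ⟨
      ∑ᴳ (λ x → ∑ᴳ (λ z → P x ⊠ χ (w z x))) ≡⟨ GS.∑-comm (λ x z → P x ⊠ χ (w z x)) ⟩
      ∑ᴳ (λ z → ∑ᴳ (λ x → P x ⊠ χ (w z x))) ≡⟨ GS.sum-cong-≗ (λ z → trans (GS.sum-cong-≗ λ x → trans (cong (P x ⊠_) (χ-+ _ _)) (swap (P x) (χ (ν * z)) _))
          (trans (∑ᴳ-*ˡ (χ (ν * z)) _) (trans (cong (χ (ν * z) ⊠_) (P-χ-sum (β * z ⁻¹ + κ a z))) (sym (G.*-assoc (χ (ν * z)) _ Γ))))) ⟩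
      ∑ᴳ (λ z → (χ (ν * z) ⊠ P̄ (β * z ⁻¹ + κ a z)) ⊠ Γ) ≡⟨ ∑ᴳ-*ʳ Γ _ ⟩
      ∑ᴳ (λ z → χ (ν * z) ⊠ P̄ (β * z ⁻¹ + κ a z)) ⊠ Γ ∎
    V≡W : ∀ x → x ≢ 0# → V x ≡ W x
    V≡W x x≢0 = trans (∑ᴳ-scale {x ⁻¹} {x} x⁻¹x (λ z → χ (v z x))) (GS.sum-cong-≗ pointwise)
      where
      c = x ⁻¹
      x⁻¹x : c * x ≡ 1#
      x⁻¹x = trans (*-comm c x) (x*x⁻¹ x≢0)
      c≢0 : c ≢ 0#
      c≢0 = ^-nonzero (neg2^ 0) x≢0
      c⁻¹≡x : c ⁻¹ ≡ x
      c⁻¹≡x = *-cancelˡ c≢0 (trans (x*x⁻¹ c≢0) (sym x⁻¹x))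
      square : ∀ z → a * (c * z) ^ t′ * x ^ t ≡ (κ a z * x) ^ 2
      square z = begin
        a * (c * z) ^ t′ * (x * (x * x ^ t′)) ≡⟨ cong (λ e → a * e * (x * (x * x ^ t′))) (^-distrib-* c z t′) ⟩
        a * (c ^ t′ * z ^ t′) * (x * (x * x ^ t′)) ≡⟨ solveF 5 (λ a C Z x X → a ⊗ (C ⊗ Z) ⊗ (x ⊗ (x ⊗ X)) ⊜ (a ⊗ Z) ⊗ (x ⊗ x) ⊗ (C ⊗ X)) refl a (c ^ t′) (z ^ t′) x (x ^ t′) ⟩
        (a * z ^ t′) * (x * x) * (c ^ t′ * x ^ t′) ≡⟨ cong₂ (λ e f → (a * z ^ t′) * e * f) (sym (x^2≡x*x x)) (trans (sym (^-distrib-* c x t′)) (trans (cong (_^ t′) x⁻¹x) (1^ t′))) ⟩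
        (a * z ^ t′) * x ^ 2 * 1# ≡⟨ *-identityʳ _ ⟩
        (a * z ^ t′) * x ^ 2 ≡⟨ cong (_* x ^ 2) (sqrt-square (a * z ^ t′)) ⟨
        κ a z ^ 2 * x ^ 2 ≡⟨ ^-distrib-* (κ a z) x 2 ⟨
        (κ a z * x) ^ 2 ∎
      νz : ∀ z → ν * (c * z) * x ≡ ν * z
      νz z = trans (solveF 4 (λ n c z x → n ⊗ (c ⊗ z) ⊗ x ⊜ (n ⊗ z) ⊗ (c ⊗ x)) refl ν c z x) (trans (cong (ν * z *_) x⁻¹x) (*-identityʳ _))
      βz : ∀ z → β * (c * z) ⁻¹ ≡ β * z ⁻¹ * x
      βz z = trans (cong (β *_) (trans (⁻¹-* c z) (cong (_* z ⁻¹) c⁻¹≡x))) (solveF 3 (λ b x z → b ⊗ (x ⊗ z) ⊜ b ⊗ z ⊗ x) refl β x (z ⁻¹))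
      pointwise : ∀ z → χ (v (c * z) x) ≡ χ (w z x)
      pointwise z = cong sign (begin
        Tr (β * (c * z) ⁻¹ + (a * (c * z) ^ t′ * x ^ t + ν * (c * z) * x)) ≡⟨ trans (Tr-+ _ _) (cong (Tr (β * (c * z) ⁻¹) +_) (Tr-+ _ _)) ⟩
        Tr (β * (c * z) ⁻¹) + (Tr (a * (c * z) ^ t′ * x ^ t) + Tr (ν * (c * z) * x))
          ≡⟨ cong₂ _+_ (cong Tr (βz z)) (cong₂ _+_ (trans (cong Tr (square z)) (Tr-square (κ a z * x))) (cong Tr (νz z))) ⟩
        Tr (β * z ⁻¹ * x) + (Tr (κ a z * x) + Tr (ν * z)) ≡⟨ solveF 3 (λ a b c → a ⊕ (b ⊕ c) ⊜ c ⊕ (a ⊕ b)) refl _ _ _ ⟩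
        Tr (ν * z) + (Tr (β * z ⁻¹ * x) + Tr (κ a z * x)) ≡⟨ cong (Tr (ν * z) +_) (trans (cong Tr (distribʳ x _ _)) (Tr-+ _ _)) ⟨
        Tr (ν * z) + Tr ((β * z ⁻¹ + κ a z) * x) ≡⟨ Tr-+ _ _ ⟨
        Tr (w z x) ∎)

-- Comparison of π-adic levels.

module FlatRelation {r : ℕ} (F : Field (2 ℕ.^ r)) (1≤r : 1 ℕ.≤ r) (t′ : ℕ) where
  open FieldTheory F 1≤r
  open Trace F 1≤r
  open CharacterSums F 1≤r
  open Differences F 1≤r
  open Spectrum F 1≤r t′
  open ≡-Reasoning

  D : ∀ {n} → (K → 𝔾) → Vec K n → K → 𝔾
  D g [] x = g x
  D g (β ∷ v) x = D g v (x + β) ⊟ D g v x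

  D-cong : ∀ {n f g} → (∀ x → f x ≡ g x) → ∀ (v : Vec K n) x → D f v x ≡ D g v x
  D-cong eq [] x = eq x
  D-cong eq (β ∷ v) x = cong₂ _⊟_ (D-cong eq v (x + β)) (D-cong eq v x)

  D-∑ : ∀ {n} (f : K → K → 𝔾) (v : Vec K n) x → D (λ β → ∑ᴳ (λ z → f z β)) v x ≡ ∑ᴳ (λ z → D (f z) v x)
  D-∑ f [] x = refl
  D-∑ f (β ∷ v) x = trans (cong₂ _⊟_ (D-∑ f v (x + β)) (D-∑ f v x)) (sym (∑ᴳ-⊟ _ _))

  D-*ˡ : ∀ {n} c g (v : Vec K n) x → D (λ β → c ⊠ g β) v x ≡ c ⊠ D g v x
  D-*ˡ c g [] x = refl
  D-*ˡ c g (β ∷ v) x = trans (cong₂ _⊟_ (D-*ˡ c g v (x + β)) (D-*ˡ c g v x))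
    (trans (cong (c ⊠ D g v (x + β) ⊞_) (G.-‿distribʳ-* c _)) (sym (G.distribˡ c _ _)))

  D-*ʳ : ∀ {n} c g (v : Vec K n) x → D (λ β → g β ⊠ c) v x ≡ D g v x ⊠ c
  D-*ʳ c g v x = trans (D-cong (λ β → G.*-comm (g β) c) v x) (trans (D-*ˡ c g v x) (G.*-comm c _))

  interchange : ∀ a b c d → (a ⊟ b) ⊟ (c ⊟ d) ≡ (a ⊟ c) ⊟ (b ⊟ d)
  interchange a b c d = begin
    (a ⊟ b) ⊟ (c ⊟ d) ≡⟨ cong ((a ⊟ b) ⊞_) (G.-‿anti-homo-+ c (⊟ d)) ⟩
    (a ⊟ b) ⊞ (⊟ (⊟ d) ⊟ c) ≡⟨ lemma a (⊟ b) (⊟ (⊟ d)) (⊟ c) ⟩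
    (a ⊟ c) ⊞ (⊟ (⊟ d) ⊟ b) ≡⟨ cong ((a ⊟ c) ⊞_) (G.-‿anti-homo-+ b (⊟ d)) ⟨
    (a ⊟ c) ⊟ (b ⊟ d) ∎
    where
    lemma : ∀ a b d c → (a ⊞ b) ⊞ (d ⊞ c) ≡ (a ⊞ c) ⊞ (d ⊞ b)
    lemma = G.solveG 4 (λ a b d c → (a G.⊕ b) G.⊕ (d G.⊕ c) G.⊜ (a G.⊕ c) G.⊕ (d G.⊕ b)) refl

  ⊠-⊟ : ∀ x a b → x ⊠ a ⊟ x ⊠ b ≡ x ⊠ (a ⊟ b)
  ⊠-⊟ x a b = trans (cong (x ⊠ a ⊞_) (G.-‿distribʳ-* x b)) (sym (G.distribˡ x a (⊟ b)))

  ⊟-⊠ : ∀ x a b → a ⊠ x ⊟ b ⊠ x ≡ (a ⊟ b) ⊠ x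
  ⊟-⊠ x a b = trans (cong₂ _⊟_ (G.*-comm a x) (G.*-comm b x)) (trans (⊠-⊟ x a b) (G.*-comm x _))

  D-⊟ : ∀ {n} f g (v : Vec K n) x → D (λ β → f β ⊟ g β) v x ≡ D f v x ⊟ D g v x
  D-⊟ f g [] x = refl
  D-⊟ f g (β ∷ v) x = trans (cong₂ _⊟_ (D-⊟ f g v (x + β)) (D-⊟ f g v x)) (interchange _ _ _ _)

  cancel-common : ∀ p s₁ s₀ t₁ t₀ g c → p ⊠ s₁ ≡ p ⊠ (t₁ ⊠ g) ⊞ c → p ⊠ s₀ ≡ p ⊠ (t₀ ⊠ g) ⊞ c →
    p ⊠ (s₁ ⊟ s₀) ≡ p ⊠ ((t₁ ⊟ t₀) ⊠ g)
  cancel-common p s₁ s₀ t₁ t₀ g c eq₁ eq₀ = begin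
    p ⊠ (s₁ ⊟ s₀) ≡⟨ ⊠-⊟ p s₁ s₀ ⟨
    p ⊠ s₁ ⊟ p ⊠ s₀ ≡⟨ cong₂ _⊟_ eq₁ eq₀ ⟩
    (A ⊞ c) ⊟ (B ⊞ c) ≡⟨ interchange′ A B c ⟩
    A ⊟ B ≡⟨ ⊠-⊟ p (t₁ ⊠ g) (t₀ ⊠ g) ⟩
    p ⊠ (t₁ ⊠ g ⊟ t₀ ⊠ g) ≡⟨ cong (p ⊠_) (⊟-⊠ g t₁ t₀) ⟩
    p ⊠ ((t₁ ⊟ t₀) ⊠ g) ∎
    where
    A = p ⊠ (t₁ ⊠ g)
    B = p ⊠ (t₀ ⊠ g)
    interchange′ : ∀ a b c → (a ⊞ c) ⊟ (b ⊞ c) ≡ a ⊟ b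
    interchange′ a b c = begin
      (a ⊞ c) ⊟ (b ⊞ c) ≡⟨ cong ((a ⊞ c) ⊞_) (G.-‿anti-homo-+ b c) ⟩
      (a ⊞ c) ⊞ (⊟ c ⊟ b) ≡⟨ lemma a c (⊟ c) (⊟ b) ⟩
      (c ⊟ c) ⊞ (a ⊟ b) ≡⟨ trans (cong (_⊞ (a ⊟ b)) (G.-‿inverseʳ c)) (G.+-identityˡ (a ⊟ b)) ⟩
      a ⊟ b ∎
      where
      lemma : ∀ a c d b → (a ⊞ c) ⊞ (d ⊞ b) ≡ (c ⊞ d) ⊞ (a ⊞ b)
      lemma = G.solveG 4 (λ a c d b → (a G.⊕ c) G.⊕ (d G.⊕ b) G.⊜ (c G.⊕ d) G.⊕ (a G.⊕ b)) refl

  D-affine : ∀ {n} g c w (v : Vec K n) x → D (λ β → g (β * w + c)) v x ≡ D g (Vec.map (_* w) v) (x * w + c)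
  D-affine g c w [] x = refl
  D-affine g c w (β ∷ v) x = cong₂ _⊟_ (trans (D-affine g c w v (x + β)) (cong (D g (Vec.map (_* w) v))
    (solveF 4 (λ x β w c → (x ⊕ β) ⊗ w ⊕ c ⊜ (x ⊗ w ⊕ c) ⊕ β ⊗ w) refl x β w c))) (D-affine g c w v x)

  D-P̄ : ∀ {n} (v : Vec K n) x → D P̄ v x ≡ Ψ (Vec.map (λ β → β , 0#) v) x
  D-P̄ [] x = refl
  D-P̄ (β ∷ v) x = cong₂ _⊟_ (trans (D-P̄ v (x + β)) (trans (sym (G.*-identityˡ _)) (cong (λ c → c ⊠ Ψ (Vec.map (λ β → β , 0#) v) (x + β)) (sym χ-0)))) (D-P̄ v x)

  steps-unsigned : ∀ {n} (v : Vec K n) → steps (Vec.map (λ β → β , 0#) v) ≡ v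
  steps-unsigned [] = refl
  steps-unsigned (β ∷ v) = cong (β ∷_) (steps-unsigned v)

  Lev-D : ∀ {n} (v : Vec K n) x → Lev n (D P̄ v x) (R n v)
  Lev-D {n} v x = subst₂ (Lev n) (sym (D-P̄ v x)) (cong (R n) (steps-unsigned v)) (Lev-Ψ n (Vec.map (λ β → β , 0#) v) x)

  -- A difference of χ is χ times χ(β) - 1, which is 0 or -2.
  2^∣D-χ : ∀ {n} (v : Vec K n) → ∃ λ e → ∀ x → D χ v x ≡ 2ᴳ ^ᴳ n ⊠ (χ x ⊠ e)
  2^∣D-χ [] = 1ᴳ , λ x → sym (trans (G.*-identityˡ _) (G.*-identityʳ _))
  2^∣D-χ {suc n} (β ∷ v) = let (e , eq) = 2^∣D-χ v in ⊟ lift (Tr β) ⊠ e , λ x → begin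
    D χ v (x + β) ⊟ D χ v x ≡⟨ cong₂ _⊟_ (trans (eq (x + β)) (cong (λ c → 2ᴳ ^ᴳ n ⊠ (c ⊠ e)) (χ-+ x β))) (eq x) ⟩
    2ᴳ ^ᴳ n ⊠ ((χ x ⊠ χ β) ⊠ e) ⊟ 2ᴳ ^ᴳ n ⊠ (χ x ⊠ e) ≡⟨ ⊠-⊟ (2ᴳ ^ᴳ n) _ _ ⟩
    2ᴳ ^ᴳ n ⊠ ((χ x ⊠ χ β) ⊠ e ⊟ χ x ⊠ e) ≡⟨ cong (2ᴳ ^ᴳ n ⊠_) (trans (⊟-⊠ e _ _) (cong (_⊠ e) (G.sub-lemma₄ (χ x) (χ β)))) ⟩
    2ᴳ ^ᴳ n ⊠ ((χ x ⊠ (χ β ⊟ 1ᴳ)) ⊠ e) ≡⟨ cong (λ c → 2ᴳ ^ᴳ n ⊠ ((χ x ⊠ c) ⊠ e)) (sign≡1-2lift (Tr β)) ⟩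
    2ᴳ ^ᴳ n ⊠ ((χ x ⊠ (2ᴳ ⊠ ⊟ lift (Tr β))) ⊠ e) ≡⟨ lemma (2ᴳ ^ᴳ n) (χ x) 2ᴳ (⊟ lift (Tr β)) e ⟩
    (2ᴳ ⊠ 2ᴳ ^ᴳ n) ⊠ (χ x ⊠ (⊟ lift (Tr β) ⊠ e)) ∎
    where
    lemma : ∀ p x d l e → p ⊠ ((x ⊠ (d ⊠ l)) ⊠ e) ≡ (d ⊠ p) ⊠ (x ⊠ (l ⊠ e))
    lemma = G.solveG 5 (λ p x d l e → p G.⊗ ((x G.⊗ (d G.⊗ l)) G.⊗ e) G.⊜ (d G.⊗ p) G.⊗ (x G.⊗ (l G.⊗ e))) refl

  Odd-⊟ : ∀ {x y} → Odd x → Odd y → Even (x ⊟ y)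
  Odd-⊟ (c , refl) (d , refl) = c ⊟ d , trans (interchange′ (π ⊠ c) (π ⊠ d)) (⊠-⊟ π c d)
    where
    interchange′ : ∀ a b → (1ᴳ ⊞ a) ⊟ (1ᴳ ⊞ b) ≡ a ⊟ b
    interchange′ a b = trans (cong ((1ᴳ ⊞ a) ⊞_) (G.-‿anti-homo-+ 1ᴳ b)) (trans (lem a (⊟ b) (⊟ 1ᴳ)) (G.+-identityˡ (a ⊟ b)))
      where
      lem : ∀ a b m → (1ᴳ ⊞ a) ⊞ (b ⊞ m) ≡ (1ᴳ ⊞ m) ⊞ (a ⊞ b)
      lem = G.solveG 3 (λ a b m → (G.con 1 G.⊕ a) G.⊕ (b G.⊕ m) G.⊜ (G.con 1 G.⊕ m) G.⊕ (a G.⊕ b)) refl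

  Even-⊟ : ∀ {x y} → Even x → Even y → Even (x ⊟ y)
  Even-⊟ (c , refl) (d , refl) = c ⊟ d , ⊠-⊟ π c d

  Lev-∑ : ∀ m {f : K → 𝔾} {g : K → K} → (∀ z → Lev m (f z) (g z)) → Lev m (∑ᴳ f) (∑ g)
  Lev-∑ m lev = go lev
    where
    go : ∀ {n} {f : Fin n → 𝔾} {g : Fin n → K} → (∀ z → Lev m (f z) (g z)) → Lev m (GS.sum f) (Sum.sum g)
    go {zero} lev = Lev-0 m
    go {suc n} lev = Lev-+ m (lev zero) (go (λ z → lev (suc z)))

  -- ε gives the values of P̂ at the points (a z^t′ , ν z), up to the factor πʳ.
  IsUnitPart : K → (K → K → 𝔾) → Set
  IsUnitPart a ε = ∀ ν z → (P̂ (a * z ^ t′) (ν * z) ≡ π ^ᴳ r ⊠ ε ν z) × Odd (ε ν z)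

  module _ (γ : 𝔾) (Γ≡ : Γ ≡ π ^ᴳ r ⊠ γ) (odd-γ : Odd γ)
           (a : K) (E₁ : K → K → 𝔾) (unit₁ : IsUnitPart a E₁) (E₀ : K → K → 𝔾) (unit₀ : IsUnitPart 0# E₀) where

    S : (K → K → 𝔾) → K → K → 𝔾
    S E ν β = ∑ᴳ (λ z → χ (β * z ⁻¹) ⊠ E ν z)

    T : K → K → K → 𝔾
    T a ν β = ∑ᴳ (λ z → χ (ν * z) ⊠ P̄ (β * z ⁻¹ + κ a z))

    C : K → K → 𝔾
    C ν β = ∑ᴳ (λ z → χ (β * z ⁻¹)) ⊟ ∑ᴳ (λ z → χ (ν * z))

    π^S : ∀ a E → IsUnitPart a E → ∀ ν β → π ^ᴳ r ⊠ S E ν β ≡ π ^ᴳ r ⊠ (T a ν β ⊠ γ) ⊞ C ν β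
    π^S a E unit ν β = begin
      π ^ᴳ r ⊠ S E ν β ≡⟨ ∑ᴳ-*ˡ (π ^ᴳ r) _ ⟨
      ∑ᴳ (λ z → π ^ᴳ r ⊠ (χ (β * z ⁻¹) ⊠ E ν z)) ≡⟨ GS.sum-cong-≗ (λ z → trans (swap (π ^ᴳ r) (χ (β * z ⁻¹)) (E ν z))
         (cong (χ (β * z ⁻¹) ⊠_) (sym (proj₁ (unit ν z))))) ⟩
      ∑ᴳ (λ z → χ (β * z ⁻¹) ⊠ P̂ (a * z ^ t′) (ν * z)) ≡⟨ main-identity a ν β ⟩
      T a ν β ⊠ Γ ⊞ C ν β ≡⟨ cong (_⊞ C ν β) (trans (cong (T a ν β ⊠_) Γ≡) (swap (T a ν β) (π ^ᴳ r) γ)) ⟩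
      π ^ᴳ r ⊠ (T a ν β ⊠ γ) ⊞ C ν β ∎
      where
      swap : ∀ a b c → a ⊠ (b ⊠ c) ≡ b ⊠ (a ⊠ c)
      swap = G.solveG 3 (λ a b c → a G.⊗ (b G.⊗ c) G.⊜ b G.⊗ (a G.⊗ c)) refl

    S-difference : ∀ ν β → S E₁ ν β ⊟ S E₀ ν β ≡ (T a ν β ⊟ T 0# ν β) ⊠ γ
    S-difference ν β = G.π^-cancel r (cancel-common (π ^ᴳ r) (S E₁ ν β) (S E₀ ν β) (T a ν β) (T 0# ν β) γ (C ν β)
      (π^S a E₁ unit₁ ν β) (π^S 0# E₀ unit₀ ν β))

    -- Subtracting the case a = 0 removes the correction `C`; subtracting ν = 0 leaves the factor
    -- χ(νz) - 1, the source of Tr(νz). The four unit parts are odd, so the combination is even.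
    err : K → K → 𝔾
    err ν z = (E₁ ν z ⊟ E₀ ν z) ⊟ (E₁ 0# z ⊟ E₀ 0# z)

    err-even : ∀ ν z → Even (err ν z)
    err-even ν z = Even-⊟ (Odd-⊟ (proj₂ (unit₁ ν z)) (proj₂ (unit₀ ν z))) (Odd-⊟ (proj₂ (unit₁ 0# z)) (proj₂ (unit₀ 0# z)))

    κ-0 : ∀ z → κ 0# z ≡ 0#
    κ-0 z = trans (cong sqrt (zeroˡ _)) (φ-0# (pred r))

    double-difference : ∀ ν β → ∑ᴳ (λ z → χ (β * z ⁻¹) ⊠ err ν z) ≡
      ∑ᴳ (λ z → (χ (ν * z) ⊟ 1ᴳ) ⊠ (P̄ (β * z ⁻¹ + κ a z) ⊟ P̄ (β * z ⁻¹ + 0#))) ⊠ γ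
    double-difference ν β = begin
      ∑ᴳ (λ z → χ (β * z ⁻¹) ⊠ err ν z) ≡⟨ GS.sum-cong-≗ (λ z → sym (trans (cong₂ _⊟_ (⊠-⊟ (χ (β * z ⁻¹)) _ _) (⊠-⊟ (χ (β * z ⁻¹)) _ _)) (⊠-⊟ (χ (β * z ⁻¹)) _ _))) ⟩
      ∑ᴳ (λ z → (χ (β * z ⁻¹) ⊠ E₁ ν z ⊟ χ (β * z ⁻¹) ⊠ E₀ ν z) ⊟ (χ (β * z ⁻¹) ⊠ E₁ 0# z ⊟ χ (β * z ⁻¹) ⊠ E₀ 0# z))
        ≡⟨ trans (∑ᴳ-⊟ _ _) (cong₂ _⊟_ (∑ᴳ-⊟ _ _) (∑ᴳ-⊟ _ _)) ⟩
      (S E₁ ν β ⊟ S E₀ ν β) ⊟ (S E₁ 0# β ⊟ S E₀ 0# β) ≡⟨ cong₂ _⊟_ (S-difference ν β) (S-difference 0# β) ⟩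
      (T a ν β ⊟ T 0# ν β) ⊠ γ ⊟ (T a 0# β ⊟ T 0# 0# β) ⊠ γ ≡⟨ ⊟-⊠ γ _ _ ⟩
      ((T a ν β ⊟ T 0# ν β) ⊟ (T a 0# β ⊟ T 0# 0# β)) ⊠ γ ≡⟨ cong (_⊠ γ) (trans (cong₂ _⊟_ (sym (∑ᴳ-⊟ _ _)) (sym (∑ᴳ-⊟ _ _))) (sym (∑ᴳ-⊟ _ _))) ⟩
      ∑ᴳ (λ z → (χ (ν * z) ⊠ A z ⊟ χ (ν * z) ⊠ P̄ (β * z ⁻¹ + κ 0# z)) ⊟ (χ (0# * z) ⊠ A z ⊟ χ (0# * z) ⊠ P̄ (β * z ⁻¹ + κ 0# z))) ⊠ γ
        ≡⟨ cong (_⊠ γ) (GS.sum-cong-≗ (λ z → trans (cong₂ (λ e c → (χ (ν * z) ⊠ A z ⊟ χ (ν * z) ⊠ P̄ (β * z ⁻¹ + e)) ⊟ (c ⊠ A z ⊟ c ⊠ P̄ (β * z ⁻¹ + e)))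
             (κ-0 z) (trans (cong χ (zeroˡ z)) χ-0))
             (trans (cong₂ _⊟_ (⊠-⊟ (χ (ν * z)) _ _) (⊠-⊟ 1ᴳ _ _)) (⊟-⊠ (A z ⊟ P̄ (β * z ⁻¹ + 0#)) _ _)))) ⟩
      ∑ᴳ (λ z → (χ (ν * z) ⊟ 1ᴳ) ⊠ (A z ⊟ P̄ (β * z ⁻¹ + 0#))) ⊠ γ ∎
      where
      A : K → 𝔾
      A z = P̄ (β * z ⁻¹ + κ a z)

    -- The coefficient at level n + 3 after n differences of `double-difference` in β, taken at 0.
    -- The element κ enters as one further step, because P̄(x + κ) - P̄(x) is itself a difference.
    relation : ∀ n → 3 ℕ.≤ n → ∀ ν (v : Vec K n) →
      ∑ (λ z → Tr (ν * z) * R (suc n) (κ a z ∷ Vec.map (_* z ⁻¹) v)) ≡ 0#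
    relation n 3≤n ν v = let (c , eq , res) = lev in trans (sym (*-identityˡ _)) (Res-even (even-c c eq) res)
      where
      f g : K → 𝔾
      f β = ∑ᴳ (λ z → χ (β * z ⁻¹) ⊠ err ν z)
      g β = ∑ᴳ (λ z → (χ (ν * z) ⊟ 1ᴳ) ⊠ (P̄ (β * z ⁻¹ + κ a z) ⊟ P̄ (β * z ⁻¹ + 0#))) ⊠ γ

      w : K → Vec K n
      w z = Vec.map (_* z ⁻¹) v

      h : K → 𝔾
      h z = (χ 0# ⊠ proj₁ (2^∣D-χ (w z))) ⊠ proj₁ (err-even ν z)

      D-f : D f v 0# ≡ 2ᴳ ^ᴳ n ⊠ (π ⊠ ∑ᴳ h)
      D-f = begin
        D f v 0# ≡⟨ D-∑ (λ z β → χ (β * z ⁻¹) ⊠ err ν z) v 0# ⟩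
        ∑ᴳ (λ z → D (λ β → χ (β * z ⁻¹) ⊠ err ν z) v 0#) ≡⟨ GS.sum-cong-≗ term ⟩
        ∑ᴳ (λ z → 2ᴳ ^ᴳ n ⊠ (π ⊠ h z)) ≡⟨ trans (∑ᴳ-*ˡ (2ᴳ ^ᴳ n) _) (cong (2ᴳ ^ᴳ n ⊠_) (∑ᴳ-*ˡ π h)) ⟩
        2ᴳ ^ᴳ n ⊠ (π ⊠ ∑ᴳ h) ∎
        where
        lemma : ∀ p x e c → (p ⊠ (x ⊠ e)) ⊠ (π ⊠ c) ≡ p ⊠ (π ⊠ ((x ⊠ e) ⊠ c))
        lemma p x e c = lem p (x ⊠ e) π c
          where
          lem : ∀ p x q c → (p ⊠ x) ⊠ (q ⊠ c) ≡ p ⊠ (q ⊠ (x ⊠ c))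
          lem = G.solveG 4 (λ p x q c → (p G.⊗ x) G.⊗ (q G.⊗ c) G.⊜ p G.⊗ (q G.⊗ (x G.⊗ c))) refl
        term : ∀ z → D (λ β → χ (β * z ⁻¹) ⊠ err ν z) v 0# ≡ 2ᴳ ^ᴳ n ⊠ (π ⊠ h z)
        term z = begin
          D (λ β → χ (β * z ⁻¹) ⊠ err ν z) v 0# ≡⟨ D-*ʳ (err ν z) (λ β → χ (β * z ⁻¹)) v 0# ⟩
          D (λ β → χ (β * z ⁻¹)) v 0# ⊠ err ν z ≡⟨ cong (_⊠ err ν z) (trans (D-cong (λ β → cong χ (sym (+-identityʳ _))) v 0#)
            (trans (D-affine χ 0# (z ⁻¹) v 0#) (trans (cong (D χ (w z)) (trans (+-identityʳ _) (zeroˡ (z ⁻¹)))) (proj₂ (2^∣D-χ (w z)) 0#)))) ⟩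
          (2ᴳ ^ᴳ n ⊠ (χ 0# ⊠ proj₁ (2^∣D-χ (w z)))) ⊠ err ν z ≡⟨ cong ((2ᴳ ^ᴳ n ⊠ (χ 0# ⊠ proj₁ (2^∣D-χ (w z)))) ⊠_) (proj₂ (err-even ν z)) ⟩
          (2ᴳ ^ᴳ n ⊠ (χ 0# ⊠ proj₁ (2^∣D-χ (w z)))) ⊠ (π ⊠ proj₁ (err-even ν z)) ≡⟨ lemma _ _ _ _ ⟩
          2ᴳ ^ᴳ n ⊠ (π ⊠ h z) ∎

      D-g : D g v 0# ≡ γ ⊠ ∑ᴳ (λ z → (χ (ν * z) ⊟ 1ᴳ) ⊠ D P̄ (κ a z ∷ w z) 0#)
      D-g = begin
        D g v 0# ≡⟨ D-*ʳ γ _ v 0# ⟩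
        D (λ β → ∑ᴳ (λ z → (χ (ν * z) ⊟ 1ᴳ) ⊠ (P̄ (β * z ⁻¹ + κ a z) ⊟ P̄ (β * z ⁻¹ + 0#)))) v 0# ⊠ γ ≡⟨ G.*-comm _ γ ⟩
        γ ⊠ D (λ β → ∑ᴳ (λ z → (χ (ν * z) ⊟ 1ᴳ) ⊠ (P̄ (β * z ⁻¹ + κ a z) ⊟ P̄ (β * z ⁻¹ + 0#)))) v 0#
          ≡⟨ cong (γ ⊠_) (trans (D-∑ (λ z β → (χ (ν * z) ⊟ 1ᴳ) ⊠ (P̄ (β * z ⁻¹ + κ a z) ⊟ P̄ (β * z ⁻¹ + 0#))) v 0#) (GS.sum-cong-≗ term)) ⟩
        γ ⊠ ∑ᴳ (λ z → (χ (ν * z) ⊟ 1ᴳ) ⊠ D P̄ (κ a z ∷ w z) 0#) ∎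
        where
        term : ∀ z → D (λ β → (χ (ν * z) ⊟ 1ᴳ) ⊠ (P̄ (β * z ⁻¹ + κ a z) ⊟ P̄ (β * z ⁻¹ + 0#))) v 0# ≡ (χ (ν * z) ⊟ 1ᴳ) ⊠ D P̄ (κ a z ∷ w z) 0#
        term z = trans (D-*ˡ (χ (ν * z) ⊟ 1ᴳ) _ v 0#) (cong ((χ (ν * z) ⊟ 1ᴳ) ⊠_) (trans (D-⊟ _ _ v 0#) (cong₂ _⊟_
          (trans (D-affine P̄ (κ a z) (z ⁻¹) v 0#) (cong (λ e → D P̄ (w z) (e + κ a z)) (zeroˡ (z ⁻¹))))
          (trans (D-affine P̄ 0# (z ⁻¹) v 0#) (cong (D P̄ (w z)) (trans (+-identityʳ _) (zeroˡ (z ⁻¹))))))))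

      lev : Lev (3 ℕ.+ n) (D g v 0#) (1# * ∑ (λ z → Tr (ν * z) * R (suc n) (κ a z ∷ w z)))
      lev = subst (λ x → Lev (3 ℕ.+ n) x (1# * ∑ (λ z → Tr (ν * z) * R (suc n) (κ a z ∷ w z)))) (sym D-g) (Lev-* 0 (3 ℕ.+ n)
        (γ , sym (G.*-identityˡ γ) , odd odd-γ refl)
        (Lev-∑ (3 ℕ.+ n) λ z → Lev-* 2 (suc n) (Lev-χ (ν * z)) (Lev-D (κ a z ∷ w z) 0#)))

      2^≡π^ : ∀ n → ∃ λ u → 2ᴳ ^ᴳ n ≡ π ^ᴳ (n ℕ.+ n) ⊠ u
      2^≡π^ zero = 1ᴳ , refl
      2^≡π^ (suc n) = let (u , eq) = 2^≡π^ n in G.-𝕚 ⊠ u , (begin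
        2ᴳ ⊠ 2ᴳ ^ᴳ n ≡⟨ cong₂ _⊠_ G.2≡-iππ eq ⟩
        (G.-𝕚 ⊠ (π ⊠ π)) ⊠ (π ^ᴳ (n ℕ.+ n) ⊠ u) ≡⟨ lemma G.-𝕚 π _ u ⟩
        (π ⊠ (π ⊠ π ^ᴳ (n ℕ.+ n))) ⊠ (G.-𝕚 ⊠ u) ≡⟨ cong (λ m → (π ⊠ π ^ᴳ m) ⊠ (G.-𝕚 ⊠ u)) (ℕₚ.+-suc n n) ⟨
        π ^ᴳ (suc n ℕ.+ suc n) ⊠ (G.-𝕚 ⊠ u) ∎)
        where
        lemma : ∀ m p x u → (m ⊠ (p ⊠ p)) ⊠ (x ⊠ u) ≡ (p ⊠ (p ⊠ x)) ⊠ (m ⊠ u)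
        lemma = G.solveG 4 (λ m p x u → (m G.⊗ (p G.⊗ p)) G.⊗ (x G.⊗ u) G.⊜ (p G.⊗ (p G.⊗ x)) G.⊗ (m G.⊗ u)) refl

      -- 2ⁿπ is divisible by π^(n+4), since n ≥ 3.
      even-c : ∀ c → D g v 0# ≡ π ^ᴳ (3 ℕ.+ n) ⊠ c → Even c
      even-c c eq = subst Even (sym (G.π^-cancel (3 ℕ.+ n) (begin
        π ^ᴳ (3 ℕ.+ n) ⊠ c ≡⟨ eq ⟨
        D g v 0# ≡⟨ D-cong (double-difference ν) v 0# ⟨
        D f v 0# ≡⟨ D-f ⟩
        2ᴳ ^ᴳ n ⊠ (π ⊠ ∑ᴳ h) ≡⟨ cong (_⊠ (π ⊠ ∑ᴳ h)) (proj₂ (2^≡π^ n)) ⟩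
        (π ^ᴳ (n ℕ.+ n) ⊠ u) ⊠ (π ⊠ ∑ᴳ h) ≡⟨ cong (λ m → (π ^ᴳ m ⊠ u) ⊠ (π ⊠ ∑ᴳ h)) (trans (cong (ℕ._+ n) (sym (ℕₚ.m+[n∸m]≡n 3≤n)))
            (trans (ℕₚ.+-assoc 3 (n ℕ.∸ 3) n) (trans (cong (3 ℕ.+_) (ℕₚ.+-comm (n ℕ.∸ 3) n)) (sym (ℕₚ.+-assoc 3 n (n ℕ.∸ 3)))))) ⟩
        (π ^ᴳ ((3 ℕ.+ n) ℕ.+ (n ℕ.∸ 3)) ⊠ u) ⊠ (π ⊠ ∑ᴳ h) ≡⟨ cong (λ p → (p ⊠ u) ⊠ (π ⊠ ∑ᴳ h)) (G.^-homo-* π (3 ℕ.+ n) (n ℕ.∸ 3)) ⟩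
        ((π ^ᴳ (3 ℕ.+ n) ⊠ π ^ᴳ (n ℕ.∸ 3)) ⊠ u) ⊠ (π ⊠ ∑ᴳ h) ≡⟨ lemma _ _ u π (∑ᴳ h) ⟩
        π ^ᴳ (3 ℕ.+ n) ⊠ (π ⊠ ((π ^ᴳ (n ℕ.∸ 3) ⊠ u) ⊠ ∑ᴳ h)) ∎))) (_ , refl)
        where
        u = proj₁ (2^≡π^ n)
        lemma : ∀ a b u p h → ((a ⊠ b) ⊠ u) ⊠ (p ⊠ h) ≡ a ⊠ (p ⊠ ((b ⊠ u) ⊠ h))
        lemma = G.solveG 5 (λ a b u p h → ((a G.⊗ b) G.⊗ u) G.⊗ (p G.⊗ h) G.⊜ a G.⊗ (p G.⊗ ((b G.⊗ u) G.⊗ h))) refl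

  flat-relation : ∀ a → (∀ z → Flat (a * z ^ t′)) → ∀ n → 3 ℕ.≤ n → ∀ ν (v : Vec K n) →
    ∑ (λ z → Tr (ν * z) * R (suc n) (κ a z ∷ Vec.map (_* z ⁻¹) v)) ≡ 0#
  flat-relation a flat = relation γ Γ≡ odd-γ a (proj₁ u₁) (proj₂ u₁) (proj₁ u₀) (proj₂ u₀)
    where
    unit : ∀ a → (∀ z → Flat (a * z ^ t′)) → ∃ (IsUnitPart a)
    unit a flat = (λ ν z → proj₁ (part ν z)) , (λ ν z → proj₂ (part ν z))
      where
      part : ∀ ν z → ∃ λ ε → (P̂ (a * z ^ t′) (ν * z) ≡ π ^ᴳ r ⊠ ε) × Odd ε
      part ν z = G.norm-2^ r _ (P̂-norm (flat z) (ν * z))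
    u₁ = unit a flat
    u₀ = unit 0# (λ z → subst Flat (sym (zeroˡ _)) Flat-0)
    -- The Gauss sum is the transform at u = 0 and μ = 0, so the same norm computation applies to
    -- it.
    Γ-unit : ∃ λ γ → (P̂ 0# 0# ≡ π ^ᴳ r ⊠ γ) × Odd γ
    Γ-unit = G.norm-2^ r _ (P̂-norm Flat-0 0#)
    γ = proj₁ Γ-unit
    odd-γ = proj₂ (proj₂ Γ-unit)
    Γ≡ : Γ ≡ π ^ᴳ r ⊠ γ
    Γ≡ = trans (GS.sum-cong-≗ (λ x → sym (trans (cong (P x ⊠_) (trans (cong χ (trans (cong₂ _+_ (zeroˡ _) (zeroˡ x)) (+-identityʳ 0#))) χ-0))
      (G.*-identityʳ (P x))))) (proj₁ (proj₂ Γ-unit))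

-- Extraction of coefficients from sums over matchings.

module Averaging {r : ℕ} (F : Field (2 ℕ.^ r)) (1≤r : 1 ℕ.≤ r) where
  open FieldTheory F 1≤r
  open Trace F 1≤r
  open Differences F 1≤r using (R; sumPicks)
  open ≡-Reasoning

  ∑-cong : ∀ {f g : K → K} → (∀ x → f x ≡ g x) → ∑ f ≡ ∑ g
  ∑-cong = sum-cong-≗

  ∑-+ : ∀ (f g : K → K) → ∑ (λ x → f x + g x) ≡ ∑ f + ∑ g
  ∑-+ = ∑-distrib-+

  -- Extracts from g the coefficient of the product of the βⱼ^(2^bⱼ).
  Avg : ∀ {n} → Vec ℕ n → (Vec K n → K) → K
  Avg [] g = g []
  Avg (b ∷ bs) g = ∑ (λ β → β ^ neg2^ b * Avg bs (λ v → g (β ∷ v)))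

  Avg-cong : ∀ {n} (bs : Vec ℕ n) {f g} → (∀ v → f v ≡ g v) → Avg bs f ≡ Avg bs g
  Avg-cong [] eq = eq []
  Avg-cong (b ∷ bs) eq = ∑-cong λ β → cong (β ^ neg2^ b *_) (Avg-cong bs (λ v → eq (β ∷ v)))

  Avg-+ : ∀ {n} (bs : Vec ℕ n) f g → Avg bs (λ v → f v + g v) ≡ Avg bs f + Avg bs g
  Avg-+ [] f g = refl
  Avg-+ (b ∷ bs) f g = trans (∑-cong λ β → trans (cong (β ^ neg2^ b *_) (Avg-+ bs _ _)) (distribˡ _ _ _)) (∑-+ _ _)

  *-swap : ∀ a b c → a * (b * c) ≡ b * (a * c)
  *-swap = solveF 3 (λ a b c → a ⊗ (b ⊗ c) ⊜ b ⊗ (a ⊗ c)) refl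

  Avg-* : ∀ {n} (bs : Vec ℕ n) c f → Avg bs (λ v → c * f v) ≡ c * Avg bs f
  Avg-* [] c f = refl
  Avg-* (b ∷ bs) c f = trans (∑-cong λ β → trans (cong (β ^ neg2^ b *_) (Avg-* bs c _)) (*-swap _ c _)) (∑-*ˡ c _)

  Avg-∑ : ∀ {n} (bs : Vec ℕ n) (f : K → Vec K n → K) → Avg bs (λ v → ∑ (λ z → f z v)) ≡ ∑ (λ z → Avg bs (f z))
  Avg-∑ [] f = refl
  Avg-∑ (b ∷ bs) f = trans (∑-cong λ β → trans (cong (β ^ neg2^ b *_) (Avg-∑ bs _)) (sym (∑-*ˡ _ _)))
    (∑-comm (λ β z → β ^ neg2^ b * Avg bs (λ v → f z (β ∷ v))))

  Avg-0 : ∀ {n} (bs : Vec ℕ n) {f} → (∀ v → f v ≡ 0#) → Avg bs f ≡ 0#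
  Avg-0 [] eq = eq []
  Avg-0 (b ∷ bs) eq = sum-ε λ β → trans (cong (β ^ neg2^ b *_) (Avg-0 bs (λ v → eq (β ∷ v)))) (zeroʳ _)

  sumPicks-cong : ∀ {A : Set} {n} (v : Vec A (suc n)) {f g : A → Vec A n → K} → (∀ y w → f y w ≡ g y w) → sumPicks v f ≡ sumPicks v g
  sumPicks-cong (y ∷ []) eq = eq y []
  sumPicks-cong (y ∷ w@(_ ∷ _)) eq = cong₂ _+_ (eq y w) (sumPicks-cong w (λ y′ w′ → eq y′ (y ∷ w′)))

  sumPicks-map : ∀ {A B : Set} {n} (h : A → B) (v : Vec A (suc n)) (f : B → Vec B n → K) →
    sumPicks (Vec.map h v) f ≡ sumPicks v (λ y w → f (h y) (Vec.map h w))
  sumPicks-map h (y ∷ []) f = refl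
  sumPicks-map h (y ∷ w@(_ ∷ _)) f = cong (f (h y) (Vec.map h w) +_) (sumPicks-map h w (λ y′ w′ → f y′ (h y ∷ w′)))

  ∑-sumPicks : ∀ {A : Set} {n} (v : Vec A (suc n)) (f : K → A → Vec A n → K) →
    ∑ (λ β → sumPicks v (f β)) ≡ sumPicks v (λ y w → ∑ (λ β → f β y w))
  ∑-sumPicks (y ∷ []) f = refl
  ∑-sumPicks (y ∷ w@(_ ∷ _)) f = trans (∑-+ _ _) (cong (∑ (λ β → f β y w) +_) (∑-sumPicks w (λ β y′ w′ → f β y′ (y ∷ w′))))

  sumPicks-*ˡ : ∀ {A : Set} {n} c (v : Vec A (suc n)) (f : A → Vec A n → K) → c * sumPicks v f ≡ sumPicks v (λ y w → c * f y w)
  sumPicks-*ˡ c (y ∷ []) f = refl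
  sumPicks-*ˡ c (y ∷ w@(_ ∷ _)) f = trans (distribˡ c _ _) (cong (c * f y w +_) (sumPicks-*ˡ c w _))

  sumPicks-0 : ∀ {A : Set} {P : A → Set} {n} (v : Vec A (suc n)) {f : A → Vec A n → K} → All P v →
    (∀ {y} → P y → ∀ w → f y w ≡ 0#) → sumPicks v f ≡ 0#
  sumPicks-0 (y ∷ []) (p ∷ []) eq = eq p []
  sumPicks-0 (y ∷ w@(_ ∷ _)) (p ∷ ps) eq = trans (cong₂ _+_ (eq p w) (sumPicks-0 w ps (λ p′ w′ → eq p′ (y ∷ w′)))) (+-identityʳ 0#)

  -- Averaging Tr(cy) over the chosen entry y at its exponent b gives `φ b c`, so choices of entries
  -- become choices of exponents.
  Avg-sumPicks : ∀ {n} (bs : Vec ℕ (suc n)) → All (ℕ._< r) bs → ∀ c (f : Vec K n → K) →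
    Avg bs (λ v → sumPicks v (λ y w → Tr (c * y) * f w)) ≡ sumPicks bs (λ b bs′ → φ b c * Avg bs′ f)
  Avg-sumPicks (b ∷ []) (b<r ∷ _) c f = begin
    ∑ (λ β → β ^ neg2^ b * (Tr (c * β) * f [])) ≡⟨ ∑-cong (λ β → trans (sym (*-assoc _ _ _)) (*-comm _ (f []))) ⟩
    ∑ (λ β → f [] * (β ^ neg2^ b * Tr (c * β))) ≡⟨ ∑-*ˡ (f []) _ ⟩
    f [] * ∑ (λ β → β ^ neg2^ b * Tr (c * β)) ≡⟨ cong (f [] *_) (select-Tr b<r c) ⟩
    f [] * φ b c ≡⟨ *-comm _ _ ⟩
    φ b c * f [] ∎
  Avg-sumPicks (b ∷ bs@(b′ ∷ bs′)) (b<r ∷ bs<r) c f = begin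
    ∑ (λ β → β ^ neg2^ b * Avg bs (λ v → sumPicks (β ∷ v) (λ y w → Tr (c * y) * f w)))
      ≡⟨ ∑-cong (λ β → cong (β ^ neg2^ b *_) (Avg-cong bs (unfold β))) ⟩
    ∑ (λ β → β ^ neg2^ b * Avg bs (λ v → Tr (c * β) * f v + sumPicks v (λ y w → Tr (c * y) * f (β ∷ w))))
      ≡⟨ ∑-cong (λ β → trans (cong (β ^ neg2^ b *_) (trans (Avg-+ bs (λ v → Tr (c * β) * f v) (λ v → sumPicks v (λ y w → Tr (c * y) * f (β ∷ w)))) (cong₂ _+_ (Avg-* bs (Tr (c * β)) f)
           (Avg-sumPicks bs bs<r c (λ w → f (β ∷ w)))))) (distribˡ _ _ _)) ⟩
    ∑ (λ β → β ^ neg2^ b * (Tr (c * β) * Avg bs f) + β ^ neg2^ b * sumPicks bs (λ b″ bs″ → φ b″ c * Avg bs″ (λ w → f (β ∷ w))))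
      ≡⟨ ∑-+ _ _ ⟩
    ∑ (λ β → β ^ neg2^ b * (Tr (c * β) * Avg bs f)) + ∑ (λ β → β ^ neg2^ b * sumPicks bs (λ b″ bs″ → φ b″ c * Avg bs″ (λ w → f (β ∷ w))))
      ≡⟨ cong₂ _+_ first second ⟩
    φ b c * Avg bs f + sumPicks bs (λ b″ bs″ → φ b″ c * Avg (b ∷ bs″) f) ∎
    where
    unfold : ∀ β v → sumPicks (β ∷ v) (λ y w → Tr (c * y) * f w) ≡ Tr (c * β) * f v + sumPicks v (λ y w → Tr (c * y) * f (β ∷ w))
    unfold β (_ ∷ _) = refl
    first : ∑ (λ β → β ^ neg2^ b * (Tr (c * β) * Avg bs f)) ≡ φ b c * Avg bs f
    first = begin
      ∑ (λ β → β ^ neg2^ b * (Tr (c * β) * Avg bs f)) ≡⟨ ∑-cong (λ β → trans (sym (*-assoc _ _ _)) (*-comm _ (Avg bs f))) ⟩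
      ∑ (λ β → Avg bs f * (β ^ neg2^ b * Tr (c * β))) ≡⟨ ∑-*ˡ (Avg bs f) _ ⟩
      Avg bs f * ∑ (λ β → β ^ neg2^ b * Tr (c * β)) ≡⟨ cong (Avg bs f *_) (select-Tr b<r c) ⟩
      Avg bs f * φ b c ≡⟨ *-comm _ _ ⟩
      φ b c * Avg bs f ∎
    second : ∑ (λ β → β ^ neg2^ b * sumPicks bs (λ b″ bs″ → φ b″ c * Avg bs″ (λ w → f (β ∷ w)))) ≡
      sumPicks bs (λ b″ bs″ → φ b″ c * Avg (b ∷ bs″) f)
    second = begin
      ∑ (λ β → β ^ neg2^ b * sumPicks bs (λ b″ bs″ → φ b″ c * Avg bs″ (λ w → f (β ∷ w)))) ≡⟨ ∑-cong (λ β →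
          trans (sumPicks-*ˡ (β ^ neg2^ b) bs _) (sumPicks-cong bs λ b″ bs″ → *-swap _ _ _)) ⟩
      ∑ (λ β → sumPicks bs (λ b″ bs″ → φ b″ c * (β ^ neg2^ b * Avg bs″ (λ w → f (β ∷ w))))) ≡⟨ ∑-sumPicks bs _ ⟩
      sumPicks bs (λ b″ bs″ → ∑ (λ β → φ b″ c * (β ^ neg2^ b * Avg bs″ (λ w → f (β ∷ w))))) ≡⟨ sumPicks-cong bs (λ b″ bs″ → ∑-*ˡ (φ b″ c) _) ⟩
      sumPicks bs (λ b″ bs″ → φ b″ c * Avg (b ∷ bs″) f) ∎

  total : ∀ {n} → Vec ℕ n → ℕ
  total [] = 0
  total (b ∷ bs) = 2 ℕ.^ b ℕ.+ total bs

  R-scaled : K → ∀ n → Vec K n → K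
  R-scaled w n v = R n (Vec.map (_* w) v)

  -- The pairings in R do not contribute, because the exponents are distinct.
  Avg-R : ∀ {n} w (bs : Vec ℕ n) → All (ℕ._< r) bs → AllPairs _≢_ bs → Avg bs (R-scaled w n) ≡ w ^ total bs
  Avg-R w [] _ _ = refl
  Avg-R w (b ∷ []) (b<r ∷ _) _ = begin
    ∑ (λ β → β ^ neg2^ b * (Tr (β * w) * 1# + 0#)) ≡⟨ ∑-cong (λ β → cong (β ^ neg2^ b *_)
        (trans (+-identityʳ _) (trans (*-identityʳ _) (cong Tr (*-comm β w))))) ⟩
    ∑ (λ β → β ^ neg2^ b * Tr (w * β)) ≡⟨ select-Tr b<r w ⟩
    φ b w ≡⟨ cong (w ^_) (ℕₚ.+-identityʳ (2 ℕ.^ b)) ⟨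
    w ^ (2 ℕ.^ b ℕ.+ 0) ∎
  Avg-R {suc (suc n)} w (b ∷ bs@(b′ ∷ bs′)) (b<r ∷ bs<r) (b≢ ∷ distinct) = begin
    ∑ (λ β → β ^ neg2^ b * Avg bs (λ v → Tr (β * w) * R-scaled w (suc n) v + sumPicks (Vec.map (_* w) v) (λ y u → Tr (β * w * y) * R n u)))
      ≡⟨ ∑-cong (λ β → trans (cong (β ^ neg2^ b *_) (trans (Avg-+ bs (λ v → Tr (β * w) * R-scaled w (suc n) v) (λ v → sumPicks (Vec.map (_* w) v) (λ y u → Tr (β * w * y) * R n u))) (cong₂ _+_
           (trans (Avg-* bs (Tr (β * w)) (R-scaled w (suc n))) (cong (Tr (β * w) *_) (Avg-R w bs bs<r distinct)))
           (trans (Avg-cong bs (λ v → trans (sumPicks-map (_* w) v (λ y u → Tr (β * w * y) * R n u)) (sumPicks-cong v λ y u → cong (λ e → Tr e * R-scaled w n u)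
             (solveF 3 (λ β w y → β ⊗ w ⊗ (y ⊗ w) ⊜ (β ⊗ (w ⊗ w)) ⊗ y) refl β w y))))
             (Avg-sumPicks bs bs<r (β * (w * w)) (R-scaled w n)))))) (distribˡ _ _ _)) ⟩
    ∑ (λ β → β ^ neg2^ b * (Tr (β * w) * w ^ total bs) + β ^ neg2^ b * sumPicks bs (λ c cs → φ c (β * (w * w)) * Avg cs (R-scaled w n)))
      ≡⟨ ∑-+ _ _ ⟩
    ∑ (λ β → β ^ neg2^ b * (Tr (β * w) * w ^ total bs)) + ∑ (λ β → β ^ neg2^ b * sumPicks bs (λ c cs → φ c (β * (w * w)) * Avg cs (R-scaled w n)))
      ≡⟨ cong₂ _+_ first second ⟩
    φ b w * w ^ total bs + 0# ≡⟨ +-identityʳ _ ⟩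
    φ b w * w ^ total bs ≡⟨ ^-homo-* w (2 ℕ.^ b) (total bs) ⟨
    w ^ (2 ℕ.^ b ℕ.+ total bs) ∎
    where
    first : ∑ (λ β → β ^ neg2^ b * (Tr (β * w) * w ^ total bs)) ≡ φ b w * w ^ total bs
    first = begin
      ∑ (λ β → β ^ neg2^ b * (Tr (β * w) * w ^ total bs)) ≡⟨ ∑-cong (λ β → trans (cong (λ e → β ^ neg2^ b * (Tr e * w ^ total bs)) (*-comm β w))
          (trans (sym (*-assoc _ _ _)) (*-comm _ (w ^ total bs)))) ⟩
      ∑ (λ β → w ^ total bs * (β ^ neg2^ b * Tr (w * β))) ≡⟨ ∑-*ˡ (w ^ total bs) _ ⟩
      w ^ total bs * ∑ (λ β → β ^ neg2^ b * Tr (w * β)) ≡⟨ trans (cong (w ^ total bs *_) (select-Tr b<r w)) (*-comm _ _) ⟩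
      φ b w * w ^ total bs ∎
    pairs : All (λ c → c ℕ.< r × b ≢ c) bs
    pairs = zip bs<r b≢
      where
      zip : ∀ {n} {cs : Vec ℕ n} → All (ℕ._< r) cs → All (b ≢_) cs → All (λ c → c ℕ.< r × b ≢ c) cs
      zip [] [] = []
      zip (p ∷ ps) (q ∷ qs) = (p , q) ∷ zip ps qs
    -- A match with an entry of exponent c depends on β through β^(2^c) only, which selection at b ≠
    -- c annihilates.
    second : ∑ (λ β → β ^ neg2^ b * sumPicks bs (λ c cs → φ c (β * (w * w)) * Avg cs (R-scaled w n))) ≡ 0#
    second = begin
      ∑ (λ β → β ^ neg2^ b * sumPicks bs (λ c cs → φ c (β * (w * w)) * Avg cs (R-scaled w n))) ≡⟨ ∑-cong (λ β → sumPicks-*ˡ (β ^ neg2^ b) bs _) ⟩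
      ∑ (λ β → sumPicks bs (λ c cs → β ^ neg2^ b * (φ c (β * (w * w)) * Avg cs (R-scaled w n)))) ≡⟨ ∑-sumPicks bs _ ⟩
      sumPicks bs (λ c cs → ∑ (λ β → β ^ neg2^ b * (φ c (β * (w * w)) * Avg cs (R-scaled w n)))) ≡⟨ sumPicks-0 bs pairs (λ {c} (c<r , b≢c) cs → begin
        ∑ (λ β → β ^ neg2^ b * (φ c (β * (w * w)) * Avg cs (R-scaled w n))) ≡⟨ ∑-cong (λ β → trans (cong (λ e → β ^ neg2^ b * (e * Avg cs (R-scaled w n))) (φ-* c β (w * w)))
            (solveF 4 (λ a x y z → a ⊗ (x ⊗ y ⊗ z) ⊜ (y ⊗ z) ⊗ (a ⊗ x)) refl _ _ _ _)) ⟩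
        ∑ (λ β → (φ c (w * w) * Avg cs (R-scaled w n)) * (β ^ neg2^ b * φ c β)) ≡⟨ ∑-*ˡ _ _ ⟩
        (φ c (w * w) * Avg cs (R-scaled w n)) * ∑ (λ β → β ^ neg2^ b * φ c β) ≡⟨ cong ((φ c (w * w) * Avg cs (R-scaled w n)) *_) (select b<r c<r (b≢c ∘ sym)) ⟩
        (φ c (w * w) * Avg cs (R-scaled w n)) * 0# ≡⟨ zeroʳ _ ⟩
        0# ∎) ⟩
      0# ∎

  sumφ : ∀ {n} → Vec ℕ n → K → K
  sumφ [] x = 0#
  sumφ (b ∷ bs) x = φ b x + sumφ bs x

  -- The factor `φ b w` of the chosen b restores w^(total bs). In `go`, the function `g` absorbs the
  -- exponents already passed.
  sumPicks-φ : ∀ {n} w x (bs : Vec ℕ (suc n)) → sumPicks bs (λ b bs′ → φ b (x * w) * w ^ total bs′) ≡ w ^ total bs * sumφ bs x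
  sumPicks-φ w x bs = trans (go 1# bs (λ _ m → w ^ m) (λ b m → ^-homo-* w b m)) (cong (_* sumφ bs x) refl)
    where
    go : ∀ {n} (o : K) (bs : Vec ℕ (suc n)) (g : K → ℕ → K) → (∀ b m → g o (b ℕ.+ m) ≡ w ^ b * g o m) →
      sumPicks bs (λ b bs′ → φ b (x * w) * g o (total bs′)) ≡ g o (total bs) * sumφ bs x
    go o (b ∷ []) g hom = trans (cong (_* g o 0) (φ-* b x w)) (trans (solveF 3 (λ x w g → (x ⊗ w) ⊗ g ⊜ (w ⊗ g) ⊗ x) refl _ _ _)
      (cong₂ _*_ (sym (hom (2 ℕ.^ b) 0)) (sym (+-identityʳ (φ b x)))))
    go o (b ∷ bs@(_ ∷ _)) g hom = trans (cong₂ _+_ (trans (cong (_* g o (total bs)) (φ-* b x w)) (trans (solveF 3 (λ x w g → (x ⊗ w) ⊗ g ⊜ (w ⊗ g) ⊗ x) refl _ _ _)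
        (cong (_* φ b x) (sym (hom (2 ℕ.^ b) (total bs))))))
      (go o bs (λ o m → g o (2 ℕ.^ b ℕ.+ m)) (λ c m → trans (cong (g o) (lem (2 ℕ.^ b) c m)) (hom c _))))
      (sym (distribˡ (g o (2 ℕ.^ b ℕ.+ total bs)) (φ b x) (sumφ bs x)))
      where
      lem : ∀ a c m → a ℕ.+ (c ℕ.+ m) ≡ c ℕ.+ (a ℕ.+ m)
      lem = solveℕ

  sumPicks-cong′ : ∀ {n} (bs : Vec ℕ (suc n)) → AllPairs _≢_ bs → {f g : ℕ → Vec ℕ n → K} →
    (∀ b cs → (∀ {P : ℕ → Set} → All P bs → All P cs) → AllPairs _≢_ cs → f b cs ≡ g b cs) → sumPicks bs f ≡ sumPicks bs g
  sumPicks-cong′ (b ∷ []) _ eq = eq b [] (λ _ → []) []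
  sumPicks-cong′ (b ∷ bs@(_ ∷ _)) (b≢ ∷ distinct) eq = cong₂ _+_ (eq b bs (λ { (_ ∷ ps) → ps }) distinct)
    (sumPicks-cong′ bs distinct λ b′ cs sub distinct′ → eq b′ (b ∷ cs) (λ { (p ∷ ps) → p ∷ sub ps }) (sub b≢ ∷ distinct′))

  -- The entry `x` is not averaged: left unmatched it gives Tr x, matched with the entry of exponent
  -- b it gives `φ b x`.
  Avg-R-head : ∀ {n} x w (bs : Vec ℕ (suc n)) → All (ℕ._< r) bs → AllPairs _≢_ bs →
    Avg bs (λ v → R (suc (suc n)) (x ∷ Vec.map (_* w) v)) ≡ w ^ total bs * (Tr x + sumφ bs x)
  Avg-R-head {n} x w bs bs<r distinct = begin
    Avg bs (λ v → Tr x * R-scaled w (suc n) v + sumPicks (Vec.map (_* w) v) (λ y u → Tr (x * y) * R n u))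
      ≡⟨ trans (Avg-+ bs (λ v → Tr x * R-scaled w (suc n) v) (λ v → sumPicks (Vec.map (_* w) v) (λ y u → Tr (x * y) * R n u))) (cong₂ _+_ (trans (Avg-* bs (Tr x) (R-scaled w (suc n))) (cong (Tr x *_) (Avg-R w bs bs<r distinct)))
           (trans (Avg-cong bs (λ v → trans (sumPicks-map (_* w) v (λ y u → Tr (x * y) * R n u)) (sumPicks-cong v λ y u → cong (λ e → Tr e * R-scaled w n u)
             (solveF 3 (λ x w y → x ⊗ (y ⊗ w) ⊜ (x ⊗ w) ⊗ y) refl x w y))))
             (Avg-sumPicks bs bs<r (x * w) (R-scaled w n)))) ⟩
    Tr x * w ^ total bs + sumPicks bs (λ b bs′ → φ b (x * w) * Avg bs′ (R-scaled w n)) ≡⟨ cong (Tr x * w ^ total bs +_) (trans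
      (sumPicks-cong′ bs distinct λ b cs sub distinct′ → cong (φ b (x * w) *_) (Avg-R w cs (sub bs<r) distinct′)) (sumPicks-φ w x bs)) ⟩
    Tr x * w ^ total bs + w ^ total bs * sumφ bs x ≡⟨ cong (_+ w ^ total bs * sumφ bs x) (*-comm _ _) ⟩
    w ^ total bs * Tr x + w ^ total bs * sumφ bs x ≡⟨ distribˡ _ _ _ ⟨
    w ^ total bs * (Tr x + sumφ bs x) ∎

-- Binary weight at least three.

module WeightThree {r : ℕ} (F : Field (2 ℕ.^ r)) (1≤r : 1 ℕ.≤ r) (t′ : ℕ) (2≤r : 2 ℕ.≤ r) (1≤t′ : 1 ℕ.≤ t′) (t′²<q : t′ ℕ.* t′ ℕ.< 2 ℕ.^ r) where
  open FieldTheory F 1≤r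
  open Trace F 1≤r
  open Differences F 1≤r using (R)
  open Spectrum F 1≤r t′ using (Flat; κ; _⁻¹)
  open FlatRelation F 1≤r t′ using (flat-relation)
  open Averaging F 1≤r
  open ≡-Reasoning

  t′2^e<q : ∀ {e} → e ℕ.+ e ℕ.≤ r → t′ ℕ.* 2 ℕ.^ e ℕ.< q
  t′2^e<q {e} 2e≤r = ℕₚ.≰⇒> λ q≤ → ℕₚ.<⇒≱
    (subst (ℕ._< q ℕ.* q) (sym (trans (lemma t′ (2 ℕ.^ e)) (cong ((t′ ℕ.* t′) ℕ.*_) (sym (ℕₚ.^-distribˡ-+-* 2 e e)))))
      (ℕₚ.≤-<-trans (ℕₚ.*-monoʳ-≤ (t′ ℕ.* t′) (ℕₚ.^-monoʳ-≤ 2 2e≤r)) (ℕₚ.*-monoˡ-< q {{ℕₚ.m^n≢0 2 r}} t′²<q)))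
    (ℕₚ.*-mono-≤ q≤ q≤)
    where
    lemma : ∀ a b → (a ℕ.* b) ℕ.* (a ℕ.* b) ≡ (a ℕ.* a) ℕ.* (b ℕ.* b)
    lemma = solveℕ

  -- The product is positive, and t′² < q with 2^(2e) ≤ q makes it smaller than q - 1.
  small∤ : ∀ {e} → 1 ℕ.≤ e → e ℕ.+ e ℕ.≤ r → ¬ (q-1 ∣ t′ ℕ.* (2 ℕ.^ e ℕ.∸ 1))
  small∤ {e} 1≤e 2e≤r d = ℕₚ.<⇒≱ bound (∣.∣⇒≤ {{ℕ.>-nonZero pos}} d)
    where
    2≤2^e : 2 ℕ.≤ 2 ℕ.^ e
    2≤2^e = ℕₚ.^-monoʳ-≤ 2 1≤e
    pos : 0 ℕ.< t′ ℕ.* (2 ℕ.^ e ℕ.∸ 1)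
    pos = ℕₚ.*-mono-≤ 1≤t′ (ℕₚ.∸-monoˡ-≤ 1 2≤2^e)
    bound : t′ ℕ.* (2 ℕ.^ e ℕ.∸ 1) ℕ.< q-1
    bound = ℕₚ.<-≤-trans (ℕₚ.*-monoʳ-< t′ {{ℕ.>-nonZero 1≤t′}} (ℕₚ.∸-monoʳ-< (s≤s z≤n) (ℕₚ.≤-trans (s≤s z≤n) 2≤2^e)))
      (ℕₚ.<⇒≤pred (t′2^e<q {e} 2e≤r))

  -- Multiplying by 2^(r-e) exchanges e and r - e modulo q - 1, so one may assume 2e ≤ r.
  ∤ : ∀ {e} → 1 ℕ.≤ e → e ℕ.< r → ¬ (q-1 ∣ t′ ℕ.* (2 ℕ.^ e ℕ.∸ 1))
  ∤ {e} 1≤e e<r d with ℕₚ.≤-total (e ℕ.+ e) r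
  ... | inj₁ 2e≤r = small∤ 1≤e 2e≤r d
  ... | inj₂ r≤2e = small∤ {f} 1≤f 2f≤r (∣.∣m+n∣m⇒∣n (subst (q-1 ∣_) eq (∣.n∣m*n t′)) (∣.∣n⇒∣m*n (2 ℕ.^ f) d))
    where
    f = r ℕ.∸ e
    f+e≡r : f ℕ.+ e ≡ r
    f+e≡r = ℕₚ.m∸n+n≡m (ℕₚ.<⇒≤ e<r)
    1≤f : 1 ℕ.≤ f
    1≤f = ℕₚ.m<n⇒0<n∸m e<r
    2f≤r : f ℕ.+ f ℕ.≤ r
    2f≤r = ℕₚ.≤-trans (ℕₚ.+-monoʳ-≤ f (ℕₚ.+-cancelʳ-≤ e f e (subst (ℕ._≤ e ℕ.+ e) (sym f+e≡r) r≤2e))) (ℕₚ.≤-reflexive f+e≡r)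
    lemma : ∀ t x y → t ℕ.* (y ℕ.+ x ℕ.* suc y) ≡ suc x ℕ.* (t ℕ.* y) ℕ.+ t ℕ.* x
    lemma = solveℕ
    1+pred : ∀ n → 2 ℕ.^ n ≡ suc (2 ℕ.^ n ℕ.∸ 1)
    1+pred n = sym (ℕₚ.m+[n∸m]≡n (ℕₚ.m^n>0 2 n))
    eq : t′ ℕ.* q-1 ≡ 2 ℕ.^ f ℕ.* (t′ ℕ.* (2 ℕ.^ e ℕ.∸ 1)) ℕ.+ t′ ℕ.* (2 ℕ.^ f ℕ.∸ 1)
    eq = trans (cong (t′ ℕ.*_) (ℕₚ.suc-injective (trans (sym q≡) (trans (cong (2 ℕ.^_) (sym f+e≡r))
      (trans (ℕₚ.^-distribˡ-+-* 2 f e) (cong₂ ℕ._*_ (1+pred f) (1+pred e)))))))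
      (trans (lemma t′ (2 ℕ.^ f ℕ.∸ 1) (2 ℕ.^ e ℕ.∸ 1)) (cong (λ x → x ℕ.* (t′ ℕ.* (2 ℕ.^ e ℕ.∸ 1)) ℕ.+ t′ ℕ.* (2 ℕ.^ f ℕ.∸ 1)) (sym (1+pred f))))

  module _ {n : ℕ} (k : ℕ) (bs : Vec ℕ (suc n)) (k<r : k ℕ.< r) (bs<r : All (ℕ._< r) bs) (distinct : AllPairs _≢_ bs)
           (1∉bs : All (_≢ 1) bs) (total≡ : total bs ≡ 2 ℕ.^ k ℕ.+ t′) (a : K) where

    -- Off zero this is z^(-t′), by `total≡`. It cancels the power of z in a z^t′, whose weighted
    -- sum is therefore `a`, and leaves z^(t′(2^e - 1)) for the proper Frobenius twists, whose sums
    -- vanish.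
    weight : K → K
    weight z = φ k z * z ⁻¹ ^ total bs

    exponent : ℕ → ℕ
    exponent e = (2 ℕ.^ k ℕ.+ neg2^ 0 ℕ.* total bs) ℕ.+ t′ ℕ.* 2 ℕ.^ e

    weight-φ : ∀ e z → weight z * φ e (a * z ^ t′) ≡ φ e a * z ^ exponent e
    weight-φ e z = begin
      (φ k z * z ⁻¹ ^ total bs) * φ e (a * z ^ t′) ≡⟨ cong₂ (λ x y → (φ k z * x) * y) (^-assocʳ z (neg2^ 0) (total bs))
          (trans (φ-* e a (z ^ t′)) (cong (φ e a *_) (^-assocʳ z t′ (2 ℕ.^ e)))) ⟩
      (φ k z * z ^ (neg2^ 0 ℕ.* total bs)) * (φ e a * z ^ (t′ ℕ.* 2 ℕ.^ e)) ≡⟨ *-swap _ (φ e a) _ ⟩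
      φ e a * ((φ k z * z ^ (neg2^ 0 ℕ.* total bs)) * z ^ (t′ ℕ.* 2 ℕ.^ e))
        ≡⟨ cong (φ e a *_) (trans (cong (_* z ^ (t′ ℕ.* 2 ℕ.^ e)) (sym (^-homo-* z (2 ℕ.^ k) (neg2^ 0 ℕ.* total bs)))) (sym (^-homo-* z (2 ℕ.^ k ℕ.+ neg2^ 0 ℕ.* total bs) (t′ ℕ.* 2 ℕ.^ e)))) ⟩
      φ e a * z ^ exponent e ∎

    exponent+t′ : ∀ e → exponent e ℕ.+ t′ ≡ total bs ℕ.* q-1 ℕ.+ t′ ℕ.* 2 ℕ.^ e
    exponent+t′ e = begin
      exponent e ℕ.+ t′ ≡⟨ lemma (2 ℕ.^ k) (neg2^ 0) (total bs) t′ (t′ ℕ.* 2 ℕ.^ e) ⟩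
      (2 ℕ.^ k ℕ.+ t′) ℕ.+ neg2^ 0 ℕ.* total bs ℕ.+ t′ ℕ.* 2 ℕ.^ e ≡⟨ cong (λ x → x ℕ.+ neg2^ 0 ℕ.* total bs ℕ.+ t′ ℕ.* 2 ℕ.^ e) total≡ ⟨
      total bs ℕ.+ neg2^ 0 ℕ.* total bs ℕ.+ t′ ℕ.* 2 ℕ.^ e ≡⟨ cong (ℕ._+ t′ ℕ.* 2 ℕ.^ e) (trans (lemma′ (total bs) (neg2^ 0)) (cong (total bs ℕ.*_) (ℕₚ.m∸n+n≡m (2^<q 1≤r)))) ⟩
      total bs ℕ.* q-1 ℕ.+ t′ ℕ.* 2 ℕ.^ e ∎
      where
      lemma : ∀ a b c d e → a ℕ.+ b ℕ.* c ℕ.+ e ℕ.+ d ≡ a ℕ.+ d ℕ.+ b ℕ.* c ℕ.+ e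
      lemma = solveℕ
      lemma′ : ∀ a b → a ℕ.+ b ℕ.* a ≡ a ℕ.* (b ℕ.+ 1)
      lemma′ = solveℕ

    exponent-∣ : ∀ {e} → q-1 ∣ exponent e → q-1 ∣ t′ ℕ.* (2 ℕ.^ e ℕ.∸ 1)
    exponent-∣ {e} d = ∣.∣m+n∣m⇒∣n (subst (q-1 ∣_) eq d) (∣.n∣m*n (total bs))
      where
      eq : exponent e ≡ total bs ℕ.* q-1 ℕ.+ t′ ℕ.* (2 ℕ.^ e ℕ.∸ 1)
      eq = ℕₚ.+-cancelʳ-≡ t′ _ _ (trans (exponent+t′ e) (trans (cong (λ x → total bs ℕ.* q-1 ℕ.+ t′ ℕ.* x) (sym (ℕₚ.m+[n∸m]≡n (ℕₚ.m^n>0 2 e))))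
        (lemma (total bs ℕ.* q-1) t′ (2 ℕ.^ e ℕ.∸ 1))))
        where
        lemma : ∀ a t x → a ℕ.+ t ℕ.* (1 ℕ.+ x) ≡ a ℕ.+ t ℕ.* x ℕ.+ t
        lemma = solveℕ

    off : ∀ {e} → 1 ℕ.≤ e → e ℕ.< r → ∑ (λ z → weight z * φ e (a * z ^ t′)) ≡ 0#
    off {e} 1≤e e<r = trans (∑-cong (weight-φ e)) (trans (∑-*ˡ (φ e a) _)
      (trans (cong (φ e a *_) (sum-pow-∤ (exponent e) (∤ 1≤e e<r ∘ exponent-∣ {e}))) (zeroʳ _)))

    on : ∑ (λ z → weight z * φ 0 (a * z ^ t′)) ≡ a
    on = trans (∑-cong (weight-φ 0)) (trans (∑-*ˡ (φ 0 a) _) (trans (cong₂ _*_ (φ-0 a) full) (*-identityʳ a)))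
      where
      exponent-0 : exponent 0 ≡ total bs ℕ.* q-1
      exponent-0 = ℕₚ.+-cancelʳ-≡ t′ _ _ (trans (exponent+t′ 0) (cong (total bs ℕ.* q-1 ℕ.+_) (ℕₚ.*-identityʳ t′)))
      full : ∑ (_^ exponent 0) ≡ 1#
      full = trans (∑-cong (λ z → cong (z ^_) (trans exponent-0 (cong (ℕ._* q-1) total-suc)))) (sum-pow-∣ (pred (total bs)))
        where
        total-suc : total bs ≡ suc (pred (total bs))
        total-suc = sym (ℕₚ.suc-pred (total bs) {{ℕ.>-nonZero (subst (0 ℕ.<_) (sym total≡) (ℕₚ.≤-trans (ℕₚ.m^n>0 2 k) (ℕₚ.m≤m+n _ t′)))}})

    -- As κ is a square root, its p-th Frobenius power is the (p - 1)-st one of a z^t′, cyclically,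
    -- and only p = 1 meets the untwisted term. Hence the demand that `bs` avoid 1.
    φ-κ : ∀ {p} → p ℕ.< r → p ≢ 1 → ∑ (λ z → weight z * φ p (κ a z)) ≡ 0#
    φ-κ {zero} 0<r _ = trans (∑-cong (λ z → cong (weight z *_) (φ-0 (κ a z))))
      (off (ℕₚ.<⇒≤pred 2≤r) (ℕₚ.≤-reflexive suc-pred-r))
    φ-κ {1} _ 1≢1 = contradiction refl 1≢1
    φ-κ {suc (suc p)} p<r _ = trans (∑-cong (λ z → cong (weight z *_) (φ-suc-sqrt (suc p) (a * z ^ t′)))) (off (s≤s z≤n) (ℕₚ.<-trans ℕₚ.≤-refl p<r))

    sum-sumφ : ∀ {m} (cs : Vec ℕ m) → All (ℕ._< r) cs → All (_≢ 1) cs → ∑ (λ z → weight z * sumφ cs (κ a z)) ≡ 0#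
    sum-sumφ [] _ _ = sum-ε λ z → zeroʳ (weight z)
    sum-sumφ (c ∷ cs) (c<r ∷ cs<r) (c≢1 ∷ 1∉cs) = trans (∑-cong (λ z → distribˡ (weight z) (φ c (κ a z)) (sumφ cs (κ a z))))
      (trans (∑-+ (λ z → weight z * φ c (κ a z)) (λ z → weight z * sumφ cs (κ a z)))
        (trans (cong₂ _+_ (φ-κ c<r c≢1) (sum-sumφ cs cs<r 1∉cs)) (+-identityʳ 0#)))

    sum-Tr : ∑ (λ z → weight z * Tr (κ a z)) ≡ a
    sum-Tr = begin
      ∑ (λ z → weight z * Tr (κ a z)) ≡⟨ ∑-cong (λ z → ∑<-* r (weight z) _) ⟩
      ∑ (λ z → ∑< r (λ s → weight z * φ s (κ a z))) ≡⟨ ∑-∑<-comm r _ ⟩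
      ∑< r (λ s → ∑ (λ z → weight z * φ s (κ a z))) ≡⟨ ∑<-single r _ 2≤r (λ s<r s≢1 → φ-κ s<r s≢1) ⟩
      ∑ (λ z → weight z * φ 1 (κ a z)) ≡⟨ ∑-cong (λ z → cong (weight z *_) (φ-suc-sqrt 0 (a * z ^ t′))) ⟩
      ∑ (λ z → weight z * φ 0 (a * z ^ t′)) ≡⟨ on ⟩
      a ∎

    -- Averaging the relation over ν at the exponent `k` gives `φ k z`, and over the steps at `bs`
    -- it gives `weight z` times Tr κ + sumφ bs κ. Only the Frobenius index 1 of the trace survives
    -- the sum over z.
    flat⇒a≡0 : 3 ℕ.≤ suc n → (∀ z → Flat (a * z ^ t′)) → a ≡ 0#
    flat⇒a≡0 3≤n flat = begin
      a ≡⟨ trans (cong₂ _+_ sum-Tr (sum-sumφ bs bs<r 1∉bs)) (+-identityʳ a) ⟨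
      ∑ (λ z → weight z * Tr (κ a z)) + ∑ (λ z → weight z * sumφ bs (κ a z)) ≡⟨ ∑-+ (λ z → weight z * Tr (κ a z)) (λ z → weight z * sumφ bs (κ a z)) ⟨
      ∑ (λ z → weight z * Tr (κ a z) + weight z * sumφ bs (κ a z)) ≡⟨ ∑-cong (λ z → trans (sym (distribˡ (weight z) _ _)) (*-assoc (φ k z) _ _)) ⟩
      ∑ (λ z → φ k z * (z ⁻¹ ^ total bs * (Tr (κ a z) + sumφ bs (κ a z)))) ≡⟨ ∑-cong (λ z → cong₂ _*_
          (trans (∑-cong (λ ν → cong (λ e → ν ^ neg2^ k * Tr e) (*-comm ν z))) (select-Tr k<r z))
          (Avg-R-head (κ a z) (z ⁻¹) bs bs<r distinct)) ⟨
      ∑ (λ z → ∑ (λ ν → ν ^ neg2^ k * Tr (ν * z)) * X z) ≡⟨ ∑-cong (λ z → *-distribʳ-sum (X z) (λ ν → ν ^ neg2^ k * Tr (ν * z))) ⟩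
      ∑ (λ z → ∑ (λ ν → (ν ^ neg2^ k * Tr (ν * z)) * X z)) ≡⟨ ∑-comm (λ z ν → (ν ^ neg2^ k * Tr (ν * z)) * X z) ⟩
      ∑ (λ ν → ∑ (λ z → (ν ^ neg2^ k * Tr (ν * z)) * X z)) ≡⟨ ∑-cong (λ ν → trans (∑-cong (λ z → *-assoc (ν ^ neg2^ k) (Tr (ν * z)) (X z))) (∑-*ˡ (ν ^ neg2^ k) _)) ⟩
      ∑ (λ ν → ν ^ neg2^ k * ∑ (λ z → Tr (ν * z) * X z)) ≡⟨ sum-ε (λ ν → trans (cong (ν ^ neg2^ k *_) (vanish ν)) (zeroʳ _)) ⟩
      0# ∎
      where
      Y : K → Vec K (suc n) → K
      Y z v = R (suc (suc n)) (κ a z ∷ Vec.map (_* z ⁻¹) v)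
      X : K → K
      X z = Avg bs (Y z)
      vanish : ∀ ν → ∑ (λ z → Tr (ν * z) * X z) ≡ 0#
      vanish ν = trans (∑-cong (λ z → sym (Avg-* bs (Tr (ν * z)) (Y z)))) (trans (sym (Avg-∑ bs (λ z v → Tr (ν * z) * Y z v)))
        (Avg-0 bs (flat-relation a flat (suc n) 3≤n ν)))

-- Digit expansions and numbers without two ones at a fixed distance.

module Digits where
  open import Data.Nat.Base using (_+_; _*_; _^_; _∸_; _≤_; _<_)
  open ≡-Reasoning

  num : ℕ → (ℕ → ℕ) → ℕ
  num zero f = 0
  num (suc n) f = f 0 + 2 * num n (f ∘ suc)

  num-cong : ∀ n {f g} → (∀ p → f p ≡ g p) → num n f ≡ num n g
  num-cong zero eq = refl
  num-cong (suc n) eq = cong₂ (λ a b → a + 2 * b) (eq 0) (num-cong n (eq ∘ suc))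

  num-+ : ∀ n f g → num n (λ p → f p + g p) ≡ num n f + num n g
  num-+ zero f g = refl
  num-+ (suc n) f g = trans (cong (λ x → f 0 + g 0 + 2 * x) (num-+ n (f ∘ suc) (g ∘ suc))) (lemma (f 0) (g 0) (num n (f ∘ suc)) (num n (g ∘ suc)))
    where
    lemma : ∀ a b c d → a + b + 2 * (c + d) ≡ (a + 2 * c) + (b + 2 * d)
    lemma = solveℕ

  num-split : ∀ m n f → num (m + n) f ≡ num m f + 2 ^ m * num n (λ p → f (m + p))
  num-split zero n f = sym (ℕₚ.+-identityʳ _)
  num-split (suc m) n f = trans (cong (λ x → f 0 + 2 * x) (num-split m n (f ∘ suc))) (lemma (f 0) (num m (f ∘ suc)) (2 ^ m) (num n (λ p → f (suc m + p))))
    where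
    lemma : ∀ a b c d → a + 2 * (b + c * d) ≡ a + 2 * b + 2 * c * d
    lemma = solveℕ

  num-zero : ∀ n {f} → (∀ p → p < n → f p ≡ 0) → num n f ≡ 0
  num-zero zero eq = refl
  num-zero (suc n) eq rewrite eq 0 (s≤s z≤n) | num-zero n (λ p p<n → eq (suc p) (s≤s p<n)) = refl

  num-extend : ∀ r k {f} → (∀ p → r ≤ p → f p ≡ 0) → num (r + k) f ≡ num r f
  num-extend r k {f} eq = trans (num-split r k f) (trans (cong (λ x → num r f + 2 ^ r * x)
    (num-zero k (λ p _ → eq (r + p) (ℕₚ.m≤m+n r p)))) (trans (cong (num r f +_) (ℕₚ.*-zeroʳ (2 ^ r))) (ℕₚ.+-identityʳ _)))

  num<2^ : ∀ n {f} → (∀ p → f p ≤ 1) → num n f < 2 ^ n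
  num<2^ zero _ = s≤s z≤n
  num<2^ (suc n) {f} f≤1 = ℕₚ.≤-trans (s≤s (ℕₚ.+-monoˡ-≤ (2 * num n (f ∘ suc)) (f≤1 0)))
    (subst (_≤ 2 * 2 ^ n) (lemma (num n (f ∘ suc))) (ℕₚ.*-monoʳ-≤ 2 (num<2^ n (f≤1 ∘ suc))))
    where
    lemma : ∀ x → 2 * suc x ≡ suc (1 + 2 * x)
    lemma = solveℕ

  divide : ∀ {m a b x y} → a < m → b < m → a + m * x ≡ b + m * y → a ≡ b × x ≡ y
  divide {m} {a} {b} {x} {y} a<m b<m eq with ℕₚ.<-cmp x y
  ... | tri≈ _ refl _ = ℕₚ.+-cancelʳ-≡ _ _ _ eq , refl
  ... | tri< x<y _ _ = contradiction eq (ℕₚ.<⇒≢ (ℕₚ.<-≤-trans (ℕₚ.+-monoˡ-< (m * x) a<m)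
        (ℕₚ.≤-trans (subst (_≤ m * y) (ℕₚ.*-suc m x) (ℕₚ.*-monoʳ-≤ m x<y)) (ℕₚ.m≤n+m _ b))))
  ... | tri> _ _ y<x = contradiction (sym eq) (ℕₚ.<⇒≢ (ℕₚ.<-≤-trans (ℕₚ.+-monoˡ-< (m * y) b<m)
        (ℕₚ.≤-trans (subst (_≤ m * x) (ℕₚ.*-suc m y) (ℕₚ.*-monoʳ-≤ m y<x)) (ℕₚ.m≤n+m _ a))))

  num-unique : ∀ n {f g X Y} → (∀ p → f p ≤ 1) → (∀ p → g p ≤ 1) →
    num n f + 2 ^ n * X ≡ num n g + 2 ^ n * Y → ∀ {p} → p < n → f p ≡ g p
  num-unique (suc n) {f} {g} {X} {Y} f≤1 g≤1 eq {p} p<n = go p p<n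
    where
    lemma : ∀ a b c d → a + 2 * (b + c * d) ≡ a + 2 * b + 2 * c * d
    lemma = solveℕ
    split = divide {2} {f 0} {g 0} (s≤s (f≤1 0)) (s≤s (g≤1 0))
      (trans (lemma (f 0) (num n (f ∘ suc)) (2 ^ n) X) (trans eq (sym (lemma (g 0) (num n (g ∘ suc)) (2 ^ n) Y))))
    go : ∀ p → p < suc n → f p ≡ g p
    go zero _ = proj₁ split
    go (suc p) (s≤s p<n) = num-unique n {f ∘ suc} {g ∘ suc} {X} {Y} (f≤1 ∘ suc) (g≤1 ∘ suc) (proj₂ split) p<n

  shift : ℕ → (ℕ → ℕ) → ℕ → ℕ
  shift zero f p = f p
  shift (suc v) f zero = 0
  shift (suc v) f (suc p) = shift v f p

  num-shift : ∀ v n f → num (v + n) (shift v f) ≡ 2 ^ v * num n f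
  num-shift zero n f = sym (ℕₚ.+-identityʳ _)
  num-shift (suc v) n f = trans (cong (2 *_) (num-shift v n f)) (sym (ℕₚ.*-assoc 2 (2 ^ v) _))

  shift-at : ∀ v f p → shift v f (v + p) ≡ f p
  shift-at zero f p = refl
  shift-at (suc v) f p = shift-at v f p

  shift-≤1 : ∀ v {f} → (∀ p → f p ≤ 1) → ∀ p → shift v f p ≤ 1
  shift-≤1 zero f≤1 p = f≤1 p
  shift-≤1 (suc v) f≤1 zero = z≤n
  shift-≤1 (suc v) f≤1 (suc p) = shift-≤1 v f≤1 p

  shift-low : ∀ v f {p} → p < v → shift v f p ≡ 0
  shift-low (suc v) f {zero} _ = refl
  shift-low (suc v) f {suc p} (s≤s p<v) = shift-low v f p<v

  suc-pos : ∀ {p} → 1 ≤ p → suc (pred p) ≡ p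
  suc-pos (s≤s z≤n) = refl

  module Sparse (r i : ℕ) (s : ℕ → ℕ) (s≤1 : ∀ p → s p ≤ 1) (s-end : ∀ p → r ≤ p → s p ≡ 0)
                (sparse : ∀ p → s p + s (i + p) ≤ 1) where
    S : ℕ
    S = num r s

    module _ (v e t′ j E l M : ℕ) (1≤e : 1 ≤ e) (t′≤2^e : t′ ≤ 2 ^ e)
             (v+l≡ : v + l ≡ suc (e + i)) (r≡ : r ≡ M + (v + i)) (room : e + l ≤ M)
             (t≡ : 2 ^ v + 2 ^ (v + i) ≡ 2 + t′) (0<E : 0 < E) (E<t′ : E < t′) (t′S≡ : t′ * S ≡ E + 2 ^ r * j) where

      -- Digits of (2 + t′)S and of 2S. The two shifted copies of S in `h` do not overlap, as S has
      -- no two ones at distance i, so `h` has digits 0 and 1 only.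
      h g : ℕ → ℕ
      h p = shift v s p + shift (v + i) s p
      g = shift 1 s

      g≤1 : ∀ p → g p ≤ 1
      g≤1 = shift-≤1 1 s≤1

      h≤1 : ∀ p → h p ≤ 1
      h≤1 = go v
        where
        go₀ : ∀ p → s p + shift i s p ≤ 1
        go₀ p with ℕₚ.<-≤-connex p i
        ... | inj₁ p<i = subst (_≤ 1) (sym (trans (cong (s p +_) (shift-low i s p<i)) (ℕₚ.+-identityʳ _))) (s≤1 p)
        ... | inj₂ i≤p = subst (λ p → s p + shift i s p ≤ 1) (ℕₚ.m+[n∸m]≡n i≤p)
              (subst (_≤ 1) (trans (ℕₚ.+-comm (s (p ∸ i)) _) (cong (s (i + (p ∸ i)) +_) (sym (shift-at i s (p ∸ i))))) (sparse (p ∸ i)))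
        go : ∀ v p → shift v s p + shift (v + i) s p ≤ 1
        go zero = go₀
        go (suc v) zero = z≤n
        go (suc v) (suc p) = go v p

      num-h : num (r + (v + i)) h ≡ num (r + 1) g + E + 2 ^ r * j
      num-h = begin
        num (r + (v + i)) h ≡⟨ num-+ (r + (v + i)) (shift v s) (shift (v + i) s) ⟩
        num (r + (v + i)) (shift v s) + num (r + (v + i)) (shift (v + i) s)
          ≡⟨ cong₂ _+_ (trans (cong (λ n → num n (shift v s)) (reorder r v i)) (trans (num-shift v (r + i) s) (cong (2 ^ v *_) (num-extend r i s-end))))
                       (trans (cong (λ n → num n (shift (v + i) s)) (ℕₚ.+-comm r (v + i))) (num-shift (v + i) r s)) ⟩
        2 ^ v * S + 2 ^ (v + i) * S ≡⟨ ℕₚ.*-distribʳ-+ S (2 ^ v) (2 ^ (v + i)) ⟨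
        (2 ^ v + 2 ^ (v + i)) * S ≡⟨ cong (_* S) t≡ ⟩
        (2 + t′) * S ≡⟨ ℕₚ.*-distribʳ-+ S 2 t′ ⟩
        2 * S + t′ * S ≡⟨ cong₂ _+_ (sym (trans (cong (λ n → num n g) (ℕₚ.+-comm r 1)) (num-shift 1 r s))) t′S≡ ⟩
        num (r + 1) g + (E + 2 ^ r * j) ≡⟨ ℕₚ.+-assoc (num (r + 1) g) E _ ⟨
        num (r + 1) g + E + 2 ^ r * j ∎
        where
        reorder : ∀ r v i → r + (v + i) ≡ v + (r + i)
        reorder = solveℕ

      E<2^e : E < 2 ^ e
      E<2^e = ℕₚ.<-≤-trans E<t′ t′≤2^e

      -- Below c the addition of E to 2S does not produce a carry out of position c.
      no-carry : ∀ p₀ → e ≤ p₀ → g p₀ ≡ 0 → num (suc p₀) g + E < 2 ^ suc p₀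
      no-carry p₀ e≤p₀ gp₀≡0 = ℕₚ.<-≤-trans
        (ℕₚ.+-mono-<-≤ (subst (_< 2 ^ p₀) (sym low) (num<2^ p₀ g≤1)) (ℕₚ.≤-trans (ℕₚ.<⇒≤ E<2^e) (ℕₚ.^-monoʳ-≤ 2 e≤p₀)))
        (ℕₚ.≤-reflexive (cong (2 ^ p₀ +_) (sym (ℕₚ.+-identityʳ (2 ^ p₀)))))
        where
        low : num (suc p₀) g ≡ num p₀ g
        low = begin
          num (suc p₀) g ≡⟨ cong (λ n → num n g) (ℕₚ.+-comm 1 p₀) ⟩
          num (p₀ + 1) g ≡⟨ num-split p₀ 1 g ⟩
          num p₀ g + 2 ^ p₀ * (g (p₀ + 0) + 2 * 0) ≡⟨ cong (λ x → num p₀ g + 2 ^ p₀ * (x + 0)) (trans (cong g (ℕₚ.+-identityʳ p₀)) gp₀≡0) ⟩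
          num p₀ g + 2 ^ p₀ * 0 ≡⟨ cong (num p₀ g +_) (ℕₚ.*-zeroʳ (2 ^ p₀)) ⟩
          num p₀ g + 0 ≡⟨ ℕₚ.+-identityʳ _ ⟩
          num p₀ g ∎

      -- If adding E to the part of 2S below `c` produces no carry, both low parts are below 2^c,
      -- and the digits above agree up to position r, where 2^r j enters.
      h≡g-above : ∀ {c d} → r ≡ c + d → num c g + E < 2 ^ c → ∀ {k} → k < d → h (c + k) ≡ g (c + k)
      h≡g-above {c} {d} refl small k<d = num-unique d {λ k → h (c + k)} {λ k → g (c + k)} {X} {Y} (λ k → h≤1 (c + k)) (λ k → g≤1 (c + k))
        (proj₂ (divide {2 ^ c} (num<2^ c h≤1) small eq)) k<d
        where
        X Y : ℕ
        X = num (v + i) (λ p → h (c + d + p))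
        Y = num 1 (λ p → g (c + d + p)) + j
        expand : ∀ f n → num (c + d + n) f ≡ num c f + 2 ^ c * (num d (λ k → f (c + k)) + 2 ^ d * num n (λ p → f (c + d + p)))
        expand f n = begin
          num (c + d + n) f ≡⟨ num-split (c + d) n f ⟩
          num (c + d) f + 2 ^ (c + d) * Z ≡⟨ cong₂ _+_ (num-split c d f) (cong (_* Z) (ℕₚ.^-distribˡ-+-* 2 c d)) ⟩
          num c f + 2 ^ c * W + 2 ^ c * 2 ^ d * Z ≡⟨ lemma (num c f) (2 ^ c) W (2 ^ d) Z ⟩
          num c f + 2 ^ c * (W + 2 ^ d * Z) ∎
          where
          Z = num n (λ p → f (c + d + p))
          W = num d (λ k → f (c + k))
          lemma : ∀ a b c d e → a + b * c + b * d * e ≡ a + b * (c + d * e)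
          lemma = solveℕ
        eq : num c h + 2 ^ c * (num d (λ k → h (c + k)) + 2 ^ d * X) ≡ num c g + E + 2 ^ c * (num d (λ k → g (c + k)) + 2 ^ d * Y)
        eq = begin
          num c h + 2 ^ c * (num d (λ k → h (c + k)) + 2 ^ d * X) ≡⟨ expand h (v + i) ⟨
          num (c + d + (v + i)) h ≡⟨ num-h ⟩
          num (c + d + 1) g + E + 2 ^ (c + d) * j ≡⟨ cong₂ (λ x y → x + E + y * j) (expand g 1) (ℕₚ.^-distribˡ-+-* 2 c d) ⟩
          num c g + 2 ^ c * (num d (λ k → g (c + k)) + 2 ^ d * num 1 (λ p → g (c + d + p))) + E + 2 ^ c * 2 ^ d * j
            ≡⟨ lemma (num c g) (2 ^ c) (num d (λ k → g (c + k))) (2 ^ d) (num 1 (λ p → g (c + d + p))) E j ⟩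
          num c g + E + 2 ^ c * (num d (λ k → g (c + k)) + 2 ^ d * Y) ∎
          where
          lemma : ∀ a b c d e f j → a + b * (c + d * e) + f + b * d * j ≡ a + f + b * (c + d * (e + j))
          lemma = solveℕ

      -- A carry caused by E dies at a zero digit of `g`. If the digit at e is 1, the one at e + i
      -- is 0 by sparseness, so nothing is carried past e + i.
      h≡g : ∀ {p} → suc (e + i) ≤ p → p < r → h p ≡ g p
      h≡g {p} e+i<p p<r with ℕₚ.m≤n⇒m<n∨m≡n (g≤1 e)
      ... | inj₁ (s≤s ge≤0) = at (suc e) (ℕₚ.≤-trans (s≤s (ℕₚ.m≤m+n e i)) e+i<p) (no-carry e ℕₚ.≤-refl (ℕₚ.n≤0⇒n≡0 ge≤0))
        where
        at : ∀ c → c ≤ p → num c g + E < 2 ^ c → h p ≡ g p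
        at c c≤p small = subst (λ p → h p ≡ g p) (ℕₚ.m+[n∸m]≡n c≤p)
          (h≡g-above (sym (ℕₚ.m+[n∸m]≡n (ℕₚ.≤-trans c≤p (ℕₚ.<⇒≤ p<r)))) small (ℕₚ.∸-monoˡ-< p<r c≤p))
      ... | inj₂ ge≡1 = subst (λ p → h p ≡ g p) (ℕₚ.m+[n∸m]≡n e+i<p)
          (h≡g-above (sym (ℕₚ.m+[n∸m]≡n (ℕₚ.≤-trans e+i<p (ℕₚ.<⇒≤ p<r)))) (no-carry (e + i) (ℕₚ.m≤m+n e i) g[e+i]≡0) (ℕₚ.∸-monoˡ-< p<r e+i<p))
        where
        g[e+i]≡0 : g (e + i) ≡ 0
        g[e+i]≡0 = begin
          g (e + i) ≡⟨ cong (λ e → g (e + i)) (suc-pos 1≤e) ⟨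
          s (pred e + i) ≡⟨ cong s (ℕₚ.+-comm (pred e) i) ⟩
          s (i + pred e) ≡⟨ ℕₚ.n≤0⇒n≡0 (ℕₚ.+-cancelˡ-≤ 1 _ _ (subst (λ x → x + s (i + pred e) ≤ 1) (trans (cong g (suc-pos 1≤e)) ge≡1) (sparse (pred e)))) ⟩
          0 ∎

      -- In this range h = g reads (2 + t′) S = 2 S + E + 2^r j digit by digit, so a digit 1 of s at m forces
      -- digits 1 at m + v - 1 and m + v + i - 1, whose distance is i.
      gap : ∀ {m} → l ≤ m → m < M → s m ≡ 0
      gap {m} l≤m m<M with ℕₚ.m≤n⇒m<n∨m≡n (s≤1 m)
      ... | inj₁ (s≤s sm≤0) = ℕₚ.n≤0⇒n≡0 sm≤0
      ... | inj₂ sm≡1 = contradiction (subst₂ (λ x y → x + y ≤ 1) s₁ s₂ (sparse (pred (v + m)))) λ { (s≤s ()) }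
        where
        low : suc (e + i) ≤ v + m
        low = subst (_≤ v + m) v+l≡ (ℕₚ.+-monoʳ-≤ v l≤m)
        high : v + i + m < r
        high = subst (v + i + m <_) (trans (ℕₚ.+-comm (v + i) M) (sym r≡)) (ℕₚ.+-monoʳ-< (v + i) m<M)
        v+m≤ : v + m ≤ v + i + m
        v+m≤ = ℕₚ.+-monoˡ-≤ m (ℕₚ.m≤m+n v i)
        one : ∀ {x} → x ≤ 1 → 1 ≤ x → x ≡ 1
        one a b = ℕₚ.≤-antisym a b
        1≤v+m : 1 ≤ v + m
        1≤v+m = ℕₚ.≤-trans (s≤s z≤n) low
        s₁ : s (pred (v + m)) ≡ 1
        s₁ = trans (cong g (suc-pos 1≤v+m)) (trans (sym (h≡g low (ℕₚ.≤-<-trans v+m≤ high)))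
          (one (h≤1 (v + m)) (subst (_≤ h (v + m)) (trans (shift-at v s m) sm≡1) (ℕₚ.m≤m+n _ _))))
        s₂ : s (i + pred (v + m)) ≡ 1
        s₂ = trans (cong g (trans (sym (ℕₚ.+-suc i (pred (v + m)))) (trans (cong (i +_) (suc-pos 1≤v+m)) (reorder i v m))))
          (trans (sym (h≡g (ℕₚ.≤-trans low v+m≤) high))
          (one (h≤1 (v + i + m)) (subst (_≤ h (v + i + m)) (trans (shift-at (v + i) s m) sm≡1) (ℕₚ.m≤n+m _ (shift v s (v + i + m))))))
          where
          reorder : ∀ i v m → i + (v + m) ≡ v + i + m
          reorder = solveℕ

      lo : ℕ
      lo = num l s

      num-M : num M s ≡ lo
      num-M = trans (cong (λ n → num n s) (sym (ℕₚ.m+[n∸m]≡n l≤M))) (trans (num-split l (M ∸ l) s)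
        (trans (cong (λ x → lo + 2 ^ l * x) (num-zero (M ∸ l) (λ p p< → gap (ℕₚ.m≤m+n l p)
          (subst (l + p <_) (ℕₚ.m+[n∸m]≡n l≤M) (ℕₚ.+-monoʳ-< l p<)))))
        (trans (cong (lo +_) (ℕₚ.*-zeroʳ (2 ^ l))) (ℕₚ.+-identityʳ lo))))
        where
        l≤M : l ≤ M
        l≤M = ℕₚ.≤-trans (ℕₚ.m≤n+m l e) room

      -- By `gap`, the digits of S below M are those below l, so t′·lo and E are both below 2^M and
      -- congruent modulo 2^M, hence equal; but 0 < E < t′ is not a multiple of t′.
      impossible : ⊥
      impossible = finish lo (proj₁ (divide {2 ^ M} t′lo< E<2^M eq))
        where
        hi : ℕ
        hi = num (v + i) (λ p → s (M + p))
        E<2^M : E < 2 ^ M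
        E<2^M = ℕₚ.<-≤-trans E<2^e (ℕₚ.^-monoʳ-≤ 2 (ℕₚ.≤-trans (ℕₚ.m≤m+n e l) room))
        t′lo< : t′ * lo < 2 ^ M
        t′lo< = ℕₚ.≤-<-trans (ℕₚ.*-monoˡ-≤ lo t′≤2^e) (ℕₚ.<-≤-trans
          (ℕₚ.*-monoʳ-< (2 ^ e) {{ℕₚ.m^n≢0 2 e}} (num<2^ l s≤1))
          (ℕₚ.≤-trans (ℕₚ.≤-reflexive (sym (ℕₚ.^-distribˡ-+-* 2 e l))) (ℕₚ.^-monoʳ-≤ 2 room)))
        eq : t′ * lo + 2 ^ M * (t′ * hi) ≡ E + 2 ^ M * (2 ^ (v + i) * j)
        eq = begin
          t′ * lo + 2 ^ M * (t′ * hi) ≡⟨ lemma t′ lo (2 ^ M) hi ⟩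
          t′ * (lo + 2 ^ M * hi) ≡⟨ cong (λ x → t′ * (x + 2 ^ M * hi)) num-M ⟨
          t′ * (num M s + 2 ^ M * hi) ≡⟨ cong (t′ *_) (trans (cong (λ n → num n s) r≡) (num-split M (v + i) s)) ⟨
          t′ * S ≡⟨ t′S≡ ⟩
          E + 2 ^ r * j ≡⟨ cong (λ r → E + 2 ^ r * j) r≡ ⟩
          E + 2 ^ (M + (v + i)) * j ≡⟨ cong (λ x → E + x * j) (ℕₚ.^-distribˡ-+-* 2 M (v + i)) ⟩
          E + 2 ^ M * 2 ^ (v + i) * j ≡⟨ cong (E +_) (ℕₚ.*-assoc (2 ^ M) (2 ^ (v + i)) j) ⟩
          E + 2 ^ M * (2 ^ (v + i) * j) ∎
          where
          lemma : ∀ t l m h → t * l + m * (t * h) ≡ t * (l + m * h)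
          lemma = solveℕ
        finish : ∀ n → t′ * n ≡ E → ⊥
        finish zero eq = contradiction (subst (0 <_) (trans (sym eq) (ℕₚ.*-zeroʳ t′)) 0<E) λ ()
        finish (suc n) eq = ℕₚ.<⇒≱ E<t′ (subst (t′ ≤_) eq (ℕₚ.m≤m*n t′ (suc n)))

-- Bit vectors, cyclic rotation and digit sums.

module BitVectors where
  open import Data.Nat.Base using (_+_; _*_; _^_; _∸_; _≤_; _<_)
  open ≡-Reasoning
  open Digits

  Bits : ℕ → Set
  Bits = Vec Bool

  bit : Bool → ℕ
  bit false = 0
  bit true = 1

  bit≤1 : ∀ b → bit b ≤ 1
  bit≤1 false = z≤n
  bit≤1 true = s≤s z≤n

  digit : ∀ {n} → Bits n → ℕ → ℕ
  digit [] p = 0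
  digit (b ∷ e) zero = bit b
  digit (b ∷ e) (suc p) = digit e p

  digit≤1 : ∀ {n} (e : Bits n) p → digit e p ≤ 1
  digit≤1 [] p = z≤n
  digit≤1 (b ∷ e) zero = bit≤1 b
  digit≤1 (b ∷ e) (suc p) = digit≤1 e p

  digit-end : ∀ {n} (e : Bits n) p → n ≤ p → digit e p ≡ 0
  digit-end [] p _ = refl
  digit-end (b ∷ e) (suc p) (s≤s n≤p) = digit-end e p n≤p

  val count : ∀ {n} → Bits n → ℕ
  val [] = 0
  val (b ∷ e) = bit b + 2 * val e
  count [] = 0
  count (b ∷ e) = bit b + count e

  val-num : ∀ {n} (e : Bits n) → val e ≡ num n (digit e)
  val-num [] = refl
  val-num (b ∷ e) = cong (λ x → bit b + 2 * x) (val-num e)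

  val< : ∀ {n} (e : Bits n) → val e < 2 ^ n
  val< {n} e = subst (_< 2 ^ n) (sym (val-num e)) (num<2^ n (digit≤1 e))

  bit-injective : ∀ {b c} → bit b ≡ bit c → b ≡ c
  bit-injective {false} {false} _ = refl
  bit-injective {true} {true} _ = refl

  val-injective : ∀ {n} (e u : Bits n) → val e ≡ val u → e ≡ u
  val-injective [] [] _ = refl
  val-injective (b ∷ e) (c ∷ u) eq = let (eq₀ , eq₁) = divide {2} {bit b} {bit c} (s≤s (bit≤1 b)) (s≤s (bit≤1 c)) eq
    in cong₂ _∷_ (bit-injective eq₀) (val-injective e u eq₁)

  -- With the lowest bit first, rotation halves the value modulo 2^n - 1.
  rotate : ∀ {n} → Bits n → Bits n
  rotate [] = []
  rotate (b ∷ e) = e ∷ʳ b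

  val-∷ʳ : ∀ {n} (e : Bits n) b → val (e ∷ʳ b) ≡ val e + 2 ^ n * bit b
  val-∷ʳ [] b = refl
  val-∷ʳ {suc n} (c ∷ e) b = trans (cong (λ x → bit c + 2 * x) (val-∷ʳ e b)) (lemma (bit c) (val e) (2 ^ n) (bit b))
    where
    lemma : ∀ c e n b → c + 2 * (e + n * b) ≡ c + 2 * e + 2 * n * b
    lemma = solveℕ

  count-∷ʳ : ∀ {n} (e : Bits n) b → count (e ∷ʳ b) ≡ count e + bit b
  count-∷ʳ [] b = ℕₚ.+-comm (bit b) 0
  count-∷ʳ (c ∷ e) b = trans (cong (bit c +_) (count-∷ʳ e b)) (sym (ℕₚ.+-assoc (bit c) _ _))

  digit-∷ʳ : ∀ {n} (e : Bits n) b p → p < n → digit (e ∷ʳ b) p ≡ digit e p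
  digit-∷ʳ (c ∷ e) b zero _ = refl
  digit-∷ʳ (c ∷ e) b (suc p) (s≤s p<n) = digit-∷ʳ e b p p<n

  count-rotate : ∀ {n} (e : Bits n) → count (rotate e) ≡ count e
  count-rotate [] = refl
  count-rotate (b ∷ e) = trans (count-∷ʳ e b) (ℕₚ.+-comm _ (bit b))

  digit-rotate : ∀ {n} (e : Bits n) p → suc p < n → digit (rotate e) p ≡ digit e (suc p)
  digit-rotate (b ∷ e) p (s≤s p<n) = digit-∷ʳ e b p p<n

  val-rotate : ∀ {n} (e : Bits n) → 2 * val (rotate e) ≡ val e + pred (2 ^ n) * digit e 0
  val-rotate [] = refl
  val-rotate {suc n} (b ∷ e) = begin
    2 * val (e ∷ʳ b) ≡⟨ cong (2 *_) (val-∷ʳ e b) ⟩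
    2 * (val e + 2 ^ n * bit b) ≡⟨ lemma₁ (val e) (2 ^ n) (bit b) ⟩
    2 * val e + 2 ^ suc n * bit b ≡⟨ cong (λ x → 2 * val e + x * bit b) (ℕₚ.suc-pred (2 ^ suc n) {{ℕₚ.m^n≢0 2 (suc n)}}) ⟨
    2 * val e + suc m * bit b ≡⟨ lemma₂ (val e) m (bit b) ⟩
    bit b + 2 * val e + m * bit b ∎
    where
    m = pred (2 ^ suc n)
    lemma₁ : ∀ e n b → 2 * (e + n * b) ≡ 2 * e + 2 * n * b
    lemma₁ = solveℕ
    lemma₂ : ∀ e m b → 2 * e + suc m * b ≡ b + 2 * e + m * b
    lemma₂ = solveℕ

  digit-0 : ∀ {n} (e : Bits n) → digit e 0 ≡ 0 ⊎ (digit e 0 ≡ 1 × 0 < val e)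
  digit-0 [] = inj₁ refl
  digit-0 (false ∷ e) = inj₁ refl
  digit-0 (true ∷ e) = inj₂ (refl , s≤s z≤n)

  rotates : ∀ {n} → ℕ → Bits n → Bits n
  rotates zero e = e
  rotates (suc i) e = rotates i (rotate e)

  count-rotates : ∀ {n} i (e : Bits n) → count (rotates i e) ≡ count e
  count-rotates zero e = refl
  count-rotates (suc i) e = trans (count-rotates i (rotate e)) (count-rotate e)

  digit-rotates : ∀ {n} i (e : Bits n) p → i + p < n → digit (rotates i e) p ≡ digit e (i + p)
  digit-rotates zero e p _ = refl
  digit-rotates (suc i) e p i+p<n = trans (digit-rotates i (rotate e) p (ℕₚ.<-trans (ℕₚ.n<1+n _) i+p<n)) (digit-rotate e (i + p) i+p<n)

  val-rotates : ∀ {n} i (e : Bits n) → ∃ λ k → 2 ^ i * val (rotates i e) ≡ val e + pred (2 ^ n) * k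
  val-rotates {n} zero e = 0 , trans (ℕₚ.+-identityʳ _) (sym (trans (cong (val e +_) (ℕₚ.*-zeroʳ (pred (2 ^ n)))) (ℕₚ.+-identityʳ _)))
  val-rotates {n} (suc i) e with val-rotates i (rotate e)
  ... | k , eq = digit e 0 + 2 * k , (begin
    2 * 2 ^ i * val (rotates i (rotate e)) ≡⟨ ℕₚ.*-assoc 2 (2 ^ i) _ ⟩
    2 * (2 ^ i * val (rotates i (rotate e))) ≡⟨ cong (2 *_) eq ⟩
    2 * (val (rotate e) + m * k) ≡⟨ ℕₚ.*-distribˡ-+ 2 (val (rotate e)) _ ⟩
    2 * val (rotate e) + 2 * (m * k) ≡⟨ cong (_+ 2 * (m * k)) (val-rotate e) ⟩
    val e + m * digit e 0 + 2 * (m * k) ≡⟨ lemma (val e) m (digit e 0) k ⟩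
    val e + m * (digit e 0 + 2 * k) ∎)
    where
    m = pred (2 ^ n)
    lemma : ∀ e m d k → e + m * d + 2 * (m * k) ≡ e + m * (d + 2 * k)
    lemma = solveℕ

  unit : ∀ n → ℕ → Bits n
  unit zero i = []
  unit (suc n) zero = true ∷ replicate n false
  unit (suc n) (suc i) = false ∷ unit n i

  val-zeros : ∀ n → val (replicate n false) ≡ 0
  val-zeros zero = refl
  val-zeros (suc n) = cong (2 *_) (val-zeros n)

  val-unit : ∀ {n i} → i < n → val (unit n i) ≡ 2 ^ i
  val-unit {suc n} {zero} _ = cong (λ x → 1 + 2 * x) (val-zeros n)
  val-unit {suc n} {suc i} (s≤s i<n) = cong (2 *_) (val-unit i<n)

  Disjoint : ∀ {n} → Bits n → Bits n → Set
  Disjoint e u = ∀ p → digit e p + digit u p ≤ 1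

  neither : Bool → Bool → Bool
  neither false false = true
  neither _ _ = false

  -- The digits left to A when B and C have taken theirs in the trinomial expansion.
  rest : ∀ {n} → Bits n → Bits n → Bits n
  rest [] [] = []
  rest (b ∷ e) (c ∷ u) = neither b c ∷ rest e u

  neither-sum : ∀ b c → bit b + bit c ≤ 1 → bit (neither b c) + bit b + bit c ≡ 1
  neither-sum false false _ = refl
  neither-sum true false _ = refl
  neither-sum false true _ = refl
  neither-sum true true (s≤s ())

  rest-count : ∀ {n} (e u : Bits n) → Disjoint e u → count (rest e u) + count e + count u ≡ n
  rest-count [] [] _ = refl
  rest-count {suc n} (b ∷ e) (c ∷ u) disj = trans (lemma (bit (neither b c)) (bit b) (bit c) (count (rest e u)) (count e) (count u))
    (cong₂ _+_ (neither-sum b c (disj 0)) (rest-count e u (disj ∘ suc)))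
    where
    lemma : ∀ a b c x y z → (a + x) + (b + y) + (c + z) ≡ (a + b + c) + (x + y + z)
    lemma = solveℕ

  rest-val : ∀ {n} (e u : Bits n) → Disjoint e u → suc (val (rest e u) + val e + val u) ≡ 2 ^ n
  rest-val [] [] _ = refl
  rest-val {suc n} (b ∷ e) (c ∷ u) disj = trans (cong suc (lemma (bit (neither b c)) (bit b) (bit c) (val (rest e u)) (val e) (val u)))
    (trans (cong (λ x → suc (x + 2 * (val (rest e u) + val e + val u))) (neither-sum b c (disj 0)))
    (trans (lemma₂ (val (rest e u) + val e + val u)) (cong (2 *_) (rest-val e u (disj ∘ suc)))))
    where
    lemma : ∀ a b c x y z → (a + 2 * x) + (b + 2 * y) + (c + 2 * z) ≡ (a + b + c) + 2 * (x + y + z)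
    lemma = solveℕ
    lemma₂ : ∀ x → suc (1 + 2 * x) ≡ 2 * suc x
    lemma₂ = solveℕ

  sumDigits : ℕ → (ℕ → ℕ) → ℕ
  sumDigits zero d = 0
  sumDigits (suc n) d = d 0 + sumDigits n (d ∘ suc)

  sumDigits-+ : ∀ n f g → sumDigits n (λ p → f p + g p) ≡ sumDigits n f + sumDigits n g
  sumDigits-+ zero f g = refl
  sumDigits-+ (suc n) f g = trans (cong (λ x → f 0 + g 0 + x) (sumDigits-+ n (f ∘ suc) (g ∘ suc)))
    (lemma (f 0) (g 0) (sumDigits n (f ∘ suc)) (sumDigits n (g ∘ suc)))
    where
    lemma : ∀ a b c d → a + b + (c + d) ≡ (a + c) + (b + d)
    lemma = solveℕ

  count-sumDigits : ∀ {n} (e : Bits n) → count e ≡ sumDigits n (digit e)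
  count-sumDigits [] = refl
  count-sumDigits (b ∷ e) = cong (bit b +_) (count-sumDigits e)

  halve : ∀ {x y z} → x + 2 * y ≡ 2 * z → ∃ λ c → x ≡ 2 * c × c + y ≡ z
  halve {x} {y} {z} eq = z ∸ y , x≡ , ℕₚ.m∸n+n≡m y≤z
    where
    y≤z : y ≤ z
    y≤z = ℕₚ.*-cancelˡ-≤ 2 (subst (2 * y ≤_) eq (ℕₚ.m≤n+m _ x))
    x≡ : x ≡ 2 * (z ∸ y)
    x≡ = trans (sym (ℕₚ.m+n∸n≡m x (2 * y))) (trans (cong (_∸ 2 * y) eq) (sym (ℕₚ.*-distribˡ-∸ 2 z y)))

  carry-step : ∀ n d c c′ → 0 < c → num (suc n) d + c ≡ 2 ^ suc n * c′ →
    ∃ λ c₁ → d 0 + c ≡ 2 * c₁ × 0 < c₁ × num n (d ∘ suc) + c₁ ≡ 2 ^ n * c′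
  carry-step n d c c′ 0<c eq with halve {d 0 + c} {num n (d ∘ suc)} {2 ^ n * c′}
      (trans (lemma (d 0) (num n (d ∘ suc)) c) (trans eq (ℕₚ.*-assoc 2 (2 ^ n) c′)))
    where
    lemma : ∀ a b c → a + c + 2 * b ≡ a + 2 * b + c
    lemma = solveℕ
  ... | zero , eq₁ , _ = contradiction (ℕₚ.<-≤-trans 0<c (ℕₚ.≤-trans (ℕₚ.m≤n+m c (d 0)) (ℕₚ.≤-reflexive eq₁))) λ ()
  ... | suc c₁ , eq₁ , eq₂ = suc c₁ , eq₁ , s≤s z≤n , trans (ℕₚ.+-comm _ (suc c₁)) eq₂

  -- The digits `d` may exceed 1. At each position d + c = 2c₁ with c₁ ≥ 1, so the digit exceeds the
  -- growth c₁ - c of the carry by c₁, at least 1.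
  carry-≤ : ∀ n d c c′ → 0 < c → num n d + c ≡ 2 ^ n * c′ → n + c′ ≤ sumDigits n d + c
  carry-≤ zero d c c′ _ eq = ℕₚ.≤-reflexive (sym (trans eq (ℕₚ.+-identityʳ c′)))
  carry-≤ (suc n) d c c′ 0<c eq with carry-step n d c c′ 0<c eq
  ... | c₁ , eq₁ , 0<c₁ , eq₂ = ℕₚ.≤-trans (ℕₚ.+-mono-≤ 0<c₁ (carry-≤ n (d ∘ suc) c₁ c′ 0<c₁ eq₂)) (ℕₚ.≤-reflexive (begin
    c₁ + (sumDigits n (d ∘ suc) + c₁) ≡⟨ lemma₁ c₁ (sumDigits n (d ∘ suc)) ⟩
    2 * c₁ + sumDigits n (d ∘ suc) ≡⟨ cong (_+ sumDigits n (d ∘ suc)) eq₁ ⟨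
    d 0 + c + sumDigits n (d ∘ suc) ≡⟨ lemma₂ (d 0) c (sumDigits n (d ∘ suc)) ⟩
    d 0 + sumDigits n (d ∘ suc) + c ∎))
    where
    lemma₁ : ∀ a b → a + (b + a) ≡ 2 * a + b
    lemma₁ = solveℕ
    lemma₂ : ∀ a b c → a + b + c ≡ a + c + b
    lemma₂ = solveℕ

  -- Every carry is positive, so a digit sum equal to its least possible value forces all carries to be 1.
  carry-≡ : ∀ n d c c′ → 0 < c → num (suc n) d + c ≡ 2 ^ suc n * c′ → sumDigits (suc n) d + c ≡ suc n + c′ →
    c′ ≡ 1 × (c ≡ 1 → ∀ {p} → p < suc n → d p ≡ 1)
  carry-≡ n d c c′ 0<c eq sum≡ with carry-step n d c c′ 0<c eq
  ... | c₁ , eq₁ , 0<c₁ , eq₂ = proj₁ (tail n refl) , λ { refl {zero} _ → ℕₚ.+-cancelʳ-≡ 1 _ _ (trans eq₁ (cong (2 *_) c₁≡1))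
                                                 ; refl {suc p} (s≤s p<n) → proj₂ (tail n refl) p<n }
    where
    lemma : ∀ d s c → d + s + c ≡ s + (d + c)
    lemma = solveℕ
    lemma₂ : ∀ s c → s + 2 * c ≡ s + c + c
    lemma₂ = solveℕ
    total≡ : sumDigits n (d ∘ suc) + c₁ + c₁ ≡ n + c′ + 1
    total≡ = begin
      sumDigits n (d ∘ suc) + c₁ + c₁ ≡⟨ lemma₂ (sumDigits n (d ∘ suc)) c₁ ⟨
      sumDigits n (d ∘ suc) + 2 * c₁ ≡⟨ cong (sumDigits n (d ∘ suc) +_) eq₁ ⟨
      sumDigits n (d ∘ suc) + (d 0 + c) ≡⟨ lemma (d 0) (sumDigits n (d ∘ suc)) c ⟨
      d 0 + sumDigits n (d ∘ suc) + c ≡⟨ sum≡ ⟩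
      suc n + c′ ≡⟨ ℕₚ.+-comm 1 (n + c′) ⟩
      n + c′ + 1 ∎
    c₁≡1 : c₁ ≡ 1
    c₁≡1 = ℕₚ.≤-antisym (ℕₚ.+-cancelˡ-≤ (n + c′) _ _ (subst (n + c′ + c₁ ≤_) total≡
      (ℕₚ.+-monoˡ-≤ c₁ (carry-≤ n (d ∘ suc) c₁ c′ 0<c₁ eq₂)))) 0<c₁
    sum′≡ : sumDigits n (d ∘ suc) + c₁ ≡ n + c′
    sum′≡ = ℕₚ.+-cancelʳ-≡ 1 _ _ (trans (cong (sumDigits n (d ∘ suc) + c₁ +_) (sym c₁≡1)) total≡)
    tail : ∀ m → m ≡ n → c′ ≡ 1 × (∀ {p} → p < n → d (suc p) ≡ 1)
    tail zero refl = trans (sym (ℕₚ.+-identityʳ c′)) (trans (sym eq₂) c₁≡1) , λ ()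
    tail (suc m) refl = let (c′≡1 , all) = carry-≡ m (d ∘ suc) c₁ c′ 0<c₁ eq₂ sum′≡ in c′≡1 , all c₁≡1

  -- Equal incoming and outgoing carry: the number is c(2^n - 1), and its digit sum n is the least
  -- possible one.
  carry-≡⁺ : ∀ {n d} c → 0 < n → 0 < c → num n d + c ≡ 2 ^ n * c → sumDigits n d ≡ n → c ≡ 1 × (∀ {p} → p < n → d p ≡ 1)
  carry-≡⁺ {suc n} {d} c _ 0<c eq sum≡ = let (c≡1 , all) = carry-≡ n d c c 0<c eq (cong (_+ c) sum≡) in c≡1 , all c≡1

  zeros-∷ʳ : ∀ n → replicate n false ∷ʳ false ≡ replicate (suc n) false
  zeros-∷ʳ zero = refl
  zeros-∷ʳ (suc n) = cong (false ∷_) (zeros-∷ʳ n)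

  unit-∷ʳ : ∀ {n i} → i < n → unit n i ∷ʳ false ≡ unit (suc n) i
  unit-∷ʳ {suc n} {zero} _ = cong (true ∷_) (zeros-∷ʳ n)
  unit-∷ʳ {suc n} {suc i} (s≤s i<n) = cong (false ∷_) (unit-∷ʳ i<n)

  rotates-unit : ∀ {n} i → i < n → rotates i (unit n i) ≡ unit n 0
  rotates-unit zero _ = refl
  rotates-unit {suc n} (suc i) (s≤s i<n) = trans (cong (rotates i) (unit-∷ʳ i<n)) (rotates-unit i (ℕₚ.m<n⇒m<1+n i<n))

  digit-zeros : ∀ n p → digit (replicate n false) p ≡ 0
  digit-zeros zero p = refl
  digit-zeros (suc n) zero = refl
  digit-zeros (suc n) (suc p) = digit-zeros n p

  unit-disjoint : ∀ n i → 1 ≤ i → Disjoint (unit n 0) (unit n i)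
  unit-disjoint zero i _ p = z≤n
  unit-disjoint (suc n) (suc i) _ zero = s≤s z≤n
  unit-disjoint (suc n) (suc i) _ (suc p) = subst (λ x → x + digit (unit n i) p ≤ 1) (sym (digit-zeros n p)) (digit≤1 (unit n i) p)

-- Sums over bit vectors and powers with exponent 2^n - 1.

module BitSums {r : ℕ} (F : Field (2 ℕ.^ r)) (1≤r : 1 ℕ.≤ r) where
  open FieldTheory F 1≤r
  open Trace F 1≤r
  open BitVectors
  open ≡-Reasoning

  Σᵇ : ∀ n → (Bits n → K) → K
  Σᵇ zero h = h []
  Σᵇ (suc n) h = Σᵇ n (h ∘ (false ∷_)) + Σᵇ n (h ∘ (true ∷_))

  Σᵇ-cong : ∀ n {f g : Bits n → K} → (∀ e → f e ≡ g e) → Σᵇ n f ≡ Σᵇ n g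
  Σᵇ-cong zero eq = eq []
  Σᵇ-cong (suc n) eq = cong₂ _+_ (Σᵇ-cong n (eq ∘ (false ∷_))) (Σᵇ-cong n (eq ∘ (true ∷_)))

  +-interchange : ∀ a b c d → (a + b) + (c + d) ≡ (a + c) + (b + d)
  +-interchange = solveF 4 (λ a b c d → (a ⊕ b) ⊕ (c ⊕ d) ⊜ (a ⊕ c) ⊕ (b ⊕ d)) refl

  Σᵇ-+ : ∀ n (f g : Bits n → K) → Σᵇ n (λ e → f e + g e) ≡ Σᵇ n f + Σᵇ n g
  Σᵇ-+ zero f g = refl
  Σᵇ-+ (suc n) f g = trans (cong₂ _+_ (Σᵇ-+ n _ _) (Σᵇ-+ n _ _)) (+-interchange _ _ _ _)

  Σᵇ-*ˡ : ∀ n c (f : Bits n → K) → c * Σᵇ n f ≡ Σᵇ n (λ e → c * f e)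
  Σᵇ-*ˡ zero c f = refl
  Σᵇ-*ˡ (suc n) c f = trans (distribˡ c _ _) (cong₂ _+_ (Σᵇ-*ˡ n c _) (Σᵇ-*ˡ n c _))

  Σᵇ-0 : ∀ n {f : Bits n → K} → (∀ e → f e ≡ 0#) → Σᵇ n f ≡ 0#
  Σᵇ-0 zero eq = eq []
  Σᵇ-0 (suc n) eq = trans (cong₂ _+_ (Σᵇ-0 n (eq ∘ (false ∷_))) (Σᵇ-0 n (eq ∘ (true ∷_)))) (+-identityʳ 0#)

  Σᵇ-comm : ∀ m n (h : Bits m → Bits n → K) → Σᵇ m (λ e → Σᵇ n (h e)) ≡ Σᵇ n (λ u → Σᵇ m (λ e → h e u))
  Σᵇ-comm zero n h = refl
  Σᵇ-comm (suc m) n h = trans (cong₂ _+_ (Σᵇ-comm m n _) (Σᵇ-comm m n _)) (sym (Σᵇ-+ n _ _))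

  ∑-Σᵇ : ∀ n (h : K → Bits n → K) → ∑ (λ x → Σᵇ n (h x)) ≡ Σᵇ n (λ e → ∑ (λ x → h x e))
  ∑-Σᵇ zero h = refl
  ∑-Σᵇ (suc n) h = trans (∑-distrib-+ (λ x → Σᵇ n (h x ∘ (false ∷_))) (λ x → Σᵇ n (h x ∘ (true ∷_)))) (cong₂ _+_ (∑-Σᵇ n _) (∑-Σᵇ n _))

  Σᵇ-single : ∀ n (u : Bits n) {f : Bits n → K} → (∀ e → e ≢ u → f e ≡ 0#) → Σᵇ n f ≡ f u
  Σᵇ-single zero [] _ = refl
  Σᵇ-single (suc n) (false ∷ u) eq = trans (cong₂ _+_ (Σᵇ-single n u (λ e e≢u → eq (false ∷ e) λ { refl → e≢u refl }))
    (Σᵇ-0 n (λ e → eq (true ∷ e) λ ()))) (+-identityʳ _)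
  Σᵇ-single (suc n) (true ∷ u) eq = trans (cong₂ _+_ (Σᵇ-0 n (λ e → eq (false ∷ e) λ ()))
    (Σᵇ-single n u (λ e e≢u → eq (true ∷ e) λ { refl → e≢u refl }))) (+-identityˡ _)

  Σᵇ-∷ʳ : ∀ n (f : Bits (suc n) → K) → Σᵇ (suc n) f ≡ Σᵇ n (λ e → f (e ∷ʳ false)) + Σᵇ n (λ e → f (e ∷ʳ true))
  Σᵇ-∷ʳ zero f = refl
  Σᵇ-∷ʳ (suc n) f = trans (cong₂ _+_ (Σᵇ-∷ʳ n (f ∘ (false ∷_))) (Σᵇ-∷ʳ n (f ∘ (true ∷_)))) (+-interchange _ _ _ _)

  Σᵇ-rotates : ∀ n i (f : Bits n → K) → Σᵇ n f ≡ Σᵇ n (f ∘ rotates i)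
  Σᵇ-rotates n zero f = refl
  Σᵇ-rotates n (suc i) f = trans (Σᵇ-rotates n i f) (step n (f ∘ rotates i))
    where
    step : ∀ n (f : Bits n → K) → Σᵇ n f ≡ Σᵇ n (f ∘ rotate)
    step zero f = refl
    step (suc n) f = Σᵇ-∷ʳ n f

  -- In characteristic 2 the off-diagonal terms cancel in pairs.
  Σᵇ-symmetric : ∀ n (h : Bits n → Bits n → K) → (∀ e u → h e u ≡ h u e) → Σᵇ n (λ e → Σᵇ n (h e)) ≡ Σᵇ n (λ e → h e e)
  Σᵇ-symmetric zero h sy = refl
  Σᵇ-symmetric (suc n) h sy = begin
    Σᵇ n (λ e → Σᵇ n (h₀₀ e) + Σᵇ n (h₀₁ e)) + Σᵇ n (λ e → Σᵇ n (h₁₀ e) + Σᵇ n (h₁₁ e))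
      ≡⟨ cong₂ _+_ (Σᵇ-+ n _ _) (Σᵇ-+ n _ _) ⟩
    (S h₀₀ + S h₀₁) + (S h₁₀ + S h₁₁) ≡⟨ cong (λ x → (S h₀₀ + S h₀₁) + (x + S h₁₁)) flip ⟩
    (S h₀₀ + S h₀₁) + (S h₀₁ + S h₁₁) ≡⟨ trans (+-assoc _ _ _) (cong (S h₀₀ +_) (x+[x+y]≡y _ _)) ⟩
    S h₀₀ + S h₁₁ ≡⟨ cong₂ _+_ (Σᵇ-symmetric n h₀₀ (λ e u → sy (false ∷ e) (false ∷ u))) (Σᵇ-symmetric n h₁₁ (λ e u → sy (true ∷ e) (true ∷ u))) ⟩
    Σᵇ n (λ e → h₀₀ e e) + Σᵇ n (λ e → h₁₁ e e) ∎
    where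
    h₀₀ h₀₁ h₁₀ h₁₁ : Bits n → Bits n → K
    h₀₀ e u = h (false ∷ e) (false ∷ u)
    h₀₁ e u = h (false ∷ e) (true ∷ u)
    h₁₀ e u = h (true ∷ e) (false ∷ u)
    h₁₁ e u = h (true ∷ e) (true ∷ u)
    S : (Bits n → Bits n → K) → K
    S k = Σᵇ n (λ e → Σᵇ n (k e))
    flip : S h₁₀ ≡ S h₀₁
    flip = trans (Σᵇ-comm n n h₁₀) (Σᵇ-cong n λ u → Σᵇ-cong n λ e → sy (true ∷ e) (false ∷ u))

  -- The term of the expansion of (A + B + C)^(2^n - 1) choosing B at the digits of e and C at those of u.
  pick : K → K → K → Bool → Bool → K
  pick A B C false false = A
  pick A B C true false = B
  pick A B C false true = C
  -- A digit cannot go to both B and C; the value 0 lets the sum run over all pairs.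
  pick A B C true true = 0#

  term : ∀ {n} → K → K → K → Bits n → Bits n → K
  term A B C [] [] = 1#
  term A B C (b ∷ e) (c ∷ u) = pick A B C b c * term (A ^ 2) (B ^ 2) (C ^ 2) e u

  -- All n digits of 2^n - 1 are 1 and Frobenius powers are additive, so the power is a product of n
  -- conjugate trinomials.
  trinomial : ∀ n A B C → (A + B + C) ^ pred (2 ℕ.^ n) ≡ Σᵇ n (λ e → Σᵇ n (term A B C e))
  trinomial zero A B C = refl
  trinomial (suc n) A B C = begin
    (A + B + C) ^ pred (2 ℕ.^ suc n) ≡⟨ cong ((A + B + C) ^_) exponent ⟩
    (A + B + C) * (A + B + C) ^ (2 ℕ.* m) ≡⟨ cong ((A + B + C) *_) (trans (sym (^-assocʳ _ 2 m)) (cong (_^ m)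
        (trans (square-+ _ _) (cong (_+ C ^ 2) (square-+ _ _))))) ⟩
    (A + B + C) * (A ^ 2 + B ^ 2 + C ^ 2) ^ m ≡⟨ cong ((A + B + C) *_) (trinomial n (A ^ 2) (B ^ 2) (C ^ 2)) ⟩
    (A + B + C) * W ≡⟨ distrib A B C W ⟩
    (A * W + C * W) + B * W ≡⟨ cong₂ _+_ (trans (cong₂ _+_ (inner A) (inner C)) (sym (Σᵇ-+ n _ _)))
        (trans (inner B) (Σᵇ-cong n λ e → sym (trans (cong (Σᵇ n (λ u → B * T e u) +_) (Σᵇ-0 n λ u → zeroˡ (T e u))) (+-identityʳ _)))) ⟩
    Σᵇ (suc n) (λ e → Σᵇ (suc n) (term A B C e)) ∎
    where
    m = pred (2 ℕ.^ n)
    T = term {n} (A ^ 2) (B ^ 2) (C ^ 2)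
    W = Σᵇ n (λ e → Σᵇ n (T e))
    inner : ∀ D → D * W ≡ Σᵇ n (λ e → Σᵇ n (λ u → D * T e u))
    inner D = trans (Σᵇ-*ˡ n D _) (Σᵇ-cong n λ e → Σᵇ-*ˡ n D _)
    distrib : ∀ a b c w → (a + b + c) * w ≡ (a * w + c * w) + b * w
    distrib = solveF 4 (λ a b c w → (a ⊕ b ⊕ c) ⊗ w ⊜ (a ⊗ w ⊕ c ⊗ w) ⊕ b ⊗ w) refl
    exponent : pred (2 ℕ.^ suc n) ≡ suc (2 ℕ.* m)
    exponent = trans (cong (λ x → pred (2 ℕ.* x)) (sym (ℕₚ.suc-pred (2 ℕ.^ n) {{ℕₚ.m^n≢0 2 n}}))) (cong pred (ℕₚ.*-suc 2 m))

  term-disjoint : ∀ {n} A B C (e u : Bits n) → Disjoint e u → term A B C e u ≡ A ^ val (rest e u) * (B ^ val e * C ^ val u)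
  term-disjoint A B C [] [] _ = sym (trans (*-identityˡ _) (*-identityˡ _))
  term-disjoint A B C (b ∷ e) (c ∷ u) disj = trans (cong (pick A B C b c *_) (trans (term-disjoint _ _ _ e u (disj ∘ suc))
      (cong₂ _*_ (^-assocʳ A 2 (val (rest e u))) (cong₂ _*_ (^-assocʳ B 2 (val e)) (^-assocʳ C 2 (val u)))))) (go b c (disj 0))
    where
    split : ∀ D k n → D ^ (bit k ℕ.+ 2 ℕ.* n) ≡ D ^ bit k * D ^ (2 ℕ.* n)
    split D k n = ^-homo-* D (bit k) (2 ℕ.* n)
    X = A ^ (2 ℕ.* val (rest e u))
    Y = B ^ (2 ℕ.* val e)
    Z = C ^ (2 ℕ.* val u)
    go : ∀ b c → bit b ℕ.+ bit c ℕ.≤ 1 → pick A B C b c * (X * (Y * Z)) ≡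
      A ^ (bit (neither b c) ℕ.+ 2 ℕ.* val (rest e u)) * (B ^ (bit b ℕ.+ 2 ℕ.* val e) * C ^ (bit c ℕ.+ 2 ℕ.* val u))
    go false false _ = solveF 4 (λ a x y z → a ⊗ (x ⊗ (y ⊗ z)) ⊜ (a ⊗ x) ⊗ (y ⊗ z)) refl A X Y Z
    go true false _ = solveF 4 (λ a x y z → a ⊗ (x ⊗ (y ⊗ z)) ⊜ x ⊗ ((a ⊗ y) ⊗ z)) refl B X Y Z
    go false true _ = solveF 4 (λ a x y z → a ⊗ (x ⊗ (y ⊗ z)) ⊜ x ⊗ (y ⊗ (a ⊗ z))) refl C X Y Z
    go true true (s≤s ())

  term-cases : ∀ {n} (e u : Bits n) → Disjoint e u ⊎ (∀ A B C → term A B C e u ≡ 0#)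
  term-cases [] [] = inj₁ λ _ → z≤n
  term-cases (b ∷ e) (c ∷ u) with term-cases e u
  ... | inj₂ zeros = inj₂ λ A B C → trans (cong (pick A B C b c *_) (zeros _ _ _)) (zeroʳ _)
  term-cases (true ∷ e) (true ∷ u) | inj₁ _ = inj₂ λ A B C → zeroˡ _
  term-cases (false ∷ e) (c ∷ u) | inj₁ disj = inj₁ λ { zero → bit≤1 c ; (suc p) → disj p }
  term-cases (true ∷ e) (false ∷ u) | inj₁ disj = inj₁ λ { zero → s≤s z≤n ; (suc p) → disj p }

  ^-rotate : ∀ x (e : Bits r) → x ^ (val e ℕ.+ q-1 ℕ.* digit e 0) ≡ x ^ val e
  ^-rotate x e with digit-0 e
  ... | inj₁ eq = cong (x ^_) (trans (cong (λ d → val e ℕ.+ q-1 ℕ.* d) eq) (trans (cong (val e ℕ.+_) (ℕₚ.*-zeroʳ q-1)) (ℕₚ.+-identityʳ (val e))))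
  ... | inj₂ (eq , 0<e) = trans (cong (x ^_) (trans (cong (λ d → val e ℕ.+ q-1 ℕ.* d) eq) (cong (val e ℕ.+_) (ℕₚ.*-identityʳ q-1))))
    (^-wrap x 0<e)

  -- Multiplying the exponent by 2^i undoes i rotations modulo q - 1. At the base 0 exponents may be
  -- reduced only while positive, which `^-rotate` secures.
  ^-rotates : ∀ i x (e : Bits r) → x ^ (2 ℕ.^ i ℕ.* val (rotates i e)) ≡ x ^ val e
  ^-rotates zero x e = cong (x ^_) (ℕₚ.+-identityʳ (val e))
  ^-rotates (suc i) x e = begin
    x ^ (2 ℕ.* 2 ℕ.^ i ℕ.* val (rotates i (rotate e))) ≡⟨ cong (x ^_) (ℕₚ.*-assoc 2 (2 ℕ.^ i) (val (rotates i (rotate e)))) ⟩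
    x ^ (2 ℕ.* (2 ℕ.^ i ℕ.* val (rotates i (rotate e)))) ≡⟨ ^-assocʳ x 2 (2 ℕ.^ i ℕ.* val (rotates i (rotate e))) ⟨
    (x ^ 2) ^ (2 ℕ.^ i ℕ.* val (rotates i (rotate e))) ≡⟨ ^-rotates i (x ^ 2) (rotate e) ⟩
    (x ^ 2) ^ val (rotate e) ≡⟨ ^-assocʳ x 2 (val (rotate e)) ⟩
    x ^ (2 ℕ.* val (rotate e)) ≡⟨ cong (x ^_) (val-rotate e) ⟩
    x ^ (val e ℕ.+ q-1 ℕ.* digit e 0) ≡⟨ ^-rotate x e ⟩
    x ^ val e ∎

-- A missed value could be punched out, leaving an injection into a smaller set.
injective⇒surjective : ∀ {n} (f : Fin n → Fin n) → (∀ {x y} → f x ≡ f y → x ≡ y) → ∀ y → ∃ λ x → f x ≡ y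
injective⇒surjective {suc n} f inj y with Finₚ.any? (λ x → f x Finₚ.≟ y)
... | yes found = found
... | no none = contradiction (Finₚ.injective⇒≤ {f = λ x → Fin.punchOut (ne x)} λ {x} {x′} eq → inj (Finₚ.punchOut-injective (ne x) (ne x′) eq)) ℕₚ.1+n≰n
  where
  ne : ∀ x → y ≢ f x
  ne x eq = none (x , sym eq)

-- Binary weight two.

module WeightTwo {r : ℕ} (F : Field (2 ℕ.^ r)) (1≤r : 1 ℕ.≤ r) where
  open FieldTheory F 1≤r
  open Trace F 1≤r
  open BitVectors
  open BitSums F 1≤r
  open ≡-Reasoning

  module _ (v i t′ : ℕ) (1≤i : 1 ℕ.≤ i) (i<r : i ℕ.< r) (0<t′ : 0 ℕ.< t′) (t′<q-1 : t′ ℕ.< q-1)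
           (t≡ : 2 ℕ.^ v ℕ.+ 2 ℕ.^ (v ℕ.+ i) ≡ 2 ℕ.+ t′) (a : K)
           (nonvanishing : ∀ b c → b ≢ 0# → c ≢ 0# → a * (φ (v ℕ.+ i) b * φ v c + φ v b * φ (v ℕ.+ i) c) + b * c ≢ 0#) where
    B : K → K → K
    B b c = a * (φ (v ℕ.+ i) b * φ v c + φ v b * φ (v ℕ.+ i) c) + b * c

    B-+ : ∀ b b′ c → B (b + b′) c ≡ B b c + B b′ c
    B-+ b b′ c = trans (cong₂ (λ x y → a * (x * φ v c + y * φ (v ℕ.+ i) c) + (b + b′) * c) (φ-+ (v ℕ.+ i) b b′) (φ-+ v b b′))
      (lemma a (φ (v ℕ.+ i) b) (φ (v ℕ.+ i) b′) (φ v b) (φ v b′) (φ v c) (φ (v ℕ.+ i) c) b b′ c)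
      where
      lemma : ∀ a x x′ y y′ u w b b′ c → a * ((x + x′) * u + (y + y′) * w) + (b + b′) * c ≡ (a * (x * u + y * w) + b * c) + (a * (x′ * u + y′ * w) + b′ * c)
      lemma = solveF 10 (λ a x x′ y y′ u w b b′ c → a ⊗ ((x ⊕ x′) ⊗ u ⊕ (y ⊕ y′) ⊗ w) ⊕ (b ⊕ b′) ⊗ c ⊜ (a ⊗ (x ⊗ u ⊕ y ⊗ w) ⊕ b ⊗ c) ⊕ (a ⊗ (x′ ⊗ u ⊕ y′ ⊗ w) ⊕ b′ ⊗ c)) refl

    additive-surjective : (f : K → K) → (∀ x y → f (x + y) ≡ f x + f y) → (∀ x → x ≢ 0# → f x ≢ 0#) → ∀ y → ∃ λ x → f x ≡ y
    additive-surjective f f-+ f≢0 = injective⇒surjective f λ {x} {y} eq → inj x y eq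
      where
      inj : ∀ x y → f x ≡ f y → x ≡ y
      inj x y eq with x + y ≟ 0#
      ... | yes x+y≡0 = x+y≡0⇒x≡y x+y≡0
      ... | no x+y≢0 = contradiction (trans (f-+ x y) (trans (cong (_+ f y) eq) (x+x≡0 (f y)))) (f≢0 (x + y) x+y≢0)

    φ≢0 : ∀ s x → x ≢ 0# → φ s x ≢ 0#
    φ≢0 s x = ^-nonzero (2 ℕ.^ s)

    -- The adjoint of B(·, c) with respect to the trace form, up to an automorphism.
    Λ : K → K → K
    Λ w X = φ (v ℕ.+ i) w * φ i X + φ i (a * w) * φ (i ℕ.+ i) X + (a * w) * X

    -- The trace is invariant under Frobenius, so each of the three terms can be twisted until b
    -- occurs in it as `φ (v ℕ.+ i) b`.
    Tr-B : ∀ w b c → Tr (w * B b c) ≡ Tr (φ (v ℕ.+ i) b * Λ w (φ v c))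
    Tr-B w b c = begin
      Tr (w * B b c) ≡⟨ cong Tr (expand₁ w a (φ s b) (φ v c) (φ v b) (φ s c) b c) ⟩
      Tr (P₁ + P₂ + P₃) ≡⟨ trans (Tr-+ _ _) (cong (_+ Tr P₃) (Tr-+ _ _)) ⟩
      Tr P₁ + Tr P₂ + Tr P₃ ≡⟨ cong₂ (λ x y → Tr P₁ + x + y) (sym (Tr-φ i P₂)) (sym (Tr-φ s P₃)) ⟩
      Tr P₁ + Tr (φ i P₂) + Tr (φ s P₃) ≡⟨ cong₂ (λ x y → Tr P₁ + Tr x + Tr y) P₂≡ P₃≡ ⟩
      Tr P₁ + Tr (φ i (a * w) * (φ s b * φ (i ℕ.+ i) X)) + Tr (φ s w * (φ s b * φ i X)) ≡⟨ trans (cong (_+ Tr Q₃) (sym (Tr-+ P₁ Q₂))) (sym (Tr-+ (P₁ + Q₂) Q₃)) ⟩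
      Tr (P₁ + Q₂ + Q₃) ≡⟨ cong Tr (expand₂ (a * w) (φ s b) X (φ i (a * w)) (φ (i ℕ.+ i) X) (φ s w) (φ i X)) ⟩
      Tr (φ s b * Λ w X) ∎
      where
      s = v ℕ.+ i
      X = φ v c
      P₁ P₂ P₃ Q₂ Q₃ : K
      P₁ = (a * w) * (φ s b * X)
      P₂ = (a * w) * (φ v b * φ s c)
      P₃ = w * (b * c)
      Q₂ = φ i (a * w) * (φ s b * φ (i ℕ.+ i) X)
      Q₃ = φ s w * (φ s b * φ i X)
      expand₁ : ∀ w a x u y z b c → w * (a * (x * u + y * z) + b * c) ≡ (a * w) * (x * u) + (a * w) * (y * z) + w * (b * c)
      expand₁ = solveF 8 (λ w a x u y z b c → w ⊗ (a ⊗ (x ⊗ u ⊕ y ⊗ z) ⊕ b ⊗ c) ⊜ (a ⊗ w) ⊗ (x ⊗ u) ⊕ (a ⊗ w) ⊗ (y ⊗ z) ⊕ w ⊗ (b ⊗ c)) refl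
      expand₂ : ∀ d β X e Y f Z → d * (β * X) + e * (β * Y) + f * (β * Z) ≡ β * (f * Z + e * Y + d * X)
      expand₂ = solveF 7 (λ d β X e Y f Z → d ⊗ (β ⊗ X) ⊕ e ⊗ (β ⊗ Y) ⊕ f ⊗ (β ⊗ Z) ⊜ β ⊗ (f ⊗ Z ⊕ e ⊗ Y ⊕ d ⊗ X)) refl
      φsc : φ i (φ s c) ≡ φ (i ℕ.+ i) X
      φsc = trans (φ-φ i s c) (trans (cong (λ n → φ n c) (ℕₚ.+-assoc v i i)) (sym (φ-φ (i ℕ.+ i) v c)))
      P₂≡ : φ i P₂ ≡ Q₂
      P₂≡ = trans (φ-* i (a * w) _) (cong (φ i (a * w) *_) (trans (φ-* i (φ v b) (φ s c)) (cong₂ _*_ (φ-φ i v b) φsc)))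
      P₃≡ : φ s P₃ ≡ Q₃
      P₃≡ = trans (φ-* s w (b * c)) (cong (φ s w *_) (trans (φ-* s b c) (cong (φ s b *_) (sym (φ-φ i v c)))))

    -- If Λ w X were 0, every w B(b, c) would have trace 0; but b ↦ B(b, c) is additive and
    -- injective, hence onto, and some element has trace 1.
    Λ≢0 : ∀ w X → w ≢ 0# → X ≢ 0# → Λ w X ≢ 0#
    Λ≢0 w X w≢0 X≢0 Λ≡0 with additive-surjective (φ v) (φ-+ v) (φ≢0 v) X
    ... | c , refl = let
        c≢0 : c ≢ 0#
        c≢0 c≡0 = X≢0 (trans (cong (φ v) c≡0) (φ-0# v))
        (w⁻¹ , ww⁻¹) = inverse w w≢0
        (y , Try≡1) = ∃-Tr≡1
        (b , Bb≡) = additive-surjective (λ b → B b c) (λ b b′ → B-+ b b′ c) (λ b b≢0 → nonvanishing b c b≢0 c≢0) (w⁻¹ * y)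
      in 0≢1 (begin
        0# ≡⟨ Tr-0# ⟨
        Tr 0# ≡⟨ cong Tr (trans (cong (φ (v ℕ.+ i) b *_) Λ≡0) (zeroʳ _)) ⟨
        Tr (φ (v ℕ.+ i) b * Λ w X) ≡⟨ Tr-B w b c ⟨
        Tr (w * B b c) ≡⟨ cong (λ x → Tr (w * x)) Bb≡ ⟩
        Tr (w * (w⁻¹ * y)) ≡⟨ cong Tr (trans (sym (*-assoc w w⁻¹ y)) (trans (cong (_* y) ww⁻¹) (*-identityˡ y))) ⟩
        Tr y ≡⟨ Try≡1 ⟩
        1# ∎)

    -- The summands of Λ after an inverse Frobenius power, chosen so that X is untwisted in `A₀` and
    -- the other two twists are rotations by i in opposite directions.
    A₀ B₀ C₀ : K → K → K
    A₀ w X = φ v w * X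
    B₀ w X = (a * w) * φ i X
    C₀ w X = φ (r ℕ.∸ i) ((a * w) * X)

    back : ∀ s x → φ (r ℕ.∸ i) (φ (s ℕ.+ i) x) ≡ φ s x
    back s x = trans (φ-φ (r ℕ.∸ i) (s ℕ.+ i) x) (trans (cong (λ n → φ n x) (trans (ℕₚ.+-assoc s i (r ℕ.∸ i)) (trans (cong (s ℕ.+_) (ℕₚ.m+[n∸m]≡n (ℕₚ.<⇒≤ i<r))) (ℕₚ.+-comm s r))))
      (trans (sym (φ-φ s r x)) (cong (φ s) (φ-r x))))

    back-Λ : ∀ w X → φ (r ℕ.∸ i) (Λ w X) ≡ A₀ w X + B₀ w X + C₀ w X
    back-Λ w X = begin
      φ r-i (φ (v ℕ.+ i) w * φ i X + φ i (a * w) * φ (i ℕ.+ i) X + (a * w) * X) ≡⟨ trans (φ-+ r-i _ _) (cong (_+ C₀ w X) (φ-+ r-i _ _)) ⟩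
      φ r-i (φ (v ℕ.+ i) w * φ i X) + φ r-i (φ i (a * w) * φ (i ℕ.+ i) X) + C₀ w X ≡⟨ cong (_+ C₀ w X) (cong₂ _+_
        (trans (φ-* r-i _ _) (cong₂ _*_ (back v w) (trans (back 0 X) (φ-0 X))))
        (trans (φ-* r-i _ _) (cong₂ _*_ (trans (back 0 (a * w)) (φ-0 (a * w))) (back i X)))) ⟩
      A₀ w X + B₀ w X + C₀ w X ∎
      where r-i = r ℕ.∸ i

    -- A power with exponent q - 1 indicates a nonzero base. For w ≠ 0 the trinomial vanishes only
    -- together with X; for w = 0 the factor w^t′ vanishes.
    ^-q-1-indicator : ∀ w X → w ^ t′ * (A₀ w X + B₀ w X + C₀ w X) ^ q-1 ≡ w ^ t′ * X ^ q-1
    ^-q-1-indicator w X with w ≟ 0# | X ≟ 0#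
    ... | yes refl | _ = trans (trans (cong (_* _) (0^ 0<t′)) (zeroˡ _)) (sym (trans (cong (_* X ^ q-1) (0^ 0<t′)) (zeroˡ _)))
    ... | no w≢0 | no X≢0 = cong (w ^ t′ *_) (trans (^q-1 (λ eq → φ≢0 (r ℕ.∸ i) (Λ w X) (Λ≢0 w X w≢0 X≢0) (trans (back-Λ w X) eq))) (sym (^q-1 X≢0)))
    ... | no w≢0 | yes refl = cong (λ x → w ^ t′ * x ^ q-1) (trans (cong₂ _+_ (trans (cong₂ _+_ (zeroʳ _) (trans (cong ((a * w) *_) (φ-0# i)) (zeroʳ _))) (+-identityʳ 0#))
          (trans (cong (φ (r ℕ.∸ i)) (zeroʳ _)) (φ-0# (r ℕ.∸ i)))) (+-identityʳ 0#))

    σ : Bits r → Bits r → K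
    σ e u = ∑ (λ w → ∑ (λ X → w ^ t′ * term (A₀ w X) (B₀ w X) (C₀ w X) e u))

    ∑-cong : ∀ {f g : K → K} → (∀ x → f x ≡ g x) → ∑ f ≡ ∑ g
    ∑-cong = sum-cong-≗

    ∑²-cong : ∀ {f g : K → K → K} → (∀ w X → f w X ≡ g w X) → ∑ (λ w → ∑ (f w)) ≡ ∑ (λ w → ∑ (g w))
    ∑²-cong eq = ∑-cong λ w → ∑-cong (eq w)

    ∑²-Σᵇ : ∀ n (h : K → K → Bits n → K) → ∑ (λ w → ∑ (λ X → Σᵇ n (h w X))) ≡ Σᵇ n (λ e → ∑ (λ w → ∑ (λ X → h w X e)))
    ∑²-Σᵇ n h = trans (∑-cong λ w → ∑-Σᵇ n (h w)) (∑-Σᵇ n (λ w e → ∑ (λ X → h w X e)))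

    t′∤ : ¬ (q-1 ∣ t′)
    t′∤ d = ℕₚ.<⇒≱ t′<q-1 (∣.∣⇒≤ {{ℕ.>-nonZero 0<t′}} d)

    σ-total : Σᵇ r (λ e → Σᵇ r (σ e)) ≡ 0#
    σ-total = begin
      Σᵇ r (λ e → Σᵇ r (σ e)) ≡⟨ Σᵇ-cong r (λ e → ∑²-Σᵇ r (λ w X u → T w X e u)) ⟨
      Σᵇ r (λ e → ∑ (λ w → ∑ (λ X → Σᵇ r (λ u → T w X e u)))) ≡⟨ ∑²-Σᵇ r (λ w X e → Σᵇ r (T w X e)) ⟨
      ∑ (λ w → ∑ (λ X → Σᵇ r (λ e → Σᵇ r (λ u → T w X e u)))) ≡⟨ ∑²-cong (λ w X → trans (cong (w ^ t′ *_) (trinomial r (A₀ w X) (B₀ w X) (C₀ w X)))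
          (trans (Σᵇ-*ˡ r (w ^ t′) _) (Σᵇ-cong r λ e → Σᵇ-*ˡ r (w ^ t′) _))) ⟨
      ∑ (λ w → ∑ (λ X → w ^ t′ * (A₀ w X + B₀ w X + C₀ w X) ^ q-1)) ≡⟨ ∑²-cong ^-q-1-indicator ⟩
      ∑ (λ w → ∑ (λ X → w ^ t′ * X ^ q-1)) ≡⟨ ∑-cong (λ w → trans (∑-*ˡ (w ^ t′) (_^ q-1)) (*-comm (w ^ t′) (∑ (_^ q-1)))) ⟩
      ∑ (λ w → ∑ (_^ q-1) * w ^ t′) ≡⟨ ∑-*ˡ (∑ (_^ q-1)) (_^ t′) ⟩
      ∑ (_^ q-1) * ∑ (_^ t′) ≡⟨ trans (cong (∑ (_^ q-1) *_) (sum-pow-∤ t′ t′∤)) (zeroʳ _) ⟩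
      0# ∎
      where
      T : K → K → Bits r → Bits r → K
      T w X e u = w ^ t′ * term (A₀ w X) (B₀ w X) (C₀ w X) e u

    monomial : ℕ → ℕ → ℕ → K
    monomial k M N = a ^ k * (∑ (_^ M) * ∑ (_^ N))

    ρ : Bits r → Bits r
    ρ = rotates i

    -- Exponents of w and X in the term indexed by (ρ f, g). Writing the first index as a rotation
    -- makes `B₀` contribute `val f` and `C₀` contribute `val (ρ g)` to the exponent of X, which
    -- prepares the exchange of f and g.
    wExp XExp : Bits r → Bits r → ℕ
    wExp f g = t′ ℕ.+ 2 ℕ.^ v ℕ.* val (rest (ρ f) g) ℕ.+ (val (ρ f) ℕ.+ val (ρ g))
    XExp f g = val (rest (ρ f) g) ℕ.+ val f ℕ.+ val (ρ g)

    σ-disjoint : ∀ f g → Disjoint (ρ f) g → σ (ρ f) g ≡ monomial (val (ρ f) ℕ.+ val (ρ g)) (wExp f g) (XExp f g)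
    σ-disjoint f g disj = begin
      σ (ρ f) g ≡⟨ ∑²-cong (λ w X → trans (cong (w ^ t′ *_) (term-disjoint _ _ _ (ρ f) g disj)) (pointwise w X)) ⟩
      ∑ (λ w → ∑ (λ X → c * (w ^ M * X ^ N))) ≡⟨ ∑-cong (λ w → trans (∑-*ˡ c (λ X → w ^ M * X ^ N)) (cong (c *_) (trans (∑-*ˡ (w ^ M) (_^ N)) (*-comm (w ^ M) (∑ (_^ N)))))) ⟩
      ∑ (λ w → c * (∑ (_^ N) * w ^ M)) ≡⟨ trans (∑-*ˡ c (λ w → ∑ (_^ N) * w ^ M)) (cong (c *_) (trans (∑-*ˡ (∑ (_^ N)) (_^ M)) (*-comm (∑ (_^ N)) (∑ (_^ M))))) ⟩
      monomial (val (ρ f) ℕ.+ val (ρ g)) M N ∎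
      where
      M = wExp f g
      N = XExp f g
      n = val (rest (ρ f) g)
      E₁ = val (ρ f)
      E₂ = val (ρ g)
      c = a ^ (E₁ ℕ.+ E₂)
      A≡ : ∀ w X → A₀ w X ^ n ≡ w ^ (2 ℕ.^ v ℕ.* n) * X ^ n
      A≡ w X = trans (^-distrib-* (φ v w) X n) (cong (_* X ^ n) (^-assocʳ w (2 ℕ.^ v) n))
      B≡ : ∀ w X → B₀ w X ^ E₁ ≡ (a ^ E₁ * w ^ E₁) * X ^ val f
      B≡ w X = trans (^-distrib-* (a * w) (φ i X) E₁) (cong₂ _*_ (^-distrib-* a w E₁) (trans (^-assocʳ X (2 ℕ.^ i) E₁) (^-rotates i X f)))
      C≡ : ∀ w X → C₀ w X ^ val g ≡ (a ^ E₂ * w ^ E₂) * X ^ E₂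
      C≡ w X = begin
        C₀ w X ^ val g ≡⟨ ^-rotates i (C₀ w X) g ⟨
        C₀ w X ^ (2 ℕ.^ i ℕ.* E₂) ≡⟨ ^-assocʳ (C₀ w X) (2 ℕ.^ i) E₂ ⟨
        φ i (C₀ w X) ^ E₂ ≡⟨ cong (_^ E₂) (trans (φ-φ i (r ℕ.∸ i) _) (trans (cong (λ n → φ n ((a * w) * X)) (ℕₚ.m∸n+n≡m (ℕₚ.<⇒≤ i<r))) (φ-r _))) ⟩
        ((a * w) * X) ^ E₂ ≡⟨ trans (^-distrib-* (a * w) X E₂) (cong (_* X ^ E₂) (^-distrib-* a w E₂)) ⟩
        (a ^ E₂ * w ^ E₂) * X ^ E₂ ∎
      regroup : ∀ p q x α β y γ δ z → p * ((q * x) * (((α * β) * y) * ((γ * δ) * z))) ≡ (α * γ) * (((p * q) * (β * δ)) * ((x * y) * z))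
      regroup = solveF 9 (λ p q x α β y γ δ z → p ⊗ ((q ⊗ x) ⊗ (((α ⊗ β) ⊗ y) ⊗ ((γ ⊗ δ) ⊗ z))) ⊜ (α ⊗ γ) ⊗ (((p ⊗ q) ⊗ (β ⊗ δ)) ⊗ ((x ⊗ y) ⊗ z))) refl
      pointwise : ∀ w X → w ^ t′ * (A₀ w X ^ n * (B₀ w X ^ E₁ * C₀ w X ^ val g)) ≡ c * (w ^ M * X ^ N)
      pointwise w X = begin
        w ^ t′ * (A₀ w X ^ n * (B₀ w X ^ E₁ * C₀ w X ^ val g)) ≡⟨ cong (w ^ t′ *_) (cong₂ _*_ (A≡ w X) (cong₂ _*_ (B≡ w X) (C≡ w X))) ⟩
        w ^ t′ * ((w ^ (2 ℕ.^ v ℕ.* n) * X ^ n) * (((a ^ E₁ * w ^ E₁) * X ^ val f) * ((a ^ E₂ * w ^ E₂) * X ^ E₂)))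
          ≡⟨ regroup (w ^ t′) (w ^ (2 ℕ.^ v ℕ.* n)) (X ^ n) (a ^ E₁) (w ^ E₁) (X ^ val f) (a ^ E₂) (w ^ E₂) (X ^ E₂) ⟩
        (a ^ E₁ * a ^ E₂) * (((w ^ t′ * w ^ (2 ℕ.^ v ℕ.* n)) * (w ^ E₁ * w ^ E₂)) * ((X ^ n * X ^ val f) * X ^ E₂))
          ≡⟨ cong₂ _*_ (^-homo-* a E₁ E₂) (cong₂ _*_
               (trans (^-homo-* w (t′ ℕ.+ 2 ℕ.^ v ℕ.* n) (E₁ ℕ.+ E₂)) (cong₂ _*_ (^-homo-* w t′ (2 ℕ.^ v ℕ.* n)) (^-homo-* w E₁ E₂)))
               (trans (^-homo-* X (n ℕ.+ val f) E₂) (cong (_* X ^ E₂) (^-homo-* X n (val f))))) ⟨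
        c * (w ^ M * X ^ N) ∎

    ∑^0 : ∀ {N} → N ≡ 0 → ∑ (_^ N) ≡ 0#
    ∑^0 refl = sum-const 1#

    ∑^≢0 : ∀ N → ∑ (_^ N) ≢ 0# → ∃ λ k → N ≡ suc k ℕ.* q-1
    ∑^≢0 N ne with q-1 ∣.∣? N
    ... | no q-1∤N = contradiction (sum-pow-∤ N q-1∤N) ne
    ... | yes (divides zero eq) = contradiction (∑^0 eq) ne
    ... | yes (divides (suc k) eq) = k , eq

    -- The exponent is a positive multiple of q - 1, and its three summands have r ones in total
    -- because rotation preserves the count. The carry argument forces q - 1 itself with exactly one
    -- 1 at each position, so f and ρ g are disjoint too.
    XExp-match : ∀ f g → Disjoint (ρ f) g → ∑ (_^ XExp f g) ≢ 0# → Disjoint (ρ g) f × XExp f g ≡ q-1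
    XExp-match f g disj ne with ∑^≢0 (XExp f g) ne
    ... | k , eq = disj′ , trans eq (trans (cong (ℕ._* q-1) (proj₁ matched)) (ℕₚ.*-identityˡ q-1))
      where
      x = rest (ρ f) g
      d : ℕ → ℕ
      d p = digit x p ℕ.+ digit f p ℕ.+ digit (ρ g) p
      num≡ : Digits.num r d ≡ XExp f g
      num≡ = trans (Digits.num-+ r (λ p → digit x p ℕ.+ digit f p) (digit (ρ g))) (cong₂ ℕ._+_
        (trans (Digits.num-+ r (digit x) (digit f)) (cong₂ ℕ._+_ (sym (val-num x)) (sym (val-num f)))) (sym (val-num (ρ g))))
      sum≡ : sumDigits r d ≡ r
      sum≡ = begin
        sumDigits r d ≡⟨ trans (sumDigits-+ r (λ p → digit x p ℕ.+ digit f p) (digit (ρ g))) (cong (ℕ._+ sumDigits r (digit (ρ g))) (sumDigits-+ r (digit x) (digit f))) ⟩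
        sumDigits r (digit x) ℕ.+ sumDigits r (digit f) ℕ.+ sumDigits r (digit (ρ g))
          ≡⟨ cong₂ ℕ._+_ (cong₂ ℕ._+_ (count-sumDigits x) (count-sumDigits f)) (count-sumDigits (ρ g)) ⟨
        count x ℕ.+ count f ℕ.+ count (ρ g) ≡⟨ cong₂ (λ m n → count x ℕ.+ m ℕ.+ n) (sym (count-rotates i f)) (count-rotates i g) ⟩
        count x ℕ.+ count (ρ f) ℕ.+ count g ≡⟨ rest-count (ρ f) g disj ⟩
        r ∎
      matched : suc k ≡ 1 × (∀ {p} → p ℕ.< r → d p ≡ 1)
      matched = carry-≡⁺ {r} {d} (suc k) 1≤r (s≤s z≤n) (begin
        Digits.num r d ℕ.+ suc k ≡⟨ cong (ℕ._+ suc k) (trans num≡ eq) ⟩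
        suc k ℕ.* q-1 ℕ.+ suc k ≡⟨ trans (ℕₚ.+-comm _ (suc k)) (trans (sym (ℕₚ.*-suc (suc k) q-1)) (ℕₚ.*-comm (suc k) (suc q-1))) ⟩
        suc q-1 ℕ.* suc k ≡⟨ cong (ℕ._* suc k) q≡ ⟨
        2 ℕ.^ r ℕ.* suc k ∎) sum≡
      disj′ : Disjoint (ρ g) f
      disj′ p with ℕₚ.<-≤-connex p r
      ... | inj₁ p<r = ℕₚ.≤-trans (ℕₚ.≤-trans (ℕₚ.m≤n+m _ (digit x p)) (ℕₚ.≤-reflexive (lemma (digit (ρ g) p) (digit f p) (digit x p)))) (ℕₚ.≤-reflexive (proj₂ matched p<r))
        where
        lemma : ∀ g f x → x ℕ.+ (g ℕ.+ f) ≡ x ℕ.+ f ℕ.+ g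
        lemma = solveℕ
      ... | inj₂ r≤p = ℕₚ.≤-trans (ℕₚ.≤-reflexive (cong₂ ℕ._+_ (digit-end (ρ g) p r≤p) (digit-end f p r≤p))) z≤n

    monomial≢0 : ∀ {k M N} → monomial k M N ≢ 0# → ∑ (_^ M) ≢ 0# × ∑ (_^ N) ≢ 0#
    monomial≢0 {k} {M} {N} ne = (λ eq → ne (trans (cong (a ^ k *_) (trans (cong (_* ∑ (_^ N)) eq) (zeroˡ _))) (zeroʳ _)))
                              , (λ eq → ne (trans (cong (a ^ k *_) (trans (cong (∑ (_^ M) *_) eq) (zeroʳ _))) (zeroʳ _)))

    record Matching (f g : Bits r) : Set where
      field
        disjoint : Disjoint (ρ f) g
        disjoint′ : Disjoint (ρ g) f
        XExp≡ : XExp f g ≡ q-1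
        ∑w≢0 : ∑ (_^ wExp f g) ≢ 0#

    σ≢0⇒matching : ∀ f g → σ (ρ f) g ≢ 0# → Matching f g
    σ≢0⇒matching f g ne with term-cases (ρ f) g
    ... | inj₂ zeros = contradiction (trans (∑²-cong λ w X → trans (cong (w ^ t′ *_) (zeros _ _ _)) (zeroʳ _)) (trans (∑-cong λ _ → sum-const 0#) (sum-const 0#))) ne
    ... | inj₁ disj = let
        (∑w≢0 , ∑X≢0) = monomial≢0 {val (ρ f) ℕ.+ val (ρ g)} {wExp f g} {XExp f g} (λ eq → ne (trans (σ-disjoint f g disj) eq))
        (disj′ , XExp≡) = XExp-match f g disj ∑X≢0
      in record { disjoint = disj ; disjoint′ = disj′ ; XExp≡ = XExp≡ ; ∑w≢0 = ∑w≢0 }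

    rest-val-ρ : ∀ f g → Disjoint (ρ f) g → val (rest (ρ f) g) ℕ.+ val (ρ f) ℕ.+ val g ≡ q-1
    rest-val-ρ f g disj = ℕₚ.suc-injective (trans (rest-val (ρ f) g disj) q≡)

    -- The complements for (ρ f, g) and (ρ g, f) have the same value, since both complete val f +
    -- val (ρ g) to q - 1.
    matching⇒symmetric : ∀ f g → Matching f g → σ (ρ f) g ≡ σ (ρ g) f
    matching⇒symmetric f g m = begin
      σ (ρ f) g ≡⟨ σ-disjoint f g disjoint ⟩
      monomial (E₁ ℕ.+ E₂) (wExp f g) (XExp f g) ≡⟨ cong₂ (monomial (E₁ ℕ.+ E₂)) wExp≡ (trans XExp≡ (sym XExp′≡)) ⟩
      monomial (E₁ ℕ.+ E₂) (wExp g f) (XExp g f) ≡⟨ cong (λ k → monomial k (wExp g f) (XExp g f)) (ℕₚ.+-comm E₁ E₂) ⟩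
      monomial (E₂ ℕ.+ E₁) (wExp g f) (XExp g f) ≡⟨ σ-disjoint g f disjoint′ ⟨
      σ (ρ g) f ∎
      where
      open Matching m
      E₁ = val (ρ f)
      E₂ = val (ρ g)
      swap : ∀ a b c → a ℕ.+ b ℕ.+ c ≡ a ℕ.+ c ℕ.+ b
      swap = solveℕ
      rest≡ : val (rest (ρ f) g) ≡ val (rest (ρ g) f)
      rest≡ = ℕₚ.+-cancelʳ-≡ (val f) _ _ (ℕₚ.+-cancelʳ-≡ E₂ _ _ (trans XExp≡ (trans (sym (rest-val-ρ g f disjoint′)) (swap (val (rest (ρ g) f)) E₂ (val f)))))
      wExp≡ : wExp f g ≡ wExp g f
      wExp≡ = cong₂ (λ x y → t′ ℕ.+ 2 ℕ.^ v ℕ.* x ℕ.+ y) rest≡ (ℕₚ.+-comm E₁ E₂)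
      XExp′≡ : XExp g f ≡ q-1
      XExp′≡ = trans (cong (λ x → x ℕ.+ val g ℕ.+ E₁) (sym rest≡)) (trans (swap (val (rest (ρ f) g)) (val g) E₁) (rest-val-ρ f g disjoint))

    σ-symmetric : ∀ f g → σ (ρ f) g ≡ σ (ρ g) f
    σ-symmetric f g with σ (ρ f) g ≟ 0# | σ (ρ g) f ≟ 0#
    ... | no ne | _ = matching⇒symmetric f g (σ≢0⇒matching f g ne)
    ... | yes _ | no ne = sym (matching⇒symmetric g f (σ≢0⇒matching g f ne))
    ... | yes eq | yes eq′ = trans eq (sym eq′)

    -- The exponent of w is t′(1 - val (ρ f)) modulo q - 1: multiplying val (ρ f) by t = 2^v +
    -- 2^(v+i) completes 2^v times `XExp f f`. The term t′ val (ρ f) stands on the left to avoid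
    -- subtraction.
    diagonal-wExp : ∀ f → XExp f f ≡ q-1 → ∃ λ k → 2 ℕ.^ i ℕ.* val (ρ f) ≡ val f ℕ.+ q-1 ℕ.* k ×
      wExp f f ℕ.+ t′ ℕ.* val (ρ f) ≡ t′ ℕ.+ 2 ℕ.^ v ℕ.* suc k ℕ.* q-1
    diagonal-wExp f XExp≡ with val-rotates i f
    ... | k , eq = k , eq , (begin
      wExp f f ℕ.+ t′ ℕ.* E ≡⟨ lemma₁ t′ (2 ℕ.^ v) n E ⟩
      t′ ℕ.+ 2 ℕ.^ v ℕ.* n ℕ.+ (2 ℕ.+ t′) ℕ.* E ≡⟨ cong (λ x → t′ ℕ.+ 2 ℕ.^ v ℕ.* n ℕ.+ x ℕ.* E) (trans (sym t≡) (cong (2 ℕ.^ v ℕ.+_) (ℕₚ.^-distribˡ-+-* 2 v i))) ⟩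
      t′ ℕ.+ 2 ℕ.^ v ℕ.* n ℕ.+ (2 ℕ.^ v ℕ.+ 2 ℕ.^ v ℕ.* 2 ℕ.^ i) ℕ.* E ≡⟨ lemma₂ t′ (2 ℕ.^ v) n (2 ℕ.^ i) E ⟩
      t′ ℕ.+ 2 ℕ.^ v ℕ.* (n ℕ.+ E ℕ.+ 2 ℕ.^ i ℕ.* E) ≡⟨ cong (λ x → t′ ℕ.+ 2 ℕ.^ v ℕ.* (n ℕ.+ E ℕ.+ x)) eq ⟩
      t′ ℕ.+ 2 ℕ.^ v ℕ.* (n ℕ.+ E ℕ.+ (val f ℕ.+ q-1 ℕ.* k)) ≡⟨ lemma₃ t′ (2 ℕ.^ v) n E (val f) (q-1 ℕ.* k) ⟩
      t′ ℕ.+ 2 ℕ.^ v ℕ.* (XExp f f ℕ.+ q-1 ℕ.* k) ≡⟨ cong (λ x → t′ ℕ.+ 2 ℕ.^ v ℕ.* (x ℕ.+ q-1 ℕ.* k)) XExp≡ ⟩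
      t′ ℕ.+ 2 ℕ.^ v ℕ.* (q-1 ℕ.+ q-1 ℕ.* k) ≡⟨ lemma₄ t′ (2 ℕ.^ v) q-1 k ⟩
      t′ ℕ.+ 2 ℕ.^ v ℕ.* suc k ℕ.* q-1 ∎)
      where
      n = val (rest (ρ f) f)
      E = val (ρ f)
      lemma₁ : ∀ t u n e → t ℕ.+ u ℕ.* n ℕ.+ (e ℕ.+ e) ℕ.+ t ℕ.* e ≡ t ℕ.+ u ℕ.* n ℕ.+ (2 ℕ.+ t) ℕ.* e
      lemma₁ = solveℕ
      lemma₂ : ∀ t u n w e → t ℕ.+ u ℕ.* n ℕ.+ (u ℕ.+ u ℕ.* w) ℕ.* e ≡ t ℕ.+ u ℕ.* (n ℕ.+ e ℕ.+ w ℕ.* e)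
      lemma₂ = solveℕ
      lemma₃ : ∀ t u n e f k → t ℕ.+ u ℕ.* (n ℕ.+ e ℕ.+ (f ℕ.+ k)) ≡ t ℕ.+ u ℕ.* (n ℕ.+ f ℕ.+ e ℕ.+ k)
      lemma₃ = solveℕ
      lemma₄ : ∀ t u q k → t ℕ.+ u ℕ.* (q ℕ.+ q ℕ.* k) ≡ t ℕ.+ u ℕ.* suc k ℕ.* q
      lemma₄ = solveℕ

    module _ (ε l M : ℕ) (1≤ε : 1 ℕ.≤ ε) (t′≤2^ε : t′ ℕ.≤ 2 ℕ.^ ε) (v+l≡ : v ℕ.+ l ≡ suc (ε ℕ.+ i))
             (r≡ : r ≡ M ℕ.+ (v ℕ.+ i)) (room : ε ℕ.+ l ℕ.≤ M) where

      -- If t′E′ = j(q - 1) with j > 0, then t′(E′ + 1) = (t′ - j) + 2^r j with 0 < t′ - j < t′,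
      -- while disjointness of ρ f and f makes ρ f sparse at distance i.
      no-multiple : ∀ f E′ → Disjoint (ρ f) f → val (ρ f) ≡ suc E′ → q-1 ∣ t′ ℕ.* E′ → E′ ≡ 0
      no-multiple f E′ disj E≡ (divides zero eq) = [ (λ t′≡0 → contradiction (subst (0 ℕ.<_) t′≡0 0<t′) λ ()) , id ]′ (ℕₚ.m*n≡0⇒m≡0∨n≡0 t′ eq)
      no-multiple f E′ disj E≡ (divides j@(suc _) eq) = ⊥-elim (Digits.Sparse.impossible r i (digit (ρ f)) (digit≤1 (ρ f)) (digit-end (ρ f)) sparse
          v ε t′ j (t′ ℕ.∸ j) l M 1≤ε t′≤2^ε v+l≡ r≡ room t≡ (ℕₚ.m<n⇒0<n∸m j<t′) (ℕₚ.∸-monoʳ-< (s≤s z≤n) (ℕₚ.<⇒≤ j<t′)) t′S≡)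
        where
        sparse : ∀ p → digit (ρ f) p ℕ.+ digit (ρ f) (i ℕ.+ p) ℕ.≤ 1
        sparse p with ℕₚ.<-≤-connex (i ℕ.+ p) r
        ... | inj₁ i+p<r = subst (ℕ._≤ 1) (trans (ℕₚ.+-comm (digit (ρ f) (i ℕ.+ p)) _) (cong (ℕ._+ digit (ρ f) (i ℕ.+ p)) (sym (digit-rotates i f p i+p<r)))) (disj (i ℕ.+ p))
        ... | inj₂ r≤i+p = subst (λ x → digit (ρ f) p ℕ.+ x ℕ.≤ 1) (sym (digit-end (ρ f) (i ℕ.+ p) r≤i+p)) (subst (ℕ._≤ 1) (sym (ℕₚ.+-identityʳ _)) (digit≤1 (ρ f) p))
        E′<q-1 : E′ ℕ.< q-1
        E′<q-1 = ℕₚ.≤-pred (subst₂ ℕ._<_ E≡ q≡ (val< (ρ f)))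
        j<t′ : j ℕ.< t′
        j<t′ = ℕₚ.*-cancelʳ-< q-1 j t′ (subst (ℕ._< t′ ℕ.* q-1) eq (ℕₚ.*-monoʳ-< t′ {{ℕ.>-nonZero 0<t′}} E′<q-1))
        t′S≡ : t′ ℕ.* Digits.num r (digit (ρ f)) ≡ t′ ℕ.∸ j ℕ.+ 2 ℕ.^ r ℕ.* j
        t′S≡ = begin
          t′ ℕ.* Digits.num r (digit (ρ f)) ≡⟨ cong (t′ ℕ.*_) (trans (sym (val-num (ρ f))) E≡) ⟩
          t′ ℕ.* suc E′ ≡⟨ ℕₚ.*-suc t′ E′ ⟩
          t′ ℕ.+ t′ ℕ.* E′ ≡⟨ cong₂ ℕ._+_ (sym (ℕₚ.m∸n+n≡m (ℕₚ.<⇒≤ j<t′))) eq ⟩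
          t′ ℕ.∸ j ℕ.+ j ℕ.+ j ℕ.* q-1 ≡⟨ lemma (t′ ℕ.∸ j) j q-1 ⟩
          t′ ℕ.∸ j ℕ.+ suc q-1 ℕ.* j ≡⟨ cong (λ x → t′ ℕ.∸ j ℕ.+ x ℕ.* j) q≡ ⟨
          t′ ℕ.∸ j ℕ.+ 2 ℕ.^ r ℕ.* j ∎
          where
          lemma : ∀ e j q → e ℕ.+ j ℕ.+ j ℕ.* q ≡ e ℕ.+ suc q ℕ.* j
          lemma = solveℕ

      2^i<q-1 : 2 ℕ.^ i ℕ.< q-1
      2^i<q-1 = ℕₚ.≤-pred (ℕₚ.≤-trans (subst (ℕ._≤ 2 ℕ.^ i ℕ.+ 2 ℕ.^ i) (ℕₚ.+-comm (2 ℕ.^ i) 2) (ℕₚ.+-monoʳ-≤ (2 ℕ.^ i) (ℕₚ.^-monoʳ-≤ 2 1≤i)))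
        (subst₂ ℕ._≤_ (cong (2 ℕ.^ i ℕ.+_) (ℕₚ.+-identityʳ (2 ℕ.^ i))) q≡ (ℕₚ.^-monoʳ-≤ 2 i<r)))

      matching⇒unit : ∀ f → Matching f f → f ≡ unit r i
      matching⇒unit f m with diagonal-wExp f (Matching.XExp≡ m) | ∑^≢0 (wExp f f) (Matching.∑w≢0 m)
      ... | k , eq , w≡ | n , wExp≡ = go (val (ρ f)) refl
        where
        E : ℕ
        E = val (ρ f)
        w≡′ : suc n ℕ.* q-1 ℕ.+ t′ ℕ.* E ≡ t′ ℕ.+ 2 ℕ.^ v ℕ.* suc k ℕ.* q-1
        w≡′ = trans (cong (ℕ._+ t′ ℕ.* E) (sym wExp≡)) w≡
        go : ∀ E′ → E ≡ E′ → f ≡ unit r i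
        go zero E≡0 = contradiction (∣.∣m+n∣m⇒∣n (subst (q-1 ∣_) sum≡ (∣.n∣m*n (suc n))) (∣.n∣m*n (2 ℕ.^ v ℕ.* suc k))) t′∤
          where
          sum≡ : suc n ℕ.* q-1 ≡ 2 ℕ.^ v ℕ.* suc k ℕ.* q-1 ℕ.+ t′
          sum≡ = trans (sym (trans (cong (suc n ℕ.* q-1 ℕ.+_) (trans (cong (t′ ℕ.*_) E≡0) (ℕₚ.*-zeroʳ t′))) (ℕₚ.+-identityʳ _))) (trans w≡′ (ℕₚ.+-comm t′ _))
        go (suc E′) E≡ = val-injective f (unit r i) (trans (val≡ k eq₁) (sym (val-unit i<r)))
          where
          cancelled : suc n ℕ.* q-1 ℕ.+ t′ ℕ.* E′ ≡ 2 ℕ.^ v ℕ.* suc k ℕ.* q-1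
          cancelled = ℕₚ.+-cancelˡ-≡ t′ _ _ (trans (lemma t′ (suc n ℕ.* q-1) E′) (trans (cong (λ x → suc n ℕ.* q-1 ℕ.+ t′ ℕ.* x) (sym E≡)) w≡′))
            where
            lemma : ∀ t a e → t ℕ.+ (a ℕ.+ t ℕ.* e) ≡ a ℕ.+ t ℕ.* suc e
            lemma = solveℕ
          E′≡0 : E′ ≡ 0
          E′≡0 = no-multiple f E′ (Matching.disjoint m) E≡ (∣.∣m+n∣m⇒∣n (subst (q-1 ∣_) (sym cancelled) (∣.n∣m*n (2 ℕ.^ v ℕ.* suc k))) (∣.n∣m*n (suc n)))
          eq₁ : 2 ℕ.^ i ≡ val f ℕ.+ q-1 ℕ.* k
          eq₁ = trans (sym (trans (cong (2 ℕ.^ i ℕ.*_) (trans E≡ (cong suc E′≡0))) (ℕₚ.*-identityʳ _))) eq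
          val≡ : ∀ k → 2 ℕ.^ i ≡ val f ℕ.+ q-1 ℕ.* k → val f ≡ 2 ℕ.^ i
          val≡ zero eq = sym (trans eq (trans (cong (val f ℕ.+_) (ℕₚ.*-zeroʳ q-1)) (ℕₚ.+-identityʳ _)))
          val≡ (suc k) eq = contradiction (subst (q-1 ℕ.≤_) (sym eq) (ℕₚ.≤-trans (ℕₚ.m≤m*n q-1 (suc k)) (ℕₚ.m≤n+m _ (val f)))) (ℕₚ.<⇒≱ 2^i<q-1)

      u₀ : Bits r
      u₀ = unit r i

      ρu₀ : ρ u₀ ≡ unit r 0
      ρu₀ = rotates-unit i i<r

      -- Here ρ u₀ has the value 1, so `a` has exponent 1 + 1, and both power sums have positive
      -- multiples of q - 1 as exponents.
      σ-unit : σ (ρ u₀) u₀ ≡ a ^ 2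
      σ-unit = finish (diagonal-wExp u₀ XExp≡)
        where
        disj : Disjoint (ρ u₀) u₀
        disj = subst (λ e → Disjoint e u₀) (sym ρu₀) (unit-disjoint r i 1≤i)
        E≡1 : val (ρ u₀) ≡ 1
        E≡1 = trans (cong val ρu₀) (val-unit 1≤r)
        XExp≡ : XExp u₀ u₀ ≡ q-1
        XExp≡ = trans (swap (val (rest (ρ u₀) u₀)) (val u₀) (val (ρ u₀))) (rest-val-ρ u₀ u₀ disj)
          where
          swap : ∀ a b c → a ℕ.+ b ℕ.+ c ≡ a ℕ.+ c ℕ.+ b
          swap = solveℕ
        ∑≡1 : ∀ {N} k → N ≡ suc k ℕ.* q-1 → ∑ (_^ N) ≡ 1#
        ∑≡1 k refl = sum-pow-∣ k
        finish : (∃ λ k → 2 ℕ.^ i ℕ.* val (ρ u₀) ≡ val u₀ ℕ.+ q-1 ℕ.* k × wExp u₀ u₀ ℕ.+ t′ ℕ.* val (ρ u₀) ≡ t′ ℕ.+ 2 ℕ.^ v ℕ.* suc k ℕ.* q-1) →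
          σ (ρ u₀) u₀ ≡ a ^ 2
        finish (k , _ , w≡) = begin
          σ (ρ u₀) u₀ ≡⟨ σ-disjoint u₀ u₀ disj ⟩
          monomial (val (ρ u₀) ℕ.+ val (ρ u₀)) (wExp u₀ u₀) (XExp u₀ u₀) ≡⟨ cong₂ (λ e x → a ^ (e ℕ.+ e) * x) E≡1 (cong₂ _*_ (∑≡1 (pred (2 ℕ.^ v ℕ.* suc k)) wExp≡) (∑≡1 0 (trans XExp≡ (sym (ℕₚ.*-identityˡ q-1))))) ⟩
          a ^ 2 * (1# * 1#) ≡⟨ trans (cong (a ^ 2 *_) (*-identityˡ 1#)) (*-identityʳ _) ⟩
          a ^ 2 ∎
          where
          wExp≡ : wExp u₀ u₀ ≡ suc (pred (2 ℕ.^ v ℕ.* suc k)) ℕ.* q-1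
          wExp≡ = trans (ℕₚ.+-cancelʳ-≡ t′ _ _ (trans (cong (wExp u₀ u₀ ℕ.+_) (sym (trans (cong (t′ ℕ.*_) E≡1) (ℕₚ.*-identityʳ t′)))) (trans w≡ (ℕₚ.+-comm t′ _))))
            (cong (ℕ._* q-1) (sym (ℕₚ.suc-pred _ {{ℕₚ.m*n≢0 (2 ℕ.^ v) (suc k) {{ℕₚ.m^n≢0 2 v}}}})))

      a≡0 : a ≡ 0#
      a≡0 = ^-integral 2 (begin
        a ^ 2 ≡⟨ σ-unit ⟨
        σ (ρ u₀) u₀ ≡⟨ Σᵇ-single r u₀ off-diagonal ⟨
        Σᵇ r (λ f → σ (ρ f) f) ≡⟨ Σᵇ-symmetric r (λ f g → σ (ρ f) g) σ-symmetric ⟨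
        Σᵇ r (λ f → Σᵇ r (σ (ρ f))) ≡⟨ Σᵇ-rotates r i (λ e → Σᵇ r (σ e)) ⟨
        Σᵇ r (λ e → Σᵇ r (σ e)) ≡⟨ σ-total ⟩
        0# ∎)
        where
        off-diagonal : ∀ f → f ≢ u₀ → σ (ρ f) f ≡ 0#
        off-diagonal f f≢u₀ with σ (ρ f) f ≟ 0#
        ... | yes eq = eq
        ... | no ne = contradiction (matching⇒unit f (σ≢0⇒matching f f ne)) f≢u₀

-- From planarity to the two weight arguments.

module PlanarMonomials {r : ℕ} (F : Field (2 ℕ.^ r)) (1≤r : 1 ℕ.≤ r) where
  open FieldTheory F 1≤r
  open Trace F 1≤r
  open ≡-Reasoning

  D : K → ℕ → K → K → K
  D a t b c = (a * (c + b) ^ t + a * c ^ t) + b * c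

  -- On a finite field this is planarity, since injective maps are bijective.
  InjectiveD : K → ℕ → Set
  InjectiveD a t = ∀ b → b ≢ 0# → ∀ c c′ → D a t b c ≡ D a t b c′ → c ≡ c′

  D-2^ : ∀ a k b c → D a (2 ℕ.^ k) b c ≡ b * c + a * φ k b
  D-2^ a k b c = trans (cong (λ x → (a * x + a * φ k c) + b * c) (φ-+ k c b))
    (trans (lemma a (φ k c) (φ k b) (b * c)) (trans (cong (_+ (b * c + a * φ k b)) (x+x≡0 _)) (+-identityˡ _)))
    where
    lemma : ∀ a x y z → (a * (x + y) + a * x) + z ≡ (a * x + a * x) + (z + a * y)
    lemma = solveF 4 (λ a x y z → (a ⊗ (x ⊕ y) ⊕ a ⊗ x) ⊕ z ⊜ (a ⊗ x ⊕ a ⊗ x) ⊕ (z ⊕ a ⊗ y)) refl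

  powerOf2⇒injective : ∀ a k → InjectiveD a (2 ℕ.^ k)
  powerOf2⇒injective a k b b≢0 c c′ eq = *-cancelˡ b≢0 (R.+-cancelʳ (a * φ k b) _ _ (trans (sym (D-2^ a k b c)) (trans eq (D-2^ a k b c′))))

  -- D(b, c) + D(b, 0) is the bilinear form, so a nontrivial zero would give c and 0 the same image.
  injective⇒nonvanishing : ∀ a v i → InjectiveD a (2 ℕ.^ v ℕ.+ 2 ℕ.^ (v ℕ.+ i)) →
    ∀ b c → b ≢ 0# → c ≢ 0# → a * (φ (v ℕ.+ i) b * φ v c + φ v b * φ (v ℕ.+ i) c) + b * c ≢ 0#
  injective⇒nonvanishing a v i inj b c b≢0 c≢0 eq = c≢0 (inj b b≢0 c 0# (begin
    D a t b c ≡⟨ cong₂ (λ x y → (a * x + a * y) + b * c) (trans (^-homo-* (c + b) (2 ℕ.^ v) (2 ℕ.^ s)) (cong₂ _*_ (φ-+ v c b) (φ-+ s c b))) (^-homo-* c (2 ℕ.^ v) (2 ℕ.^ s)) ⟩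
    (a * ((φ v c + φ v b) * (φ s c + φ s b)) + a * (φ v c * φ s c)) + b * c ≡⟨ lemma₁ a (φ v c) (φ v b) (φ s c) (φ s b) (b * c) ⟩
    (B + a * (φ v b * φ s b)) + (a * (φ v c * φ s c) + a * (φ v c * φ s c)) ≡⟨ trans (cong₂ (λ x y → (x + a * (φ v b * φ s b)) + y) eq (x+x≡0 _)) (trans (+-identityʳ _) (+-identityˡ _)) ⟩
    a * (φ v b * φ s b) ≡⟨ cong (a *_) (^-homo-* b (2 ℕ.^ v) (2 ℕ.^ s)) ⟨
    a * b ^ t ≡⟨ trans (+-identityʳ _) (+-identityʳ _) ⟨
    (a * b ^ t + 0#) + 0# ≡⟨ cong₂ _+_ (cong₂ _+_ (cong (λ x → a * x ^ t) (+-identityˡ b)) (trans (cong (a *_) (0^ 0<t)) (zeroʳ a))) (zeroʳ b) ⟨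
    D a t b 0# ∎))
    where
    s t : ℕ
    s = v ℕ.+ i
    t = 2 ℕ.^ v ℕ.+ 2 ℕ.^ s
    0<t : 0 ℕ.< t
    0<t = ℕₚ.≤-trans (ℕₚ.m^n>0 2 v) (ℕₚ.m≤m+n _ (2 ℕ.^ s))
    B : K
    B = a * (φ s b * φ v c + φ v b * φ s c) + b * c
    lemma₁ : ∀ a x y z w u → (a * ((x + y) * (z + w)) + a * (x * z)) + u ≡ ((a * (w * x + y * z) + u) + a * (y * w)) + (a * (x * z) + a * (x * z))
    lemma₁ = solveF 6 (λ a x y z w u → (a ⊗ ((x ⊕ y) ⊗ (z ⊕ w)) ⊕ a ⊗ (x ⊗ z)) ⊕ u ⊜ ((a ⊗ (w ⊗ x ⊕ y ⊗ z) ⊕ u) ⊕ a ⊗ (y ⊗ w)) ⊕ (a ⊗ (x ⊗ z) ⊕ a ⊗ (x ⊗ z))) refl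

  module _ (t′ : ℕ) (1≤t′ : 1 ℕ.≤ t′) (a : K) (inj : InjectiveD a (2 ℕ.+ t′)) where
    open Spectrum F 1≤r t′
    open CharacterSums F 1≤r using (χ; 0ᴳ)

    -- By homogeneity the difference map of a x^t with step zb at zy is z² times the argument of χ
    -- in `Flat`; its values form a permutation, over which a nontrivial character sums to 0.
    injective⇒flat : ∀ z → Flat (a * z ^ t′)
    injective⇒flat z with z ≟ 0#
    ... | yes refl = subst Flat (sym (trans (cong (a *_) (0^ 1≤t′)) (zeroʳ a))) Flat-0
    ... | no z≢0 = λ b b≢0 → let
        f : K → K
        f y = D a t (z * b) (z * y)
        f-inj : ∀ {y y′} → f y ≡ f y′ → y ≡ y′
        f-inj {y} {y′} eq = *-cancelˡ z≢0 (inj (z * b) (*-nonzero z≢0 b≢0) (z * y) (z * y′) eq)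
        f⁻¹ = λ y → proj₁ (injective⇒surjective f f-inj y)
        ff⁻¹ = λ y → proj₂ (injective⇒surjective f f-inj y)
      in trans (GS.sum-cong-≗ λ y → cong χ (sym (scaled b y)))
        (trans (sym (GS.sum-reindex f f⁻¹ ff⁻¹ (λ y → f-inj (ff⁻¹ (f y))) (λ y → χ ((x * x) * y)))) (χ-sum (*-nonzero x≢0 x≢0)))
      where
      x : K
      x = z ⁻¹
      x≢0 : x ≢ 0#
      x≢0 = ^-nonzero (neg2^ 0) z≢0
      scaled : ∀ b y → (x * x) * D a t (z * b) (z * y) ≡ (a * z ^ t′) * ((y + b) ^ t + y ^ t) + y * b
      scaled b y = begin
        (x * x) * D a t (z * b) (z * y) ≡⟨ cong₂ (λ p q → (x * x) * ((a * p + a * q) + (z * b) * (z * y)))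
          (trans (cong (_^ t) (sym (distribˡ z y b))) (^-distrib-* z (y + b) t)) (^-distrib-* z y t) ⟩
        (x * x) * ((a * ((z * (z * z ^ t′)) * (y + b) ^ t) + a * ((z * (z * z ^ t′)) * y ^ t)) + (z * b) * (z * y))
          ≡⟨ lemma x z (z ^ t′) a ((y + b) ^ t) (y ^ t) b y ⟩
        ((z * x) * (z * x)) * ((a * z ^ t′) * ((y + b) ^ t + y ^ t) + y * b) ≡⟨ cong (λ e → (e * e) * ((a * z ^ t′) * ((y + b) ^ t + y ^ t) + y * b)) (x*x⁻¹ z≢0) ⟩
        (1# * 1#) * ((a * z ^ t′) * ((y + b) ^ t + y ^ t) + y * b) ≡⟨ trans (cong (λ e → e * ((a * z ^ t′) * ((y + b) ^ t + y ^ t) + y * b)) (*-identityˡ 1#)) (*-identityˡ _) ⟩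
        (a * z ^ t′) * ((y + b) ^ t + y ^ t) + y * b ∎
        where
        lemma : ∀ x z Z a p q b y → (x * x) * ((a * ((z * (z * Z)) * p) + a * ((z * (z * Z)) * q)) + (z * b) * (z * y)) ≡ ((z * x) * (z * x)) * ((a * Z) * (p + q) + y * b)
        lemma = solveF 8 (λ x z Z a p q b y → (x ⊗ x) ⊗ ((a ⊗ ((z ⊗ (z ⊗ Z)) ⊗ p) ⊕ a ⊗ ((z ⊗ (z ⊗ Z)) ⊗ q)) ⊕ (z ⊗ b) ⊗ (z ⊗ y)) ⊜ ((z ⊗ x) ⊗ (z ⊗ x)) ⊗ ((a ⊗ Z) ⊗ (p ⊕ q) ⊕ y ⊗ b)) refl

  open Averaging F 1≤r using (total)

  total-map-suc : ∀ {n} (bs : Vec ℕ n) → total (Vec.map suc bs) ≡ 2 ℕ.* total bs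
  total-map-suc [] = refl
  total-map-suc (b ∷ bs) = trans (cong (2 ℕ.^ suc b ℕ.+_) (total-map-suc bs)) (sym (ℕₚ.*-distribˡ-+ 2 (2 ℕ.^ b) (total bs)))

  parity : ∀ n → ∃ λ m → n ≡ 2 ℕ.* m ⊎ n ≡ 1 ℕ.+ 2 ℕ.* m
  parity zero = 0 , inj₁ refl
  parity (suc n) with parity n
  ... | m , inj₁ eq = m , inj₂ (cong suc eq)
  ... | m , inj₂ eq = suc m , inj₁ (trans (cong suc eq) (sym (ℕₚ.*-suc 2 m)))

  BinaryExpansion : ℕ → Set
  BinaryExpansion n = ∃ λ k → ∃ λ (bs : Vec ℕ k) → AllPairs ℕ._<_ bs × total bs ≡ n

  binaryExpansion : ∀ n → BinaryExpansion n
  binaryExpansion = <-rec BinaryExpansion expand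
    where
    expand : ∀ n → (∀ {m} → m ℕ.< n → BinaryExpansion m) → BinaryExpansion n
    expand zero _ = 0 , [] , [] , refl
    expand (suc n) rec with parity (suc n)
    ... | m , inj₁ eq = let
        m<n : m ℕ.< suc n
        m<n = subst (m ℕ.<_) (sym eq) (ℕₚ.m<m+n m (subst (0 ℕ.<_) (sym (ℕₚ.+-identityʳ m)) (ℕₚ.n≢0⇒n>0 λ m≡0 → contradiction (trans eq (cong (2 ℕ.*_) m≡0)) λ ())))
        (k , bs , sorted , total≡) = rec m<n
      in k , Vec.map suc bs , AllPairsₚ.map⁺ (AllPairs.map s≤s sorted) , trans (total-map-suc bs) (trans (cong (2 ℕ.*_) total≡) (sym eq))
    ... | m , inj₂ eq = let
        (k , bs , sorted , total≡) = rec (subst (m ℕ.<_) (sym eq) (s≤s (ℕₚ.m≤m+n m _)))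
      in suc k , 0 ∷ Vec.map suc bs , Allₚ.map⁺ (All.universal (λ _ → s≤s z≤n) bs) ∷ AllPairsₚ.map⁺ (AllPairs.map s≤s sorted) ,
         cong suc (trans (total-map-suc bs) (trans (cong (2 ℕ.*_) total≡) (sym (ℕₚ.suc-injective eq))))

  2^≤total : ∀ {n} (bs : Vec ℕ n) → All (λ b → 2 ℕ.^ b ℕ.≤ total bs) bs
  2^≤total [] = []
  2^≤total (b ∷ bs) = ℕₚ.m≤m+n _ _ ∷ All.map (λ le → ℕₚ.≤-trans le (ℕₚ.m≤n+m _ (2 ℕ.^ b))) (2^≤total bs)

  module _ (t′ : ℕ) (1≤t′ : 1 ℕ.≤ t′) (t⁴≤q : (2 ℕ.+ t′) ℕ.^ 4 ℕ.≤ 2 ℕ.^ r) (a : K) (a≢0 : a ≢ 0#) (inj : InjectiveD a (2 ℕ.+ t′)) where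
    t : ℕ
    t = 2 ℕ.+ t′

    2^-reflect-≤ : ∀ {m n} → 2 ℕ.^ m ℕ.≤ 2 ℕ.^ n → m ℕ.≤ n
    2^-reflect-≤ {m} {n} le with ℕₚ.≤-<-connex m n
    ... | inj₁ m≤n = m≤n
    ... | inj₂ n<m = contradiction le (ℕₚ.<⇒≱ (ℕₚ.^-monoʳ-< 2 ℕₚ.≤-refl n<m))

    2^-reflect-< : ∀ {m n} → 2 ℕ.^ m ℕ.< 2 ℕ.^ n → m ℕ.< n
    2^-reflect-< {m} {n} lt with ℕₚ.<-≤-connex m n
    ... | inj₁ m<n = m<n
    ... | inj₂ n≤m = contradiction (ℕₚ.^-monoʳ-≤ 2 n≤m) (ℕₚ.<⇒≱ lt)

    -- t ≥ 3 and 3⁴ = 81 > 64 = 2^6.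
    7≤r : 7 ℕ.≤ r
    7≤r = 2^-reflect-< (ℕₚ.≤-trans (ℕₚ.≤-trans (ℕₚ.m≤m+n 65 16) (ℕₚ.^-monoˡ-≤ 4 (s≤s (s≤s 1≤t′)))) t⁴≤q)

    4b≤r : ∀ {b} → 2 ℕ.^ b ℕ.≤ t → b ℕ.* 4 ℕ.≤ r
    4b≤r {b} le = 2^-reflect-≤ (ℕₚ.≤-trans (ℕₚ.≤-reflexive (sym (ℕₚ.^-*-assoc 2 b 4))) (ℕₚ.≤-trans (ℕₚ.^-monoˡ-≤ 4 le) t⁴≤q))

    4b<r : ∀ {b} → 2 ℕ.^ b ℕ.< t → b ℕ.* 4 ℕ.< r
    4b<r {b} lt = 2^-reflect-< (ℕₚ.<-≤-trans (subst (ℕ._< t ℕ.^ 4) (ℕₚ.^-*-assoc 2 b 4) (ℕₚ.^-monoˡ-< 4 lt)) t⁴≤q)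

    b<r-1 : ∀ {b} → 2 ℕ.^ b ℕ.≤ t → b ℕ.< pred r
    b<r-1 {zero} _ = ℕₚ.≤-trans (s≤s z≤n) (ℕₚ.pred-mono-≤ 7≤r)
    b<r-1 {suc b} le = ℕₚ.pred-mono-≤ (ℕₚ.≤-trans (s≤s (s≤s (s≤s (ℕₚ.≤-trans (ℕₚ.m≤m*n b 4) (ℕₚ.n≤1+n _))))) (4b≤r {suc b} le))

    b<r : ∀ {b} → 2 ℕ.^ b ℕ.≤ t → b ℕ.< r
    b<r le = ℕₚ.<-≤-trans (b<r-1 le) (ℕₚ.pred[n]≤n {r})

    t≤t⁴ : t ℕ.≤ t ℕ.^ 4
    t≤t⁴ = ℕₚ.m≤m*n t (t ℕ.^ 3) {{ℕₚ.m^n≢0 t 3}}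

    t′²<q : t′ ℕ.* t′ ℕ.< 2 ℕ.^ r
    t′²<q = ℕₚ.<-≤-trans (ℕₚ.*-mono-< t′<t t′<t) (ℕₚ.≤-trans
      (ℕₚ.*-monoʳ-≤ t (ℕₚ.m≤m*n t (t ℕ.^ 2) {{ℕₚ.m^n≢0 t 2}})) t⁴≤q)
      where
      t′<t : t′ ℕ.< t
      t′<t = ℕₚ.m≤n+m (suc t′) 1

    t′<q-1 : t′ ℕ.< q-1
    t′<q-1 = ℕₚ.≤-pred (subst (t ℕ.≤_) q≡ (ℕₚ.≤-trans t≤t⁴ t⁴≤q))

    weight-three : ∀ {n} k (bs : Vec ℕ (3 ℕ.+ n)) → k ℕ.< r → All (ℕ._< r) bs → AllPairs _≢_ bs → All (_≢ 1) bs →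
      total bs ≡ 2 ℕ.^ k ℕ.+ t′ → ⊥
    weight-three k bs k<r bs<r distinct 1∉bs total≡ = a≢0 (WeightThree.flat⇒a≡0 F 1≤r t′ (ℕₚ.≤-trans (s≤s (s≤s z≤n)) 7≤r) 1≤t′ t′²<q
      k bs k<r bs<r distinct 1∉bs total≡ a (s≤s (s≤s (s≤s z≤n))) (injective⇒flat t′ 1≤t′ a inj))

    weight-two : ∀ v i → t ≡ 2 ℕ.^ v ℕ.+ 2 ℕ.^ (v ℕ.+ suc i) → ⊥
    weight-two v i t≡ = a≢0 (by-cases v refl)
      where
      s : ℕ
      s = v ℕ.+ suc i
      2^s<t : 2 ℕ.^ s ℕ.< t
      2^s<t = subst (2 ℕ.^ s ℕ.<_) (sym t≡) (ℕₚ.m<n+m (2 ℕ.^ s) (ℕₚ.m^n>0 2 v))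
      i<r : suc i ℕ.< r
      i<r = ℕₚ.≤-<-trans (ℕₚ.m≤n+m (suc i) v) (b<r {s} (ℕₚ.<⇒≤ 2^s<t))
      nonvanishing = injective⇒nonvanishing a v (suc i) (subst (InjectiveD a) t≡ inj)
      r≡ : r ≡ r ℕ.∸ s ℕ.+ s
      r≡ = sym (ℕₚ.m∸n+n≡m (ℕₚ.<⇒≤ (b<r {s} (ℕₚ.<⇒≤ 2^s<t))))
      use : ∀ ε l → 1 ℕ.≤ ε → t′ ℕ.≤ 2 ℕ.^ ε → v ℕ.+ l ≡ suc (ε ℕ.+ suc i) → ε ℕ.+ l ℕ.+ s ℕ.≤ suc (s ℕ.* 4) → a ≡ 0#
      use ε l 1≤ε t′≤ v+l≡ room = WeightTwo.a≡0 F 1≤r v (suc i) t′ (s≤s z≤n) i<r 1≤t′ t′<q-1 (sym t≡) a nonvanishing ε l (r ℕ.∸ s) 1≤ε t′≤ v+l≡ r≡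
        (ℕₚ.m+n≤o⇒m≤o∸n (ε ℕ.+ l) (ℕₚ.≤-trans room (4b<r {s} 2^s<t)))
      by-cases : ∀ v′ → v ≡ v′ → a ≡ 0#
      -- Here t′ = 2^s - 1, so ε = s suffices, and the room ε + l + s = 4s + 1 is used up exactly.
      by-cases zero refl = use (suc i) (suc (suc i ℕ.+ suc i)) (s≤s z≤n)
        (ℕₚ.≤-trans (ℕₚ.n≤1+n t′) (ℕₚ.≤-reflexive (ℕₚ.suc-injective t≡))) refl (ℕₚ.≤-reflexive (lemma i))
        where
        lemma : ∀ i → suc i ℕ.+ suc (suc i ℕ.+ suc i) ℕ.+ suc i ≡ suc (suc i ℕ.* 4)
        lemma = solveℕ
      -- Now t ≤ 2 · 2^s bounds t′, whence ε = s + 1; the room has a slack of 2v′.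
      by-cases (suc v′) refl = use (suc s) (suc i ℕ.+ suc i ℕ.+ 2) (s≤s z≤n)
        (ℕₚ.≤-trans (ℕₚ.m≤n+m t′ 2) (ℕₚ.≤-trans (ℕₚ.≤-reflexive t≡) (ℕₚ.≤-trans (ℕₚ.+-monoˡ-≤ (2 ℕ.^ s) (ℕₚ.^-monoʳ-≤ 2 (ℕₚ.m≤m+n v (suc i))))
          (ℕₚ.≤-reflexive (cong (2 ℕ.^ s ℕ.+_) (sym (ℕₚ.+-identityʳ _)))))))
        (lemma₁ v′ i) (ℕₚ.≤-trans (ℕₚ.m≤m+n _ (v′ ℕ.+ v′)) (ℕₚ.≤-reflexive (lemma₂ v′ i)))
        where
        lemma₁ : ∀ v i → suc v ℕ.+ (suc i ℕ.+ suc i ℕ.+ 2) ≡ suc (suc (suc v ℕ.+ suc i) ℕ.+ suc i)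
        lemma₁ = solveℕ
        lemma₂ : ∀ v i → suc (suc v ℕ.+ suc i) ℕ.+ (suc i ℕ.+ suc i ℕ.+ 2) ℕ.+ (suc v ℕ.+ suc i) ℕ.+ (v ℕ.+ v) ≡ suc ((suc v ℕ.+ suc i) ℕ.* 4)
        lemma₂ = solveℕ

    sorted⇒distinct : ∀ {n} {bs : Vec ℕ n} → AllPairs ℕ._<_ bs → AllPairs _≢_ bs
    sorted⇒distinct = AllPairs.map ℕₚ.<⇒≢

    below : ∀ {n} {bs : Vec ℕ n} {m} → total bs ℕ.≤ m → All (λ b → 2 ℕ.^ b ℕ.≤ m) bs
    below {bs = bs} le = All.map (λ le′ → ℕₚ.≤-trans le′ le) (2^≤total bs)

    -- If 2 occurs in t, it is traded for the summand 2^(r-1), which exceeds all others.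
    with-top : ∀ {n} (bs : Vec ℕ (2 ℕ.+ n)) → AllPairs ℕ._<_ bs → All (_≢ 1) bs → total bs ≡ t′ → ⊥
    with-top bs sorted 1∉bs total≡ = weight-three (pred r) (pred r ∷ bs) r-1<r (r-1<r ∷ All.map b<r bs≤t)
      (All.map (λ le → ℕₚ.>⇒≢ (b<r-1 le)) bs≤t ∷ sorted⇒distinct sorted)
      (ℕₚ.>⇒≢ (ℕₚ.≤-trans (s≤s (s≤s z≤n)) (ℕₚ.pred-mono-≤ 7≤r)) ∷ 1∉bs) (cong (2 ℕ.^ pred r ℕ.+_) total≡)
      where
      bs≤t = below {bs = bs} (ℕₚ.≤-trans (ℕₚ.≤-reflexive total≡) (ℕₚ.m≤n+m t′ 2))
      r-1<r : pred r ℕ.< r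
      r-1<r = ℕₚ.≤-reflexive (ℕₚ.suc-pred r {{ℕ.>-nonZero 1≤r}})

    -- The digits of t itself serve as exponents, because t = 2^1 + t′ has the required form with k
    -- = 1.
    without-2 : ∀ {n} (bs : Vec ℕ (3 ℕ.+ n)) → AllPairs ℕ._<_ bs → All (_≢ 1) bs → total bs ≡ t → ⊥
    without-2 bs sorted 1∉bs total≡ = weight-three 1 bs (ℕₚ.≤-trans (s≤s (s≤s z≤n)) 7≤r)
      (All.map b<r (below {bs = bs} (ℕₚ.≤-reflexive total≡))) (sorted⇒distinct sorted) 1∉bs total≡

    -- With three or more sorted exponents, 1 can only be among the first two; its presence decides
    -- between trading it for r - 1 and keeping the digits of t.
    injective⇒powerOf2 : IsPowerOf2 t
    injective⇒powerOf2 with binaryExpansion t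
    ... | _ , [] , _ , ()
    ... | _ , s ∷ [] , _ , total≡ = s , trans (sym total≡) (ℕₚ.+-identityʳ _)
    ... | _ , v ∷ s ∷ [] , (v<s ∷ []) ∷ _ , total≡ = ⊥-elim (weight-two v (s ℕ.∸ suc v) (trans (sym total≡)
          (cong (2 ℕ.^ v ℕ.+_) (trans (ℕₚ.+-identityʳ _) (cong (2 ℕ.^_) (sym (trans (ℕₚ.+-suc v _) (ℕₚ.m+[n∸m]≡n v<s))))))))
    ... | _ , bs@(suc (suc _) ∷ _ ∷ _ ∷ _) , sorted@(b<bs ∷ _) , total≡ =
          ⊥-elim (without-2 bs sorted ((λ ()) ∷ All.map (λ { (s≤s (s≤s _)) () }) b<bs) total≡)
    ... | _ , 1 ∷ bs@(_ ∷ _ ∷ _) , 1<bs ∷ sorted , total≡ =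
          ⊥-elim (with-top bs sorted (All.map ℕₚ.>⇒≢ 1<bs) (ℕₚ.+-cancelˡ-≡ 2 _ _ total≡))
    ... | _ , 0 ∷ 0 ∷ _ ∷ _ , (() ∷ _) ∷ _ , _
    ... | _ , bs@(0 ∷ suc (suc _) ∷ _ ∷ _) , sorted@(_ ∷ b<bs ∷ _) , total≡ =
          ⊥-elim (without-2 bs sorted ((λ ()) ∷ (λ ()) ∷ All.map (λ { (s≤s (s≤s _)) () }) b<bs) total≡)
    ... | _ , 0 ∷ 1 ∷ bs@(_ ∷ _) , (_ ∷ 0<bs) ∷ 1<bs ∷ sorted , total≡ =
          ⊥-elim (with-top (0 ∷ bs) (0<bs ∷ sorted) ((λ ()) ∷ All.map ℕₚ.>⇒≢ 1<bs) (ℕₚ.+-cancelˡ-≡ 2 _ _ (trans (lemma (total bs)) total≡)))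
      where
      lemma : ∀ x → 2 ℕ.+ (1 ℕ.+ x) ≡ 1 ℕ.+ (2 ℕ.+ x)
      lemma = solveℕ

  injective⇒isPowerOf2 : ∀ t → 1 ℕ.≤ t → t ℕ.^ 4 ℕ.≤ 2 ℕ.^ r → ∀ a → a ≢ 0# → InjectiveD a t → IsPowerOf2 t
  injective⇒isPowerOf2 1 _ _ _ _ _ = 0 , refl
  injective⇒isPowerOf2 2 _ _ _ _ _ = 1 , refl
  injective⇒isPowerOf2 (suc (suc t′@(suc _))) _ t⁴≤q a a≢0 inj = injective⇒powerOf2 t′ (s≤s z≤n) t⁴≤q a a≢0 inj

-- Transport between a given finite field and its enumerated copy.

module Enumeration {r : ℕ} (F : FiniteField (2 ℕ.^ r)) where
  private module F = FiniteField F
  open F using (Carrier; enum; _≈_; pow)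

  index : Carrier → Fin (2 ℕ.^ r)
  index x = proj₁ (F.enum-surj x)

  enum-index : ∀ x → enum (index x) ≈ x
  enum-index x = proj₂ (F.enum-surj x)

  rawRing : RawRing 0ℓ 0ℓ
  rawRing = record
    { Carrier = Fin (2 ℕ.^ r) ; _≈_ = _≡_
    ; _+_ = λ i j → index (enum i F.+ enum j) ; _*_ = λ i j → index (enum i F.* enum j)
    ; -_ = λ i → index (F.- enum i) ; 0# = index F.0# ; 1# = index F.1# }

  enum-cong : ∀ {i j} → i ≡ j → enum i ≈ enum j
  enum-cong refl = F.refl

  -- The ring laws on indices are pulled back along `enum`, which turns `≈` into propositional
  -- equality.
  enum-isRingMonomorphism : IsRingMonomorphism rawRing (CommutativeRing.rawRing F.commRing) enum
  enum-isRingMonomorphism = record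
    { isRingHomomorphism = record
      { isSemiringHomomorphism = record
        { isNearSemiringHomomorphism = record
          { +-isMonoidHomomorphism = record
            { isMagmaHomomorphism = record { isRelHomomorphism = record { cong = enum-cong } ; homo = λ _ _ → enum-index _ }
            ; ε-homo = enum-index F.0# }
          ; *-homo = λ _ _ → enum-index _ }
        ; 1#-homo = enum-index F.1# }
      ; -‿homo = λ _ → enum-index _ }
    ; injective = F.enum-inj _ _ }

  field′ : Field (2 ℕ.^ r)
  field′ = record
    { isCommutativeRing = RingMono.isCommutativeRing enum-isRingMonomorphism F.isCommutativeRing
    ; 0≢1 = λ eq → F.0≉1 (F.trans (F.sym (enum-index F.0#)) (F.trans (enum-cong eq) (enum-index F.1#)))
    ; inverse = λ i i≢0 → let (y , eq) = F.inverse (enum i) (λ i≈0 → i≢0 (F.enum-inj _ _ (F.trans i≈0 (F.sym (enum-index F.0#))))) in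
        index y , F.enum-inj _ _ (F.trans (enum-index _) (F.trans (F.*-congˡ (enum-index y)) (F.trans eq (F.sym (enum-index F.1#)))))
    }

  module _ (1≤r : 1 ℕ.≤ r) where
    open FieldTheory field′ 1≤r
    open PlanarMonomials field′ 1≤r

    enum-0 : ∀ {x} → ¬ (x ≈ F.0#) → index x ≢ 0#
    enum-0 {x} x≉0 eq = x≉0 (F.trans (F.sym (enum-index x)) (F.trans (enum-cong eq) (enum-index F.0#)))

    enum-^ : ∀ i n → enum (i ^ n) ≈ pow (enum i) n
    enum-^ i zero = enum-index F.1#
    enum-^ i (suc n) = F.trans (enum-index _) (F.*-congˡ (enum-^ i n))

    pow-cong : ∀ {x y} n → x ≈ y → pow x n ≈ pow y n
    pow-cong zero _ = F.refl
    pow-cong (suc n) eq = F.*-cong eq (pow-cong n eq)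

    Δ : Carrier → ℕ → Carrier → Carrier → Carrier
    Δ a t b c = ((a F.* pow (c F.+ b) t) F.+ (a F.* pow c t)) F.+ b F.* c

    Δ-cong : ∀ {a a′ b b′ c c′} t → a ≈ a′ → b ≈ b′ → c ≈ c′ → Δ a t b c ≈ Δ a′ t b′ c′
    Δ-cong t a≈ b≈ c≈ = F.+-cong (F.+-cong (F.*-cong a≈ (pow-cong t (F.+-cong c≈ b≈))) (F.*-cong a≈ (pow-cong t c≈))) (F.*-cong b≈ c≈)

    enum-D : ∀ a t b c → enum (D a t b c) ≈ Δ (enum a) t (enum b) (enum c)
    enum-D a t b c = F.trans (enum-index _) (F.+-cong (F.trans (enum-index _) (F.+-cong
      (F.trans (enum-index _) (F.*-congˡ (F.trans (enum-^ _ t) (pow-cong t (enum-index _)))))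
      (F.trans (enum-index _) (F.*-congˡ (enum-^ c t))))) (enum-index _))

    planar⇒injective : ∀ a t → Planar F (λ c → a F.* pow c t) → InjectiveD (index a) t
    planar⇒injective a t planar b b≢0 c c′ eq = F.enum-inj c c′ (proj₁ (planar (enum b) b≉0)
      (F.trans (F.sym (step c)) (F.trans (enum-cong eq) (step c′))))
      where
      b≉0 : ¬ (enum b ≈ F.0#)
      b≉0 b≈0 = b≢0 (F.enum-inj _ _ (F.trans b≈0 (F.sym (enum-index F.0#))))
      step : ∀ c → enum (D (index a) t b c) ≈ Δ a t (enum b) (enum c)
      step c = F.trans (enum-D (index a) t b c) (Δ-cong t (enum-index a) F.refl F.refl)

    injective⇒planar : ∀ a t → InjectiveD (index a) t → Planar F (λ c → a F.* pow c t)
    injective⇒planar a t inj b b≉0 =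
        (λ {x} {y} eq → F.trans (F.sym (enum-index x)) (F.trans (enum-cong (inj (index b) (enum-0 b≉0) (index x) (index y)
          (F.enum-inj _ _ (F.trans (step (index x)) (F.trans (Δ-cong t F.refl F.refl (enum-index x)) (F.trans eq
            (F.trans (Δ-cong t F.refl F.refl (F.sym (enum-index y))) (F.sym (step (index y))))))))) ) (enum-index y)))
      , λ y → let (c , eq) = injective⇒surjective (D (index a) t (index b)) (λ {c} {c′} → inj (index b) (enum-0 b≉0) c c′) (index y) in
          enum c , λ z≈c → F.trans (Δ-cong t F.refl F.refl z≈c) (F.trans (F.sym (step c)) (F.trans (enum-cong eq) (enum-index y)))
      where
      step : ∀ c → enum (D (index a) t (index b) c) ≈ Δ a t b (enum c)
      step c = F.trans (enum-D (index a) t (index b) c) (Δ-cong t (enum-index a) (enum-index b) F.refl)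

open import Data.Nat using (_^_; _≤_)

theorem1 : (r : ℕ) → 1 ≤ r → (t : ℕ) → 1 ≤ t → t ^ 4 ≤ 2 ^ r →
    (F : FiniteField (2 ^ r)) → (a : FiniteField.Carrier F) →
    ¬ (FiniteField._≈_ F a (FiniteField.0# F)) →
    Planar F (λ c → FiniteField._*_ F a (FiniteField.pow F c t)) ⇔ IsPowerOf2 t
theorem1 r 1≤r t 1≤t t⁴≤q F a a≉0 = mk⇔
  (λ planar → injective⇒isPowerOf2 t 1≤t t⁴≤q (index a) (enum-0 1≤r a≉0) (planar⇒injective 1≤r a t planar))
  (λ { (k , refl) → injective⇒planar 1≤r a (2 ^ k) (powerOf2⇒injective (index a) k) })
  where
  open Enumeration {r} F
  open PlanarMonomials {r} field′ 1≤r using (injective⇒isPowerOf2; powerOf2⇒injective)
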